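{- Let $G^\sigma$ be a signed graph whose adjacency matrix has all but at most two eigenvalues (counted with multiplicity) equal to $\pm 1$. If the underlying graph $G$ is disconnected and has no isolated edges (no connected component equal to $K_2$), then $G^\sigma$ is the disjoint union of two signed graphs, each of which is switching isomorphic with an unsigned complete graph or with the negative of an unsigned complete graph.
   Context: A signed graph $G^\sigma$ is a finite simple graph $G$ with a signature $\sigma:E(G)\to\{ -1,+1\}$; its adjacency matrix $A$ has $A_{uv}=\sigma(\{u,v\})$ for edges and $0$ otherwise. The negative of a signed graph has adjacency matrix $-A$. Switching with respect to a vertex subset $X$ changes the sign of every edge between $X$ and $V\setminus X$; two signed graphs are switching isomorphic if one can be switched into an isomorphic copy of the other. An unsigned graph is regarded as a signed graph with all edges positive. -}

module Defs where

open import Data.Nat as ℕ using (ℕ; zero; suc; _≤_; _∸_)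
open import Data.Integer as ℤ using (ℤ; 0ℤ; 1ℤ; -1ℤ)
open import Data.Fin as Fin using (Fin; punchIn; splitAt)
open import Data.List using (List; []; _∷_; map)
open import Data.Bool using (Bool; true; false; if_then_else_; _xor_)
open import Data.Sum using (_⊎_; inj₁; inj₂)
open import Data.Product using (Σ; ∃; _×_; _,_)
open import Relation.Nullary using (¬_; does)
open import Relation.Binary.PropositionalEquality using (_≡_)
open import Relation.Binary.Construct.Closure.ReflexiveTransitive using (Star)
open import Function.Bundles using (_↔_; Inverse)

-- Integer polynomials as coefficient lists (lowest degree first)

Poly : Set
Poly = List ℤ

infixl 6 _+P_
infixl 7 _*P_

_+P_ : Poly → Poly → Poly
[]      +P q       = q
(a ∷ p) +P []      = a ∷ p
(a ∷ p) +P (b ∷ q) = (a ℤ.+ b) ∷ (p +P q)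

scaleP : ℤ → Poly → Poly
scaleP c p = map (c ℤ.*_) p

_*P_ : Poly → Poly → Poly
[]      *P q = []
(a ∷ p) *P q = scaleP a q +P (0ℤ ∷ (p *P q))

oneP : Poly
oneP = 1ℤ ∷ []

powP : Poly → ℕ → Poly
powP p zero    = oneP
powP p (suc k) = p *P powP p k

coeff : Poly → ℕ → ℤ
coeff []      k       = 0ℤ
coeff (a ∷ p) zero    = a
coeff (a ∷ p) (suc k) = coeff p k

_≈P_ : Poly → Poly → Set
p ≈P q = ∀ k → coeff p k ≡ coeff q k

_∣P_ : Poly → Poly → Set
p ∣P q = Σ Poly λ r → (p *P r) ≈P q

altSign : ℕ → ℤ
altSign zero    = 1ℤ
altSign (suc k) = ℤ.- altSign k

sumFin : ∀ {n} → (Fin n → Poly) → Poly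
sumFin {zero}  f = []
sumFin {suc n} f = f Fin.zero +P sumFin (λ i → f (Fin.suc i))

det : ∀ n → (Fin n → Fin n → Poly) → Poly
det zero    M = oneP
det (suc n) M = sumFin λ j →
  scaleP (altSign (Fin.toℕ j))
         (M Fin.zero j *P det n (λ i k → M (Fin.suc i) (punchIn j k)))

Matrix : ℕ → Set
Matrix n = Fin n → Fin n → ℤ

charPoly : ∀ {n} → Matrix n → Poly
charPoly {n} A = det n λ i j →
  if does (i Fin.≟ j) then (ℤ.- A i j) ∷ 1ℤ ∷ [] else (ℤ.- A i j) ∷ []

xMinus1 xPlus1 : Poly
xMinus1 = -1ℤ ∷ 1ℤ ∷ []
xPlus1  = 1ℤ ∷ 1ℤ ∷ []

-- all but at most two eigenvalues (with algebraic multiplicity) are ±1: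
-- (x-1)^a (x+1)^b divides the characteristic polynomial with a+b ≥ n-2
AllButAtMostTwoEigenvaluesPM1 : ∀ {n} → Matrix n → Set
AllButAtMostTwoEigenvaluesPM1 {n} A =
  Σ ℕ λ a → Σ ℕ λ b → (n ∸ 2 ≤ a ℕ.+ b) ×
    ((powP xMinus1 a *P powP xPlus1 b) ∣P charPoly A)

record IsSignedGraph {n} (A : Matrix n) : Set where
  field
    symmetric : ∀ i j → A i j ≡ A j i
    loopless  : ∀ i → A i i ≡ 0ℤ
    entries   : ∀ i j → A i j ≡ 0ℤ ⊎ A i j ≡ 1ℤ ⊎ A i j ≡ -1ℤ

Adj : ∀ {n} → Matrix n → Fin n → Fin n → Set
Adj A i j = ¬ (A i j ≡ 0ℤ)

Reachable : ∀ {n} → Matrix n → Fin n → Fin n → Set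
Reachable A = Star (Adj A)

Disconnected : ∀ {n} → Matrix n → Set
Disconnected A = ∃ λ u → ∃ λ v → ¬ Reachable A u v

HasIsolatedEdge : ∀ {n} → Matrix n → Set
HasIsolatedEdge A = ∃ λ u → ∃ λ v → Adj A u v ×
  (∀ w → Adj A u w → w ≡ v) × (∀ w → Adj A v w → w ≡ u)

negM : ∀ {n} → Matrix n → Matrix n
negM A i j = ℤ.- A i j

completeM : ∀ m → Matrix m
completeM m i j = if does (i Fin.≟ j) then 0ℤ else 1ℤ

switch : ∀ {n} → (Fin n → Bool) → Matrix n → Matrix n
switch X A i j = if X i xor X j then ℤ.- A i j else A i j

Isomorphic : ∀ {n m} → Matrix n → Matrix m → Set
Isomorphic {n} {m} A B = Σ (Fin n ↔ Fin m) λ f →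
  ∀ i j → B (Inverse.to f i) (Inverse.to f j) ≡ A i j

SwitchingIsomorphic : ∀ {n m} → Matrix n → Matrix m → Set
SwitchingIsomorphic {n} A B = Σ (Fin n → Bool) λ X → Isomorphic (switch X A) B

blockM : ∀ {m₁ m₂} → Matrix m₁ → Matrix m₂ → Fin m₁ ⊎ Fin m₂ → Fin m₁ ⊎ Fin m₂ → ℤ
blockM A B (inj₁ i) (inj₁ j) = A i j
blockM A B (inj₂ i) (inj₂ j) = B i j
blockM A B (inj₁ i) (inj₂ j) = 0ℤ
blockM A B (inj₂ i) (inj₁ j) = 0ℤ

_⊕_ : ∀ {m₁ m₂} → Matrix m₁ → Matrix m₂ → Matrix (m₁ ℕ.+ m₂)
_⊕_ {m₁} A B i j = blockM A B (splitAt m₁ i) (splitAt m₁ j)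

SwitchingIsoToPMComplete : ∀ {m} → Matrix m → Set
SwitchingIsoToPMComplete {m} H =
  SwitchingIsomorphic H (completeM m) ⊎ SwitchingIsomorphic H (negM (completeM m))

{-# OPTIONS --safe #-}
module Submission where

-- Let N = A² − I. The adjugate of x I − A gives the Cayley–Hamilton theorem
-- and, since the derivative of det (x I − A) is the trace of that adjugate,
-- Newton's identities. Removing the factors x ∓ 1 one at a time from the
-- characteristic polynomial leaves a monic quadratic q = x² − s x + p with
-- N q(A) = 0 (here the symmetry of A is used) and with the remaining power
-- sums. Hence N³ = σ N² − δ N, tr N = σ and tr N² = σ² − 2 δ, where σ and δ
-- are the sum and the product of the values of x² − 1 at the roots of q.
--
-- Thus Z = σ N − N² satisfies Z² = δ Z and tr Z = 2 δ: it is δ times a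
-- projection of rank 2. (If δ = 0, then Z = 0 and N itself is σ times a
-- projection of rank 1, which the following excludes.) The vertex set is a
-- union of two nonempty parts with no edges in between, and Z is nonzero on
-- both, as N vanishes on a part only if the part has an isolated edge. So Z,
-- and with it N, has rank one on each part. For i, j in the same part this
-- says N i j ² = N i i * N j j, where N i i is the degree of i minus 1 and N
-- i j a signed count of common neighbours. Counting shows that adjacent
-- vertices have the same closed neighbourhood, that each part is complete,
-- and that the sign of a triangle through a fixed vertex is constant;
-- switching makes all edges that sign.

open import Defs
open import Algebra.Bundles using (CommutativeRing)
open import Data.Bool as Bool using (Bool; true; false; if_then_else_)
open import Data.Bool.Properties as Boolₚ using ()
open import Data.Empty using (⊥; ⊥-elim)
open import Data.Fin as Fin using (Fin; zero; suc; toℕ; punchIn; splitAt; join)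
open import Data.Fin.Properties as Finₚ using ()
open import Data.List using ([]; _∷_; drop; length)
open import Data.Nat as ℕ using (ℕ; zero; suc; _≤_; _<_; z≤n; s≤s; _⊔_; _∸_)
open import Data.Nat.Properties as ℕₚ using ()
open import Data.Product using (Σ; ∃; ∃₂; _×_; _,_; proj₁; proj₂)
open import Data.Sum using (_⊎_; inj₁; inj₂; [_,_]′)
open import Data.Unit using (tt)
open import Function using (_∘_)
open import Function.Bundles using (mk↔ₛ′)
open import Function.Construct.Identity using (↔-id)
open import Level using (0ℓ)
open import Relation.Binary.Construct.Closure.ReflexiveTransitive as Star using (_◅_; _◅◅_)
open import Relation.Binary.PropositionalEquality as ≡ using (_≡_; _≢_; _≗_)
open import Relation.Binary.Structures using (IsEquivalence)
open import Relation.Nullary using (¬_; Dec; does; yes; no; contradiction)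
open import Relation.Nullary.Decidable using (toWitness; _×-dec_; ¬?)

-- All arithmetic stays in the integers: the roots θ and η of q need not be rational, so only s, p,
-- σ and δ ever occur, and ranks are compared through sums of squares instead of eigenvectors. The
-- equation N q(A) = 0 alone says nothing about multiplicities; that θ and η count once each is
-- carried by the power sums, and these fix the trace of Z. The detour through Z is made because N
-- can have two different nonzero eigenvalues a = θ² - 1 and b = η² - 1, while Z = N (σ - N) sends
-- both to a b = δ. For a scaled projection the bound δ² ≤ tr Z² holds on each part where Z is
-- nonzero; the two parts together have exactly 2 δ², so both bounds are equalities, and equality
-- means that all 2 × 2 minors vanish.

module Summation {c ℓ} (R : CommutativeRing c ℓ) where
  open CommutativeRing R hiding (zero)
  import Algebra.Properties.Semiring.Sum semiring as S

  unit : ∀ {n} → Fin n → Fin n → Carrier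
  unit i j = if does (i Fin.≟ j) then 1# else 0#

  unit-sym : ∀ {n} (i j : Fin n) → unit i j ≡ unit j i
  unit-sym zero    zero    = ≡.refl
  unit-sym zero    (suc j) = ≡.refl
  unit-sym (suc i) zero    = ≡.refl
  unit-sym (suc i) (suc j) = unit-sym i j

  -- Opaque so that unification sees ∑ as injective.
  opaque
    ∑ : ∀ {n} → (Fin n → Carrier) → Carrier
    ∑ = S.sum

    ∑-nil : (f : Fin 0 → Carrier) → ∑ f ≈ 0#
    ∑-nil f = refl

    ∑-suc : ∀ {n} (f : Fin (suc n) → Carrier) → ∑ f ≈ f zero + ∑ (f ∘ suc)
    ∑-suc f = refl

    ∑-cong : ∀ {n} {f g : Fin n → Carrier} → (∀ i → f i ≈ g i) → ∑ f ≈ ∑ g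
    ∑-cong = S.sum-cong-≋

    ∑-distrib-+ : ∀ {n} (f g : Fin n → Carrier) → ∑ (λ i → f i + g i) ≈ ∑ f + ∑ g
    ∑-distrib-+ = S.∑-distrib-+

    ∑-swap : ∀ {m n} (f : Fin m → Fin n → Carrier) → ∑ (λ i → ∑ (f i)) ≈ ∑ (λ j → ∑ (λ i → f i j))
    ∑-swap = S.∑-comm

    *-distribˡ-∑ : ∀ {n} x (f : Fin n → Carrier) → x * ∑ f ≈ ∑ (λ i → x * f i)
    *-distribˡ-∑ = S.*-distribˡ-sum

    *-distribʳ-∑ : ∀ {n} x (f : Fin n → Carrier) → ∑ f * x ≈ ∑ (λ i → f i * x)
    *-distribʳ-∑ = S.*-distribʳ-sum

    ∑-zero : ∀ {n} {f : Fin n → Carrier} → (∀ i → f i ≈ 0#) → ∑ f ≈ 0#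
    ∑-zero {n} f≈0 = trans (S.sum-cong-≋ f≈0) (S.sum-replicate-zero n)

  ∑-linear : ∀ {n} x (f g : Fin n → Carrier) → ∑ (λ j → x * f j + g j) ≈ x * ∑ f + ∑ g
  ∑-linear x f g = trans (∑-distrib-+ (λ j → x * f j) g) (+-congʳ (sym (*-distribˡ-∑ x f)))

  ∑-unit : ∀ {n} (f : Fin n → Carrier) l → ∑ (λ k → f k * unit k l) ≈ f l
  ∑-unit f zero = trans (∑-suc _)
    (trans (+-cong (*-identityʳ _) (∑-zero λ k → zeroʳ (f (suc k)))) (+-identityʳ _))
  ∑-unit f (suc l) = trans (∑-suc _) (trans (+-cong (zeroʳ _) (∑-unit (f ∘ suc) l)) (+-identityˡ _))

-- Replacing one entry of a finite family

infixl 20 _[_≔_]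

-- By recursion on the index, row `zero` of `M [ suc i ≔ v ]` reduces to row `zero` of `M`, which is
-- what expansion along the first row needs.
_[_≔_] : ∀ {a} {X : Set a} {m} → (Fin m → X) → Fin m → X → Fin m → X
(f [ zero  ≔ x ]) zero    = x
(f [ zero  ≔ x ]) (suc k) = f (suc k)
(f [ suc i ≔ x ]) zero    = f zero
(f [ suc i ≔ x ]) (suc k) = ((f ∘ suc) [ i ≔ x ]) k

module _ {a b} {X : Set a} {Y : Set b} where

  ≔-map : ∀ {m} (g : X → Y) (f : Fin m → X) i x →
          g ∘ (f [ i ≔ x ]) ≗ (g ∘ f) [ i ≔ g x ]
  ≔-map g f zero    x zero    = ≡.refl
  ≔-map g f zero    x (suc k) = ≡.refl
  ≔-map g f (suc i) x zero    = ≡.refl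
  ≔-map g f (suc i) x (suc k) = ≔-map g (f ∘ suc) i x k

module _ {a} {X : Set a} where

  ≔-same : ∀ {m} (f : Fin m → X) i x → (f [ i ≔ x ]) i ≡ x
  ≔-same f zero    x = ≡.refl
  ≔-same f (suc i) x = ≔-same (f ∘ suc) i x

  ≔-other : ∀ {m} (f : Fin m → X) i k x → i ≢ k → (f [ i ≔ x ]) k ≡ f k
  ≔-other f zero    zero    x i≢k = contradiction ≡.refl i≢k
  ≔-other f zero    (suc k) x i≢k = ≡.refl
  ≔-other f (suc i) zero    x i≢k = ≡.refl
  ≔-other f (suc i) (suc k) x i≢k = ≔-other (f ∘ suc) i k x (i≢k ∘ ≡.cong suc)

  ≔-self : ∀ {m} (f : Fin m → X) i → f [ i ≔ f i ] ≗ f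
  ≔-self f zero    zero    = ≡.refl
  ≔-self f zero    (suc k) = ≡.refl
  ≔-self f (suc i) zero    = ≡.refl
  ≔-self f (suc i) (suc k) = ≔-self (f ∘ suc) i k

-- Determinants, by Laplace expansion along the first row

module Determinant {c ℓ} (R : CommutativeRing c ℓ) where
  open import Data.Vec.Functional using () renaming (_∷_ to _∷ʳ_)
  open CommutativeRing R hiding (zero)
  open Summation R
  open import Algebra.Properties.Ring ring
  open import Algebra.Solver.Ring.NaturalCoefficients.Default commutativeSemiring using (solve; _:=_; _:+_; _:*_; con)
  open import Relation.Binary.Reasoning.Setoid setoid

  Mat : ℕ → ℕ → Set c
  Mat m n = Fin m → Fin n → Carrier

  sgn : ℕ → Carrier
  sgn zero    = 1#
  sgn (suc k) = - sgn k

  minor : ∀ {n} → Mat (suc n) (suc n) → Fin (suc n) → Mat n n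
  minor M j i k = M (suc i) (punchIn j k)

  Det : ∀ {n} → Mat n n → Carrier
  Det {zero}  M = 1#
  Det {suc n} M = ∑ λ j → sgn (toℕ j) * (M zero j * Det (minor M j))

  det-cong : ∀ {n} {M M′ : Mat n n} → (∀ i j → M i j ≈ M′ i j) → Det M ≈ Det M′
  det-cong {zero}  eq = refl
  det-cong {suc n} eq = ∑-cong λ j → *-congˡ
    (*-cong (eq zero j) (det-cong λ i k → eq (suc i) (punchIn j k)))

  minor-≔ : ∀ {n} (M : Mat (suc n) (suc n)) i v j r k →
            minor (M [ suc i ≔ v ]) j r k ≡ (minor M j [ i ≔ v ∘ punchIn j ]) r k
  minor-≔ M i v j r k = ≡.cong (λ row → row k) (≔-map (_∘ punchIn j) (M ∘ suc) i v r)

  det-minor-≔ : ∀ {n} (M : Mat (suc n) (suc n)) i v j →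
                Det (minor (M [ suc i ≔ v ]) j) ≈ Det (minor M j [ i ≔ v ∘ punchIn j ])
  det-minor-≔ M i v j = det-cong λ r k → reflexive (minor-≔ M i v j r k)

  -- The form x u + w covers additivity and homogeneity with a single induction.
  det-linear : ∀ {n} (M : Mat n n) i x u w →
               Det (M [ i ≔ (λ j → x * u j + w j) ]) ≈ x * Det (M [ i ≔ u ]) + Det (M [ i ≔ w ])
  det-linear {suc n} M zero x u w = trans
    (∑-cong λ j → solve 5 (λ s x u w d → s :* ((x :* u :+ w) :* d) := x :* (s :* (u :* d)) :+ s :* (w :* d))
       refl (sgn (toℕ j)) x (u j) (w j) (Det (minor M j)))
    (∑-linear x _ _)
  det-linear {suc n} M (suc i) x u w = trans
    (∑-cong λ j → begin
      sgn (toℕ j) * (M zero j * Det (minor (M [ suc i ≔ _ ]) j))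
        ≈⟨ *-congˡ (*-congˡ (trans (det-minor-≔ M i _ j) (trans (det-linear (minor M j) i x _ _)
             (+-cong (*-congˡ (sym (det-minor-≔ M i u j))) (sym (det-minor-≔ M i w j)))))) ⟩
      sgn (toℕ j) * (M zero j * (x * Det (minor (M [ suc i ≔ u ]) j) + Det (minor (M [ suc i ≔ w ]) j)))
        ≈⟨ solve 5 (λ s m x d e → s :* (m :* (x :* d :+ e)) := x :* (s :* (m :* d)) :+ s :* (m :* e)) refl
             (sgn (toℕ j)) (M zero j) x _ _ ⟩
      _ ∎)
    (∑-linear x _ _)

  det-≔-cong : ∀ {n} (M : Mat n n) i {u w} → (∀ j → u j ≈ w j) → Det (M [ i ≔ u ]) ≈ Det (M [ i ≔ w ])
  det-≔-cong {n} M i {u} {w} eq = det-cong (go M i)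
    where
    go : ∀ {m} (M : Mat m n) i r k → (M [ i ≔ u ]) r k ≈ (M [ i ≔ w ]) r k
    go M zero    zero    k = eq k
    go M zero    (suc r) k = refl
    go M (suc i) zero    k = refl
    go M (suc i) (suc r) k = go (M ∘ suc) i r k

  -- Writing the zero row as - 1 times itself plus itself gives d = - d + d.
  det-zero-row : ∀ {n} (M : Mat n n) i → Det (M [ i ≔ (λ _ → 0#) ]) ≈ 0#
  det-zero-row M i = begin
    Det (M [ i ≔ (λ _ → 0#) ])
      ≈⟨ det-≔-cong M i (λ j → sym (trans (+-identityʳ _) (zeroʳ _))) ⟩
    Det (M [ i ≔ (λ _ → - 1# * 0# + 0#) ])
      ≈⟨ det-linear M i (- 1#) _ _ ⟩
    - 1# * Det (M [ i ≔ (λ _ → 0#) ]) + Det (M [ i ≔ (λ _ → 0#) ])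
      ≈⟨ +-congʳ (-1*x≈-x _) ⟩
    - Det (M [ i ≔ (λ _ → 0#) ]) + Det (M [ i ≔ (λ _ → 0#) ])
      ≈⟨ -‿inverseˡ _ ⟩
    0# ∎

  det-sum-row : ∀ {n m} (M : Mat n n) i (x : Fin m → Carrier) (U : Mat m n) →
                Det (M [ i ≔ (λ j → ∑ λ k → x k * U k j) ]) ≈ ∑ λ k → x k * Det (M [ i ≔ U k ])
  det-sum-row {m = zero}  M i x U =
    trans (det-≔-cong M i λ j → ∑-nil _) (trans (det-zero-row M i) (sym (∑-nil _)))
  det-sum-row {m = suc m} M i x U =
    trans (det-≔-cong M i λ j → ∑-suc _) (trans (det-linear M i (x zero) (U zero) _)
      (trans (+-congˡ (det-sum-row M i (x ∘ suc) (U ∘ suc))) (sym (∑-suc _))))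

  -*-cancel : ∀ x y → - x * - y ≈ x * y
  -*-cancel x y = begin
    - x * - y   ≈⟨ -‿distribˡ-* x (- y) ⟨
    - (x * - y) ≈⟨ -‿cong (-‿distribʳ-* x y) ⟨
    - - (x * y) ≈⟨ -‿involutive _ ⟩
    x * y       ∎

  -- The pairs (0 , k) and (suc k , 0) of deleted columns cancel; the
  -- remaining pairs form the same sum with one column fewer.
  deleted-pairs-cancel : ∀ n (v : Fin (suc (suc n)) → Carrier)
    (F : (Fin n → Fin (suc (suc n))) → Carrier) → (∀ {c c′} → c ≗ c′ → F c ≈ F c′) →
    (∑ λ j → sgn (toℕ j) * ∑ λ k → sgn (toℕ k) *
      (v j * (v (punchIn j k) * F (λ m → punchIn j (punchIn k m))))) ≈ 0#
  deleted-pairs-cancel n v F F-cong = begin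
    ∑ (λ j → sgn (toℕ j) * ∑ λ k → sgn (toℕ k) * (v j * (v (punchIn j k) * F (λ m → punchIn j (punchIn k m)))))
      ≈⟨ trans (∑-suc _) (+-congˡ (∑-cong λ j → *-congˡ (∑-suc _))) ⟩
    1# * ∑ (λ k → x k) + ∑ (λ j → - sgn (toℕ j) * (1# * y j + ∑ (λ k → z j k)))
      ≈⟨ +-congʳ (*-identityˡ _) ⟩
    ∑ x + ∑ (λ j → - sgn (toℕ j) * (1# * y j + ∑ (z j)))
      ≈⟨ ∑-distrib-+ x _ ⟨
    ∑ (λ j → x j + - sgn (toℕ j) * (1# * y j + ∑ (z j)))
      ≈⟨ ∑-cong (λ j → step (sgn (toℕ j)) (v zero) (v (suc j)) _ (∑ (z j))) ⟩
    ∑ (λ j → - sgn (toℕ j) * ∑ (z j))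
      ≈⟨ rest n v F F-cong ⟩
    0# ∎
    where
    x y : Fin (suc n) → Carrier
    x k = sgn (toℕ k) * (v zero * (v (suc k) * F (λ m → suc (punchIn k m))))
    y j = v (suc j) * (v zero * F (λ m → suc (punchIn j m)))
    z : Fin (suc n) → Fin n → Carrier
    z j k = - sgn (toℕ k) * (v (suc j) * (v (suc (punchIn j k)) * F (λ m → punchIn (suc j) (punchIn (suc k) m))))

    step : ∀ s a b f t → s * (a * (b * f)) + - s * (1# * (b * (a * f)) + t) ≈ - s * t
    step s a b f t = begin
      s * (a * (b * f)) + - s * (1# * (b * (a * f)) + t)
        ≈⟨ solve 6 (λ s s′ a b f t → s :* (a :* (b :* f)) :+ s′ :* (con 1 :* (b :* (a :* f)) :+ t)
             := (s :+ s′) :* (a :* (b :* f)) :+ s′ :* t) refl s (- s) a b f t ⟩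
      (s + - s) * (a * (b * f)) + - s * t
        ≈⟨ +-congʳ (trans (*-congʳ (-‿inverseʳ s)) (zeroˡ _)) ⟩
      0# + - s * t
        ≈⟨ +-identityˡ _ ⟩
      - s * t ∎

    rest : ∀ n (v : Fin (suc (suc n)) → Carrier) (F : (Fin n → Fin (suc (suc n))) → Carrier) →
      (∀ {c c′} → c ≗ c′ → F c ≈ F c′) →
      (∑ λ (j : Fin (suc n)) → - sgn (toℕ j) * ∑ λ (k : Fin n) → - sgn (toℕ k) *
        (v (suc j) * (v (suc (punchIn j k)) * F (λ m → punchIn (suc j) (punchIn (suc k) m))))) ≈ 0#
    rest zero    v F F-cong = ∑-zero λ j → trans (*-congˡ (∑-nil _)) (zeroʳ (- sgn (toℕ j)))
    rest (suc n) v F F-cong = trans (∑-cong λ j → begin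
      - sgn (toℕ j) * ∑ (λ k → - sgn (toℕ k) * g j k)
        ≈⟨ *-congˡ (∑-cong λ k → trans (sym (-‿distribˡ-* (sgn (toℕ k)) (g j k))) (sym (-1*x≈-x _))) ⟩
      - sgn (toℕ j) * ∑ (λ k → - 1# * (sgn (toℕ k) * g j k))
        ≈⟨ *-congˡ (*-distribˡ-∑ (- 1#) (λ k → sgn (toℕ k) * g j k)) ⟨
      - sgn (toℕ j) * (- 1# * ∑ (λ k → sgn (toℕ k) * g j k))
        ≈⟨ *-congˡ (-1*x≈-x _) ⟩
      - sgn (toℕ j) * - ∑ (λ k → sgn (toℕ k) * g j k)
        ≈⟨ -*-cancel _ _ ⟩
      sgn (toℕ j) * ∑ (λ k → sgn (toℕ k) * g j k)
        ≈⟨ *-congˡ (∑-cong λ k → *-congˡ (*-congˡ (*-congˡ (F-cong (shift j k))))) ⟩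
      sgn (toℕ j) * ∑ (λ k → sgn (toℕ k) *
        (v (suc j) * (v (suc (punchIn j k)) * F (lift₁ (λ m → punchIn j (punchIn k m)))))) ∎)
      (deleted-pairs-cancel n (v ∘ suc) (λ c → F (lift₁ c)) (λ eq → F-cong (lift₁-cong eq)))
      where
      g : Fin (suc (suc n)) → Fin (suc n) → Carrier
      g j k = v (suc j) * (v (suc (punchIn j k)) * F (λ m → punchIn (suc j) (punchIn (suc k) m)))

      -- When columns suc j and suc k are deleted, column `zero` survives as the first one; `lift₁`
      -- puts it in front of the columns left among the others.
      lift₁ : ∀ {p q} → (Fin p → Fin q) → Fin (suc p) → Fin (suc q)
      lift₁ c zero    = zero
      lift₁ c (suc m) = suc (c m)

      lift₁-cong : ∀ {p q} {c c′ : Fin p → Fin q} → c ≗ c′ → lift₁ c ≗ lift₁ c′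
      lift₁-cong eq zero    = ≡.refl
      lift₁-cong eq (suc m) = ≡.cong suc (eq m)

      shift : ∀ (j : Fin (suc (suc n))) k m → punchIn (suc j) (punchIn (suc k) m) ≡ lift₁ (λ m → punchIn j (punchIn k m)) m
      shift j k zero    = ≡.refl
      shift j k (suc m) = ≡.refl

  -- Expansion along the first two rows is a sum over ordered pairs of deleted columns. With equal
  -- rows, exchanging the two columns of a pair keeps the product and flips the sign.
  det-equal-rows₀₁ : ∀ {n} (M : Mat (suc (suc n)) (suc (suc n))) →
                     (∀ j → M zero j ≈ M (suc zero) j) → Det M ≈ 0#
  det-equal-rows₀₁ {n} M eq = trans
    (∑-cong λ j → *-congˡ (trans (*-distribˡ-∑ (M zero j) _) (∑-cong λ k → begin
      M zero j * (sgn (toℕ k) * (M (suc zero) (punchIn j k) * Det (minor (minor M j) k)))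
        ≈⟨ solve 4 (λ m s m′ d → m :* (s :* (m′ :* d)) := s :* (m :* (m′ :* d))) refl (M zero j) (sgn (toℕ k)) _ _ ⟩
      sgn (toℕ k) * (M zero j * (M (suc zero) (punchIn j k) * Det (minor (minor M j) k)))
        ≈⟨ *-congˡ (*-congˡ (*-congʳ (sym (eq (punchIn j k))))) ⟩
      sgn (toℕ k) * (M zero j * (M zero (punchIn j k) * Det (minor (minor M j) k))) ∎)))
    (deleted-pairs-cancel n (M zero) (λ c → Det λ i m → M (suc (suc i)) (c m))
      λ eq → det-cong λ i m → reflexive (≡.cong (M (suc (suc i))) (eq m)))

  mutual

    -- Rows suc zero and suc (suc k) are exchanged inside every minor, by `det-swap₀` one size
    -- lower; this negates the determinant and brings the equal rows to the top. The two lemmas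
    -- alternate: a swap comes from equal rows of the same size, equal rows from a swap of the size
    -- below.
    det-equal-rows₀ : ∀ {n} (M : Mat (suc n) (suc n)) k →
                      (∀ j → M zero j ≈ M (suc k) j) → Det M ≈ 0#
    det-equal-rows₀ {suc n} M zero eq = det-equal-rows₀₁ M eq
    det-equal-rows₀ {suc n} M (suc k) eq = begin
      Det M
        ≈⟨ ∑-cong (λ j → trans (*-congˡ (*-congˡ (swapped j))) (neg-out _ _ _)) ⟩
      ∑ (λ j → - 1# * (sgn (toℕ j) * (M zero j * Det (minor M′ j))))
        ≈⟨ *-distribˡ-∑ (- 1#) _ ⟨
      - 1# * Det M′
        ≈⟨ *-congˡ (det-equal-rows₀₁ M′ eq) ⟩
      - 1# * 0#
        ≈⟨ zeroʳ _ ⟩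
      0# ∎
      where
      u = M (suc zero)
      w = M (suc (suc k))
      rows = λ i → M (suc (suc i))
      M′ = M zero ∷ʳ w ∷ʳ rows [ k ≔ u ]

      neg-out : ∀ s m d → s * (m * - d) ≈ - 1# * (s * (m * d))
      neg-out s m d = begin
        s * (m * - d)       ≈⟨ *-congˡ (-‿distribʳ-* m d) ⟨
        s * - (m * d)       ≈⟨ -‿distribʳ-* s _ ⟨
        - (s * (m * d))     ≈⟨ -1*x≈-x _ ⟨
        - 1# * (s * (m * d)) ∎

      swapped : ∀ j → Det (minor M j) ≈ - Det (minor M′ j)
      swapped j = begin
        Det (minor M j)
          ≈⟨ det-cong {M = minor M j} {u ∘ punchIn j ∷ʳ rows′ [ k ≔ w ∘ punchIn j ]}
               (λ { zero l → refl ; (suc r) l → reflexive (≡.cong (λ row → row l) (≡.sym (≔-self rows′ k r))) }) ⟩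
        Det (u ∘ punchIn j ∷ʳ rows′ [ k ≔ w ∘ punchIn j ])
          ≈⟨ det-swap₀ rows′ k _ _ ⟩
        - Det (w ∘ punchIn j ∷ʳ rows′ [ k ≔ u ∘ punchIn j ])
          ≈⟨ -‿cong (det-cong {M = w ∘ punchIn j ∷ʳ rows′ [ k ≔ u ∘ punchIn j ]} {minor M′ j}
               (λ { zero l → refl ; (suc r) l → reflexive (≡.cong (λ row → row l) (≡.sym (≔-map (_∘ punchIn j) rows k u r))) })) ⟩
        - Det (minor M′ j) ∎
        where
        rows′ : Mat n (suc n)
        rows′ i = rows i ∘ punchIn j

    -- Polarization: an alternating form f has f (u + w) (u + w) = 0, and expanding it leaves f u w
    -- + f w u = 0.
    det-swap₀ : ∀ {n} (Q : Mat n (suc n)) k u w →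
                Det (u ∷ʳ Q [ k ≔ w ]) ≈ - Det (w ∷ʳ Q [ k ≔ u ])
    det-swap₀ {n} Q k u w = +-inverseʳ-unique (f w u) (f u w) (begin
      f w u + f u w                       ≈⟨ +-cong (trans (sym (+-identityʳ _)) (+-congˡ (sym (diagonal w)))) (trans (sym (+-identityˡ _)) (+-congʳ (sym (diagonal u)))) ⟩
      (f w u + f w w) + (f u u + f u w)   ≈⟨ +-cong (additiveʳ w) (additiveʳ u) ⟨
      f w u+w + f u u+w                   ≈⟨ +-comm _ _ ⟩
      f u u+w + f w u+w                   ≈⟨ additiveˡ (Q [ k ≔ u+w ]) ⟨
      f u+w u+w                           ≈⟨ diagonal u+w ⟩
      0#                                  ∎)
      where
      f : (Fin (suc n) → Carrier) → (Fin (suc n) → Carrier) → Carrier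
      f x y = Det (x ∷ʳ Q [ k ≔ y ])

      u+w : Fin (suc n) → Carrier
      u+w j = 1# * u j + w j

      diagonal : ∀ x → f x x ≈ 0#
      diagonal x = det-equal-rows₀ (x ∷ʳ Q [ k ≔ x ]) k λ j →
        reflexive (≡.cong (λ row → row j) (≡.sym (≔-same Q k x)))

      additiveˡ : ∀ P → Det (u+w ∷ʳ P) ≈ Det (u ∷ʳ P) + Det (w ∷ʳ P)
      additiveˡ P = begin
        Det (u+w ∷ʳ P)
          ≈⟨ at u+w ⟩
        Det ((u ∷ʳ P) [ zero ≔ u+w ])
          ≈⟨ det-linear (u ∷ʳ P) zero 1# u w ⟩
        1# * Det ((u ∷ʳ P) [ zero ≔ u ]) + Det ((u ∷ʳ P) [ zero ≔ w ])
          ≈⟨ +-cong (trans (*-identityˡ _) (sym (at u))) (sym (at w)) ⟩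
        Det (u ∷ʳ P) + Det (w ∷ʳ P) ∎
        where
        at : ∀ x → Det (x ∷ʳ P) ≈ Det ((u ∷ʳ P) [ zero ≔ x ])
        at x = det-cong {M = x ∷ʳ P} {(u ∷ʳ P) [ zero ≔ x ]} λ { zero l → refl ; (suc r) l → refl }

      additiveʳ : ∀ x → f x u+w ≈ f x u + f x w
      additiveʳ x = begin
        f x u+w
          ≈⟨ at u+w ⟩
        Det ((x ∷ʳ Q) [ suc k ≔ u+w ])
          ≈⟨ det-linear (x ∷ʳ Q) (suc k) 1# u w ⟩
        1# * Det ((x ∷ʳ Q) [ suc k ≔ u ]) + Det ((x ∷ʳ Q) [ suc k ≔ w ])
          ≈⟨ +-cong (trans (*-identityˡ _) (sym (at u))) (sym (at w)) ⟩
        f x u + f x w ∎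
        where
        at : ∀ y → f x y ≈ Det ((x ∷ʳ Q) [ suc k ≔ y ])
        at y = det-cong {M = x ∷ʳ Q [ k ≔ y ]} {(x ∷ʳ Q) [ suc k ≔ y ]} λ { zero l → refl ; (suc r) l → refl }

  det-equal-rows : ∀ {n} (M : Mat n n) i k → i ≢ k → (∀ j → M i j ≈ M k j) → Det M ≈ 0#
  det-equal-rows M zero    zero    i≢k eq = contradiction ≡.refl i≢k
  det-equal-rows M zero    (suc k) i≢k eq = det-equal-rows₀ M k eq
  det-equal-rows M (suc i) zero    i≢k eq = det-equal-rows₀ M i (λ j → sym (eq j))
  det-equal-rows M (suc i) (suc k) i≢k eq = ∑-zero λ j → begin
    sgn (toℕ j) * (M zero j * Det (minor M j))
      ≈⟨ *-congˡ (*-congˡ (det-equal-rows (minor M j) i k (i≢k ∘ ≡.cong suc) (λ l → eq (punchIn j l)))) ⟩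
    sgn (toℕ j) * (M zero j * 0#)
      ≈⟨ trans (*-congˡ (zeroʳ _)) (zeroʳ _) ⟩
    0# ∎

  -- The cofactor of entry (j , k) as a determinant with a unit row instead of a signed minor. Row
  -- linearity then gives `adjugate-inverse`, and the derivative of a characteristic matrix produces
  -- terms of just this shape.
  adjugate : ∀ {n} → Mat n n → Mat n n
  adjugate M k j = Det (M [ j ≔ unit k ])

  adjugate-inverse : ∀ {n} (M : Mat n n) i j →
                     ∑ (λ k → M i k * adjugate M k j) ≈ Det M * unit i j
  adjugate-inverse M i j = trans (sym (det-sum-row M j (M i) unit))
    (trans (det-≔-cong M j (∑-unit (M i))) (replaced (i Fin.≟ j)))
    where
    replaced : Dec (i ≡ j) → Det (M [ j ≔ M i ]) ≈ Det M * unit i j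
    replaced i≟j with i Fin.≟ j
    ... | yes ≡.refl = trans (det-cong λ r l → reflexive (≡.cong (λ row → row l) (≔-self M i r))) (sym (*-identityʳ _))
    ... | no i≢j = trans
      (det-equal-rows (M [ j ≔ M i ]) i j i≢j λ l → reflexive (≡.cong (λ row → row l)
        (≡.trans (≔-other M j i (M i) (i≢j ∘ ≡.sym)) (≡.sym (≔-same M j (M i))))))
      (sym (zeroʳ _))

  det-unit : ∀ {n} → Det (unit {n}) ≈ 1#
  det-unit {zero}  = refl
  det-unit {suc n} = begin
    Det (unit {suc n})
      ≈⟨ ∑-suc _ ⟩
    1# * (1# * Det (unit {n})) + ∑ (λ j → sgn (toℕ (suc j)) * (0# * Det (minor (unit {suc n}) (suc j))))
      ≈⟨ +-cong (trans (*-identityˡ _) (*-identityˡ _)) (∑-zero λ j → trans (*-congˡ (zeroˡ _)) (zeroʳ _)) ⟩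
    Det (unit {n}) + 0#
      ≈⟨ trans (+-identityʳ _) (det-unit {n}) ⟩
    1# ∎

  module Derivation (∂ : Carrier → Carrier)
    (∂-cong : ∀ {x y} → x ≈ y → ∂ x ≈ ∂ y)
    (∂-+ : ∀ x y → ∂ (x + y) ≈ ∂ x + ∂ y)
    (∂-* : ∀ x y → ∂ (x * y) ≈ ∂ x * y + x * ∂ y) where

    ∂-0 : ∂ 0# ≈ 0#
    ∂-0 = x+x≈x⇒x≈0 _ (trans (sym (∂-+ 0# 0#)) (∂-cong (+-identityˡ 0#)))

    ∂-1 : ∂ 1# ≈ 0#
    ∂-1 = x+x≈x⇒x≈0 _ (trans (sym (+-cong (*-identityʳ _) (*-identityˡ _)))
      (trans (sym (∂-* 1# 1#)) (∂-cong (*-identityˡ 1#))))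

    ∂-sgn : ∀ k → ∂ (sgn k) ≈ 0#
    ∂-sgn zero    = ∂-1
    ∂-sgn (suc k) = begin
      ∂ (- sgn k)              ≈⟨ +-identityˡ _ ⟨
      0# + ∂ (- sgn k)         ≈⟨ +-congʳ (∂-sgn k) ⟨
      ∂ (sgn k) + ∂ (- sgn k)  ≈⟨ ∂-+ _ _ ⟨
      ∂ (sgn k + - sgn k)      ≈⟨ ∂-cong (-‿inverseʳ _) ⟩
      ∂ 0#                     ≈⟨ ∂-0 ⟩
      0#                       ∎

    ∂-∑ : ∀ {n} (f : Fin n → Carrier) → ∂ (∑ f) ≈ ∑ (λ i → ∂ (f i))
    ∂-∑ {zero}  f = trans (∂-cong (∑-nil f)) (trans ∂-0 (sym (∑-nil _)))
    ∂-∑ {suc n} f = trans (∂-cong (∑-suc f)) (trans (∂-+ _ _) (trans (+-congˡ (∂-∑ (f ∘ suc))) (sym (∑-suc _))))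

    -- The product rule applied to the expansion: the term that differentiates an entry of the first
    -- row is the summand for row `zero`, and the derivatives of the minors supply the other rows.
    ∂-det : ∀ {n} (M : Mat n n) → ∂ (Det M) ≈ ∑ (λ i → Det (M [ i ≔ ∂ ∘ M i ]))
    ∂-det {zero}  M = trans ∂-1 (sym (∑-nil _))
    ∂-det {suc n} M = begin
      ∂ (Det M)
        ≈⟨ ∂-∑ _ ⟩
      ∑ (λ j → ∂ (sgn (toℕ j) * (M zero j * Det (minor M j))))
        ≈⟨ ∑-cong (λ j → expand j) ⟩
      ∑ (λ j → sgn (toℕ j) * (∂ (M zero j) * Det (minor M j)) +
               ∑ (λ i → sgn (toℕ j) * (M zero j * Det (minor (M [ suc i ≔ ∂ ∘ M (suc i) ]) j))))
        ≈⟨ ∑-distrib-+ _ _ ⟩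
      Det (M [ zero ≔ ∂ ∘ M zero ]) +
        ∑ (λ j → ∑ (λ i → sgn (toℕ j) * (M zero j * Det (minor (M [ suc i ≔ ∂ ∘ M (suc i) ]) j))))
        ≈⟨ +-congˡ (∑-swap _) ⟩
      Det (M [ zero ≔ ∂ ∘ M zero ]) + ∑ (λ i → Det (M [ suc i ≔ ∂ ∘ M (suc i) ]))
        ≈⟨ ∑-suc _ ⟨
      ∑ (λ i → Det (M [ i ≔ ∂ ∘ M i ])) ∎
      where
      expand : ∀ j → ∂ (sgn (toℕ j) * (M zero j * Det (minor M j))) ≈
        sgn (toℕ j) * (∂ (M zero j) * Det (minor M j)) +
        ∑ (λ i → sgn (toℕ j) * (M zero j * Det (minor (M [ suc i ≔ ∂ ∘ M (suc i) ]) j)))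
      expand j = begin
        ∂ (s * (m * d))
          ≈⟨ ∂-* s (m * d) ⟩
        ∂ s * (m * d) + s * ∂ (m * d)
          ≈⟨ +-cong (trans (*-congʳ (∂-sgn (toℕ j))) (zeroˡ _)) (*-congˡ (∂-* m d)) ⟩
        0# + s * (∂ m * d + m * ∂ d)
          ≈⟨ trans (+-identityˡ _) (distribˡ s _ _) ⟩
        s * (∂ m * d) + s * (m * ∂ d)
          ≈⟨ +-congˡ (*-congˡ (*-congˡ (trans (∂-det (minor M j))
               (∑-cong λ i → sym (det-minor-≔ M i (∂ ∘ M (suc i)) j))))) ⟩
        s * (∂ m * d) + s * (m * ∑ (λ i → Det (minor (M [ suc i ≔ ∂ ∘ M (suc i) ]) j)))
          ≈⟨ +-congˡ (trans (*-congˡ (*-distribˡ-∑ m _)) (*-distribˡ-∑ s _)) ⟩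
        s * (∂ m * d) + ∑ (λ i → s * (m * Det (minor (M [ suc i ≔ ∂ ∘ M (suc i) ]) j))) ∎
        where
        s m d : Carrier
        s = sgn (toℕ j)
        m = M zero j
        d = Det (minor M j)

open import Data.Integer as ℤ using (ℤ; +_; -[1+_]; 0ℤ; 1ℤ; -1ℤ; _+_; _*_; -_; _-_)
open import Data.Integer.Properties as ℤₚ using ()
open import Data.Integer.Tactic.RingSolver using (solve-∀)
open ≡ using (refl; sym; trans; cong; cong₂; subst; subst₂; module ≡-Reasoning)
open ≡-Reasoning

-- The ring of integer polynomials

infix 4 _≋_

-- Unlike _≈P_, this record type determines its two arguments.
record _≋_ (p q : Poly) : Set where
  constructor coeffwise
  field at : p ≈P q

open _≋_ public

-- The Cauchy product, on coefficient sequences rather than lists, so that trailing zeros do not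
-- enter the proofs of the ring laws.
conv : (ℕ → ℤ) → (ℕ → ℤ) → ℕ → ℤ
conv f g zero    = f 0 * g 0
conv f g (suc k) = f 0 * g (suc k) + conv (f ∘ suc) g k

conv-cong : ∀ {f f′ g g′} → (∀ k → f k ≡ f′ k) → (∀ k → g k ≡ g′ k) → ∀ k → conv f g k ≡ conv f′ g′ k
conv-cong p q zero    = cong₂ _*_ (p 0) (q 0)
conv-cong p q (suc k) = cong₂ _+_ (cong₂ _*_ (p 0) (q (suc k))) (conv-cong (p ∘ suc) q k)

conv-zeroˡ : ∀ {f} g → (∀ k → f k ≡ 0ℤ) → ∀ k → conv f g k ≡ 0ℤ
conv-zeroˡ g f≡0 zero    = cong (_* g 0) (f≡0 0)
conv-zeroˡ g f≡0 (suc k) = cong₂ _+_ (cong (_* g (suc k)) (f≡0 0)) (conv-zeroˡ g (f≡0 ∘ suc) k)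

conv-linearˡ : ∀ c f f′ g k → conv (λ i → c * f i + f′ i) g k ≡ c * conv f g k + conv f′ g k
conv-linearˡ c f f′ g zero = expand c (f 0) (f′ 0) (g 0)
  where
  expand : ∀ c x y z → (c * x + y) * z ≡ c * (x * z) + y * z
  expand = solve-∀
conv-linearˡ c f f′ g (suc k) = trans (cong (_+_ ((c * f 0 + f′ 0) * g (suc k))) (conv-linearˡ c (f ∘ suc) (f′ ∘ suc) g k))
  (expand c (f 0) (f′ 0) (g (suc k)) _ _)
  where
  expand : ∀ c x y z s t → (c * x + y) * z + (c * s + t) ≡ c * (x * z + s) + (y * z + t)
  expand = solve-∀

-- The defining recursion run from the other end; commutativity compares the two.
conv-sucʳ : ∀ f g k → conv f g (suc k) ≡ conv f (g ∘ suc) k + f (suc k) * g 0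
conv-sucʳ f g zero    = refl
conv-sucʳ f g (suc k) = trans (cong (_+_ (f 0 * g (suc (suc k)))) (conv-sucʳ (f ∘ suc) g k))
  (sym (ℤₚ.+-assoc (f 0 * g (suc (suc k))) _ _))

conv-comm : ∀ f g k → conv f g k ≡ conv g f k
conv-comm f g zero    = ℤₚ.*-comm (f 0) (g 0)
conv-comm f g (suc k) = begin
  f 0 * g (suc k) + conv (f ∘ suc) g k  ≡⟨ cong₂ _+_ (ℤₚ.*-comm (f 0) _) (conv-comm (f ∘ suc) g k) ⟩
  g (suc k) * f 0 + conv g (f ∘ suc) k  ≡⟨ ℤₚ.+-comm (g (suc k) * f 0) _ ⟩
  conv g (f ∘ suc) k + g (suc k) * f 0  ≡⟨ conv-sucʳ g f k ⟨
  conv g f (suc k)                      ∎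

conv-assoc : ∀ f g h k → conv (conv f g) h k ≡ conv f (conv g h) k
conv-assoc f g h zero    = ℤₚ.*-assoc (f 0) (g 0) (h 0)
conv-assoc f g h (suc k) = begin
  f 0 * g 0 * h (suc k) + conv (λ i → f 0 * g (suc i) + conv (f ∘ suc) g i) h k
    ≡⟨ cong (_+_ (f 0 * g 0 * h (suc k))) (conv-linearˡ (f 0) (g ∘ suc) (conv (f ∘ suc) g) h k) ⟩
  f 0 * g 0 * h (suc k) + (f 0 * conv (g ∘ suc) h k + conv (conv (f ∘ suc) g) h k)
    ≡⟨ cong (λ z → f 0 * g 0 * h (suc k) + (f 0 * conv (g ∘ suc) h k + z)) (conv-assoc (f ∘ suc) g h k) ⟩
  f 0 * g 0 * h (suc k) + (f 0 * conv (g ∘ suc) h k + conv (f ∘ suc) (conv g h) k)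
    ≡⟨ regroup (f 0) (g 0) (h (suc k)) _ _ ⟩
  f 0 * (g 0 * h (suc k) + conv (g ∘ suc) h k) + conv (f ∘ suc) (conv g h) k ∎
  where
  regroup : ∀ x y z s t → x * y * z + (x * s + t) ≡ x * (y * z + s) + t
  regroup = solve-∀

coeff-+ : ∀ p q k → coeff (p +P q) k ≡ coeff p k + coeff q k
coeff-+ []      q       k       = sym (ℤₚ.+-identityˡ _)
coeff-+ (a ∷ p) []      k       = sym (ℤₚ.+-identityʳ _)
coeff-+ (a ∷ p) (b ∷ q) zero    = refl
coeff-+ (a ∷ p) (b ∷ q) (suc k) = coeff-+ p q k

coeff-scale : ∀ c p k → coeff (scaleP c p) k ≡ c * coeff p k
coeff-scale c []      k       = sym (ℤₚ.*-zeroʳ c)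
coeff-scale c (a ∷ p) zero    = refl
coeff-scale c (a ∷ p) (suc k) = coeff-scale c p k

coeff-* : ∀ p q k → coeff (p *P q) k ≡ conv (coeff p) (coeff q) k
coeff-* []      q k       = sym (conv-zeroˡ {coeff []} (coeff q) (λ _ → refl) k)
coeff-* (a ∷ p) q zero    = trans (coeff-+ (scaleP a q) _ 0) (trans (ℤₚ.+-identityʳ _) (coeff-scale a q 0))
coeff-* (a ∷ p) q (suc k) = trans (coeff-+ (scaleP a q) _ (suc k))
  (cong₂ _+_ (coeff-scale a q (suc k)) (coeff-* p q k))

-- Horner form: the derivative of a + x p is p + x p′.
D : Poly → Poly
D []      = []
D (a ∷ p) = p +P (0ℤ ∷ D p)

coeff-D : ∀ p k → coeff (D p) k ≡ + suc k * coeff p (suc k)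
coeff-D []      k       = sym (ℤₚ.*-zeroʳ (+ suc k))
coeff-D (a ∷ p) zero    = trans (coeff-+ p (0ℤ ∷ D p) 0) (trans (ℤₚ.+-identityʳ _) (sym (ℤₚ.*-identityˡ _)))
coeff-D (a ∷ p) (suc k) = trans (coeff-+ p (0ℤ ∷ D p) (suc k))
  (trans (cong (_+_ (coeff p (suc k))) (coeff-D p k)) (sym (ℤₚ.suc-* (+ suc k) (coeff p (suc k)))))

shiftD : (ℕ → ℤ) → ℕ → ℤ
shiftD f k = + suc k * f (suc k)

-- The Leibniz rule, one coefficient at a time. Shifting `f` lowers the weight of each of its
-- coefficients by one; the copy of `conv f′ g (suc k)` split off from the factor k + 2 makes up for
-- that.
conv-leibniz : ∀ f g k → + suc k * conv f g (suc k) ≡ conv (shiftD f) g k + conv f (shiftD g) k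
conv-leibniz f g zero = base (f 0) (f 1) (g 0) (g 1)
  where
  base : ∀ x x′ y y′ → 1ℤ * (x * y′ + x′ * y) ≡ 1ℤ * x′ * y + x * (1ℤ * y′)
  base = solve-∀
conv-leibniz f g (suc k) = begin
  + suc (suc k) * (f 0 * g (suc (suc k)) + conv f′ g (suc k))
    ≡⟨ split (+ suc k) (f 0) (g (suc (suc k))) (conv f′ g (suc k)) ⟩
  conv f′ g (suc k) + (f 0 * (+ suc (suc k) * g (suc (suc k))) + + suc k * conv f′ g (suc k))
    ≡⟨ cong (λ z → conv f′ g (suc k) + (f 0 * (+ suc (suc k) * g (suc (suc k))) + z)) (conv-leibniz f′ g k) ⟩
  (f 1 * g (suc k) + conv (f′ ∘ suc) g k) + (f 0 * shiftD g (suc k) + (conv (shiftD f′) g k + conv f′ (shiftD g) k))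
    ≡⟨ regroup (f 1) (g (suc k)) (conv (f′ ∘ suc) g k) (f 0 * shiftD g (suc k)) (conv (shiftD f′) g k) (conv f′ (shiftD g) k) ⟩
  (1ℤ * f 1 * g (suc k) + (1ℤ * conv (f′ ∘ suc) g k + conv (shiftD f′) g k)) + (f 0 * shiftD g (suc k) + conv f′ (shiftD g) k)
    ≡⟨ cong (λ z → (1ℤ * f 1 * g (suc k) + z) + (f 0 * shiftD g (suc k) + conv f′ (shiftD g) k)) (sym (trans (conv-cong (λ i → step i) (λ _ → refl) k) (conv-linearˡ 1ℤ (f′ ∘ suc) (shiftD f′) g k))) ⟩
  conv (shiftD f) g (suc k) + conv f (shiftD g) (suc k) ∎
  where
  f′ = f ∘ suc
  split : ∀ m x y z → (1ℤ + m) * (x * y + z) ≡ z + (x * ((1ℤ + m) * y) + m * z)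
  split = solve-∀
  regroup : ∀ x y b c d e → (x * y + b) + (c + (d + e)) ≡ (1ℤ * x * y + (1ℤ * b + d)) + (c + e)
  regroup = solve-∀
  step : ∀ i → shiftD f (suc i) ≡ 1ℤ * f′ (suc i) + shiftD f′ i
  step i = dist (+ suc i) (f (suc (suc i)))
    where
    dist : ∀ m y → (1ℤ + m) * y ≡ 1ℤ * y + m * y
    dist = solve-∀

≋-isEquivalence : IsEquivalence _≋_
≋-isEquivalence = record
  { refl  = coeffwise λ k → refl
  ; sym   = λ p≋q → coeffwise λ k → sym (at p≋q k)
  ; trans = λ p≋q q≋r → coeffwise λ k → trans (at p≋q k) (at q≋r k)
  }

polyRing : CommutativeRing 0ℓ 0ℓ
polyRing = record
  { Carrier = Poly
  ; _≈_ = _≋_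
  ; _+_ = _+P_
  ; _*_ = _*P_
  ; -_ = scaleP -1ℤ
  ; 0# = []
  ; 1# = oneP
  ; isCommutativeRing = record
    { isRing = record
      { +-isAbelianGroup = record
        { isGroup = record
          { isMonoid = record
            { isSemigroup = record
              { isMagma = record
                { isEquivalence = ≋-isEquivalence
                ; ∙-cong = λ {p} {p′} {q} {q′} p≋p′ q≋q′ → coeffwise λ k →
                    trans (coeff-+ p q k) (trans (cong₂ _+_ (at p≋p′ k) (at q≋q′ k)) (sym (coeff-+ p′ q′ k)))
                }
              ; assoc = λ p q r → coeffwise λ k → begin
                  coeff (p +P q +P r) k                ≡⟨ trans (coeff-+ (p +P q) r k) (cong (_+ coeff r k) (coeff-+ p q k)) ⟩
                  coeff p k + coeff q k + coeff r k    ≡⟨ ℤₚ.+-assoc (coeff p k) _ _ ⟩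
                  coeff p k + (coeff q k + coeff r k)  ≡⟨ trans (coeff-+ p (q +P r) k) (cong (_+_ (coeff p k)) (coeff-+ q r k)) ⟨
                  coeff (p +P (q +P r)) k              ∎
              }
            ; identity = (λ p → coeffwise λ k → refl) ,
                         (λ p → coeffwise λ k → trans (coeff-+ p [] k) (ℤₚ.+-identityʳ _))
            }
          ; inverse = (λ p → coeffwise λ k → trans (coeff-+ (scaleP -1ℤ p) p k)
                         (trans (cong (_+ coeff p k) (coeff-scale -1ℤ p k)) (cancelˡ (coeff p k)))) ,
                      (λ p → coeffwise λ k → trans (coeff-+ p (scaleP -1ℤ p) k)
                         (trans (cong (_+_ (coeff p k)) (coeff-scale -1ℤ p k)) (cancelʳ (coeff p k))))
          ; ⁻¹-cong = λ {p} {q} p≋q → coeffwise λ k →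
              trans (coeff-scale -1ℤ p k) (trans (cong (-1ℤ *_) (at p≋q k)) (sym (coeff-scale -1ℤ q k)))
          }
        ; comm = λ p q → coeffwise λ k →
            trans (coeff-+ p q k) (trans (ℤₚ.+-comm (coeff p k) _) (sym (coeff-+ q p k)))
        }
      ; *-cong = λ {p} {p′} {q} {q′} p≋p′ q≋q′ → coeffwise λ k →
          trans (coeff-* p q k) (trans (conv-cong (at p≋p′) (at q≋q′) k) (sym (coeff-* p′ q′ k)))
      ; *-assoc = λ p q r → coeffwise λ k → begin
          coeff (p *P q *P r) k                     ≡⟨ coeff-* (p *P q) r k ⟩
          conv (coeff (p *P q)) (coeff r) k         ≡⟨ conv-cong (coeff-* p q) (λ _ → refl) k ⟩
          conv (conv (coeff p) (coeff q)) (coeff r) k ≡⟨ conv-assoc (coeff p) (coeff q) (coeff r) k ⟩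
          conv (coeff p) (conv (coeff q) (coeff r)) k ≡⟨ conv-cong {coeff p} (λ _ → refl) (coeff-* q r) k ⟨
          conv (coeff p) (coeff (q *P r)) k         ≡⟨ coeff-* p (q *P r) k ⟨
          coeff (p *P (q *P r)) k                   ∎
      ; *-identity = identityˡ ,
                     (λ p → coeffwise λ k → trans (comm p oneP k) (at (identityˡ p) k))
      ; distrib = (λ p q r → coeffwise λ k → begin
                    coeff (p *P (q +P r)) k                ≡⟨ comm p (q +P r) k ⟩
                    coeff ((q +P r) *P p) k                ≡⟨ at (distribʳ p q r) k ⟩
                    coeff (q *P p +P r *P p) k             ≡⟨ coeff-+ (q *P p) (r *P p) k ⟩
                    coeff (q *P p) k + coeff (r *P p) k    ≡⟨ cong₂ _+_ (comm q p k) (comm r p k) ⟩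
                    coeff (p *P q) k + coeff (p *P r) k    ≡⟨ coeff-+ (p *P q) (p *P r) k ⟨
                    coeff (p *P q +P p *P r) k             ∎) ,
                  distribʳ
      }
    ; *-comm = λ p q → coeffwise (comm p q)
    }
  }
  where
  cancelˡ : ∀ x → -1ℤ * x + x ≡ 0ℤ
  cancelˡ = solve-∀
  cancelʳ : ∀ x → x + -1ℤ * x ≡ 0ℤ
  cancelʳ = solve-∀

  comm : ∀ p q k → coeff (p *P q) k ≡ coeff (q *P p) k
  comm p q k = trans (coeff-* p q k) (trans (conv-comm (coeff p) (coeff q) k) (sym (coeff-* q p k)))

  identityˡ : ∀ p → oneP *P p ≋ p
  identityˡ p = coeffwise λ k → trans (coeff-* oneP p k) (one k)
    where
    one : ∀ k → conv (coeff oneP) (coeff p) k ≡ coeff p k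
    one zero    = ℤₚ.*-identityˡ _
    one (suc k) = trans (cong₂ _+_ (ℤₚ.*-identityˡ (coeff p (suc k)))
      (conv-zeroˡ {coeff []} (coeff p) (λ _ → refl) k)) (ℤₚ.+-identityʳ _)

  distribʳ : ∀ p q r → (q +P r) *P p ≋ q *P p +P r *P p
  distribʳ p q r = coeffwise λ k → begin
    coeff ((q +P r) *P p) k
      ≡⟨ coeff-* (q +P r) p k ⟩
    conv (coeff (q +P r)) (coeff p) k
      ≡⟨ conv-cong (λ i → trans (coeff-+ q r i) (cong (_+ coeff r i) (sym (ℤₚ.*-identityˡ (coeff q i))))) (λ _ → refl) k ⟩
    conv (λ i → 1ℤ * coeff q i + coeff r i) (coeff p) k
      ≡⟨ conv-linearˡ 1ℤ (coeff q) (coeff r) (coeff p) k ⟩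
    1ℤ * conv (coeff q) (coeff p) k + conv (coeff r) (coeff p) k
      ≡⟨ cong₂ _+_ (trans (ℤₚ.*-identityˡ _) (sym (coeff-* q p k))) (sym (coeff-* r p k)) ⟩
    coeff (q *P p) k + coeff (r *P p) k
      ≡⟨ coeff-+ (q *P p) (r *P p) k ⟨
    coeff (q *P p +P r *P p) k ∎

D-cong : ∀ {p q} → p ≋ q → D p ≋ D q
D-cong {p} {q} p≋q = coeffwise λ k → trans (coeff-D p k) (trans (cong (+ suc k *_) (at p≋q (suc k))) (sym (coeff-D q k)))

D-+ : ∀ p q → D (p +P q) ≋ D p +P D q
D-+ p q = coeffwise λ k → begin
  coeff (D (p +P q)) k
    ≡⟨ trans (coeff-D (p +P q) k) (cong (+ suc k *_) (coeff-+ p q (suc k))) ⟩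
  + suc k * (coeff p (suc k) + coeff q (suc k))
    ≡⟨ ℤₚ.*-distribˡ-+ (+ suc k) (coeff p (suc k)) (coeff q (suc k)) ⟩
  + suc k * coeff p (suc k) + + suc k * coeff q (suc k)
    ≡⟨ cong₂ _+_ (coeff-D p k) (coeff-D q k) ⟨
  coeff (D p) k + coeff (D q) k
    ≡⟨ coeff-+ (D p) (D q) k ⟨
  coeff (D p +P D q) k ∎

D-* : ∀ p q → D (p *P q) ≋ D p *P q +P p *P D q
D-* p q = coeffwise λ k → begin
  coeff (D (p *P q)) k
    ≡⟨ trans (coeff-D (p *P q) k) (cong (+ suc k *_) (coeff-* p q (suc k))) ⟩
  + suc k * conv (coeff p) (coeff q) (suc k)
    ≡⟨ conv-leibniz (coeff p) (coeff q) k ⟩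
  conv (shiftD (coeff p)) (coeff q) k + conv (coeff p) (shiftD (coeff q)) k
    ≡⟨ cong₂ _+_ (conv-cong (coeff-D p) (λ _ → refl) k) (conv-cong {coeff p} (λ _ → refl) (coeff-D q) k) ⟨
  conv (coeff (D p)) (coeff q) k + conv (coeff p) (coeff (D q)) k
    ≡⟨ cong₂ _+_ (coeff-* (D p) q k) (coeff-* p (D q) k) ⟨
  coeff (D p *P q) k + coeff (p *P D q) k
    ≡⟨ coeff-+ (D p *P q) (p *P D q) k ⟨
  coeff (D p *P q +P p *P D q) k ∎

open Summation ℤₚ.+-*-commutativeRing
module Z = Determinant ℤₚ.+-*-commutativeRing
module P = Determinant polyRing
module PS = Summation polyRing
module PR = CommutativeRing polyRing

-- The characteristic polynomial and its resolvent

coeff-∑ : ∀ {n} (f : Fin n → Poly) k → coeff (PS.∑ f) k ≡ ∑ (λ i → coeff (f i) k)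
coeff-∑ {zero}  f k = trans (at (PS.∑-nil f) k) (sym (∑-nil _))
coeff-∑ {suc n} f k = trans (at (PS.∑-suc f) k) (trans (coeff-+ (f zero) _ k)
  (trans (cong (_+_ (coeff (f zero) k)) (coeff-∑ (f ∘ suc) k)) (sym (∑-suc _))))

sumFin≋∑ : ∀ {n} (f : Fin n → Poly) → sumFin f ≋ PS.∑ f
sumFin≋∑ {zero}  f = PR.sym (PS.∑-nil f)
sumFin≋∑ {suc n} f = PR.trans (PR.+-congˡ {f zero} (sumFin≋∑ (f ∘ suc))) (PR.sym (PS.∑-suc f))

coeff-sgn-* : ∀ j p k → coeff (P.sgn j *P p) k ≡ altSign j * coeff p k
coeff-sgn-* zero    p k = trans (at (PR.*-identityˡ p) k) (sym (ℤₚ.*-identityˡ _))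
coeff-sgn-* (suc j) p k = begin
  coeff (scaleP -1ℤ (P.sgn j) *P p) k  ≡⟨ at (-‿distribˡ-* (P.sgn j) p) k ⟨
  coeff (scaleP -1ℤ (P.sgn j *P p)) k  ≡⟨ coeff-scale -1ℤ (P.sgn j *P p) k ⟩
  -1ℤ * coeff (P.sgn j *P p) k         ≡⟨ cong (-1ℤ *_) (coeff-sgn-* j p k) ⟩
  -1ℤ * (altSign j * coeff p k)        ≡⟨ negate (altSign j) (coeff p k) ⟩
  - altSign j * coeff p k              ∎
  where
  open import Algebra.Properties.Ring PR.ring using (-‿distribˡ-*)
  negate : ∀ x y → -1ℤ * (x * y) ≡ - x * y
  negate = solve-∀

det≋ : ∀ n (M : Fin n → Fin n → Poly) → det n M ≋ P.Det M
det≋ zero    M = PR.refl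
det≋ (suc n) M = PR.trans (sumFin≋∑ (λ j → scaleP (altSign (toℕ j)) (M zero j *P det n (P.minor M j)))) (PS.∑-cong λ j → coeffwise λ k → trans
  (coeff-scale (altSign (toℕ j)) (M zero j *P det n (P.minor M j)) k)
  (trans (sym (coeff-sgn-* (toℕ j) _ k))
    (at (PR.*-congˡ {P.sgn (toℕ j)} (PR.*-congˡ {M zero j} (det≋ n (P.minor M j)))) k)))

altSign≡sgn : ∀ k → altSign k ≡ Z.sgn k
altSign≡sgn zero    = refl
altSign≡sgn (suc k) = cong -_ (altSign≡sgn k)

conv-linear-factor : ∀ f g → (∀ k → f (suc (suc k)) ≡ 0ℤ) → ∀ k →
                     conv f g (suc k) ≡ f 0 * g (suc k) + f 1 * g k
conv-linear-factor f g f≡0 zero    = refl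
conv-linear-factor f g f≡0 (suc k) = cong (_+_ (f 0 * g (suc (suc k)))) (trans
  (cong (_+_ (f 1 * g (suc k))) (conv-zeroˡ g f≡0 k)) (ℤₚ.+-identityʳ _))

det-degree : ∀ {n} (M : Fin n → Fin n → Poly) → (∀ i j k → coeff (M i j) (suc (suc k)) ≡ 0ℤ) →
             ∀ k → n < k → coeff (P.Det M) k ≡ 0ℤ
det-degree {zero}  M deg (suc k) n<k       = refl
det-degree {suc n} M deg (suc k) (s≤s n<k) = trans (coeff-∑ _ (suc k)) (∑-zero λ j → begin
  coeff (P.sgn (toℕ j) *P (M zero j *P P.Det (P.minor M j))) (suc k)
    ≡⟨ coeff-sgn-* (toℕ j) _ (suc k) ⟩
  altSign (toℕ j) * coeff (M zero j *P P.Det (P.minor M j)) (suc k)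
    ≡⟨ cong (altSign (toℕ j) *_) (trans (coeff-* (M zero j) _ (suc k)) (conv-linear-factor (coeff (M zero j)) _ (deg zero j) k)) ⟩
  altSign (toℕ j) * (coeff (M zero j) 0 * coeff (P.Det (P.minor M j)) (suc k) + coeff (M zero j) 1 * coeff (P.Det (P.minor M j)) k)
    ≡⟨ cong (altSign (toℕ j) *_) (cong₂ (λ x y → coeff (M zero j) 0 * x + coeff (M zero j) 1 * y)
         (det-degree (P.minor M j) (λ i l → deg (suc i) (punchIn j l)) (suc k) (ℕₚ.m<n⇒m<1+n n<k))
         (det-degree (P.minor M j) (λ i l → deg (suc i) (punchIn j l)) k n<k)) ⟩
  altSign (toℕ j) * (coeff (M zero j) 0 * 0ℤ + coeff (M zero j) 1 * 0ℤ)
    ≡⟨ vanish (altSign (toℕ j)) (coeff (M zero j) 0) (coeff (M zero j) 1) ⟩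
  0ℤ ∎)
  where
  vanish : ∀ x y z → x * (y * 0ℤ + z * 0ℤ) ≡ 0ℤ
  vanish = solve-∀

-- For entries of degree at most one, each row contributes at most one factor x, so x^n takes the
-- linear coefficient from every row. For x I - A these form the identity matrix.
det-leading : ∀ {n} (M : Fin n → Fin n → Poly) → (∀ i j k → coeff (M i j) (suc (suc k)) ≡ 0ℤ) →
              coeff (P.Det M) n ≡ Z.Det (λ i j → coeff (M i j) 1)
det-leading {zero}  M deg = refl
det-leading {suc n} M deg = trans (coeff-∑ _ (suc n)) (∑-cong λ j → begin
  coeff (P.sgn (toℕ j) *P (M zero j *P P.Det (P.minor M j))) (suc n)
    ≡⟨ coeff-sgn-* (toℕ j) _ (suc n) ⟩
  altSign (toℕ j) * coeff (M zero j *P P.Det (P.minor M j)) (suc n)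
    ≡⟨ cong (altSign (toℕ j) *_) (trans (coeff-* (M zero j) _ (suc n)) (conv-linear-factor (coeff (M zero j)) _ (deg zero j) n)) ⟩
  altSign (toℕ j) * (coeff (M zero j) 0 * coeff (P.Det (P.minor M j)) (suc n) + coeff (M zero j) 1 * coeff (P.Det (P.minor M j)) n)
    ≡⟨ cong₂ _*_ (altSign≡sgn (toℕ j)) (cong₂ (λ x y → coeff (M zero j) 0 * x + coeff (M zero j) 1 * y)
         (det-degree (P.minor M j) (λ i l → deg (suc i) (punchIn j l)) (suc n) (ℕₚ.n<1+n n))
         (det-leading (P.minor M j) (λ i l → deg (suc i) (punchIn j l)))) ⟩
  Z.sgn (toℕ j) * (coeff (M zero j) 0 * 0ℤ + coeff (M zero j) 1 * Z.Det (Z.minor (λ i j → coeff (M i j) 1) j))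
    ≡⟨ cong (Z.sgn (toℕ j) *_) (drop-zero (coeff (M zero j) 0) _) ⟩
  Z.sgn (toℕ j) * (coeff (M zero j) 1 * Z.Det (Z.minor (λ i j → coeff (M i j) 1) j)) ∎)
  where
  drop-zero : ∀ x y → x * 0ℤ + y ≡ y
  drop-zero = solve-∀

module CharacteristicPolynomial {n} (A : Matrix n) where

  charMatrix : Fin n → Fin n → Poly
  charMatrix i j = if does (i Fin.≟ j) then (- A i j) ∷ 1ℤ ∷ [] else (- A i j) ∷ []

  χ : Poly
  χ = charPoly A

  χ≋det : χ ≋ P.Det charMatrix
  χ≋det = det≋ n charMatrix

  charMatrix-coeff₁ : ∀ i j → coeff (charMatrix i j) 1 ≡ unit i j
  charMatrix-coeff₁ i j with does (i Fin.≟ j)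
  ... | true  = refl
  ... | false = refl

  charMatrix-coeff₀ : ∀ i j → coeff (charMatrix i j) 0 ≡ - A i j
  charMatrix-coeff₀ i j with does (i Fin.≟ j)
  ... | true  = refl
  ... | false = refl

  charMatrix-degree : ∀ i j k → coeff (charMatrix i j) (suc (suc k)) ≡ 0ℤ
  charMatrix-degree i j k with does (i Fin.≟ j)
  ... | true  = refl
  ... | false = refl

  χ-degree : ∀ k → n < k → coeff χ k ≡ 0ℤ
  χ-degree k n<k = trans (at χ≋det k) (det-degree charMatrix charMatrix-degree k n<k)

  χ-monic : coeff χ n ≡ 1ℤ
  χ-monic = begin
    coeff χ n                                  ≡⟨ at χ≋det n ⟩
    coeff (P.Det charMatrix) n                 ≡⟨ det-leading charMatrix charMatrix-degree ⟩
    Z.Det (λ i j → coeff (charMatrix i j) 1)   ≡⟨ Z.det-cong {n} charMatrix-coeff₁ ⟩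
    Z.Det (unit {n})                             ≡⟨ Z.det-unit {n} ⟩
    1ℤ                                         ∎

  -- The adjugate of x I - A. Comparing coefficients in (x I - A) adj (x I - A) = χ I gives the
  -- Faddeev-LeVerrier recursion of `resolvent-zero` and `resolvent-suc`.
  resolvent : Fin n → Fin n → Poly
  resolvent = P.adjugate charMatrix

  coeff-*-unit : ∀ p (i j : Fin n) k → coeff (p *P PS.unit i j) k ≡ coeff p k * unit i j
  coeff-*-unit p i j k with does (i Fin.≟ j)
  ... | true  = trans (at (PR.*-identityʳ p) k) (sym (ℤₚ.*-identityʳ _))
  ... | false = trans (at (PR.zeroʳ p) k) (sym (ℤₚ.*-zeroʳ (coeff p k)))

  resolvent-row : ∀ i j k → ∑ (λ l → coeff (charMatrix i l *P resolvent l j) k) ≡ coeff χ k * unit i j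
  resolvent-row i j k = begin
    ∑ (λ l → coeff (charMatrix i l *P resolvent l j) k)
      ≡⟨ coeff-∑ _ k ⟨
    coeff (PS.∑ (λ l → charMatrix i l *P resolvent l j)) k
      ≡⟨ at (P.adjugate-inverse charMatrix i j) k ⟩
    coeff (P.Det charMatrix *P PS.unit i j) k
      ≡⟨ at (PR.*-congʳ {PS.unit i j} χ≋det) k ⟨
    coeff (χ *P PS.unit i j) k
      ≡⟨ coeff-*-unit χ i j k ⟩
    coeff χ k * unit i j ∎

  resolvent-zero : ∀ i j → ∑ (λ l → A i l * coeff (resolvent l j) 0) + coeff χ 0 * unit i j ≡ 0ℤ
  resolvent-zero i j = begin
    ∑ (λ l → A i l * r l) + coeff χ 0 * unit i j
      ≡⟨ cong (_+_ (∑ (λ l → A i l * r l))) (resolvent-row i j 0) ⟨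
    ∑ (λ l → A i l * r l) + ∑ (λ l → coeff (charMatrix i l *P resolvent l j) 0)
      ≡⟨ ∑-distrib-+ _ _ ⟨
    ∑ (λ l → A i l * r l + coeff (charMatrix i l *P resolvent l j) 0)
      ≡⟨ ∑-zero (λ l → trans (cong (_+_ (A i l * r l)) (trans (coeff-* (charMatrix i l) (resolvent l j) 0)
           (cong (_* r l) (charMatrix-coeff₀ i l)))) (cancel (A i l) (r l))) ⟩
    0ℤ ∎
    where
    r : Fin n → ℤ
    r l = coeff (resolvent l j) 0
    cancel : ∀ x y → x * y + - x * y ≡ 0ℤ
    cancel = solve-∀

  resolvent-suc : ∀ i j k → coeff (resolvent i j) k ≡
    ∑ (λ l → A i l * coeff (resolvent l j) (suc k)) + coeff χ (suc k) * unit i j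
  resolvent-suc i j k = sym (begin
    ∑ (λ l → A i l * r (suc k) l) + coeff χ (suc k) * unit i j
      ≡⟨ cong (_+_ (∑ (λ l → A i l * r (suc k) l))) (resolvent-row i j (suc k)) ⟨
    ∑ (λ l → A i l * r (suc k) l) + ∑ (λ l → coeff (charMatrix i l *P resolvent l j) (suc k))
      ≡⟨ ∑-distrib-+ _ _ ⟨
    ∑ (λ l → A i l * r (suc k) l + coeff (charMatrix i l *P resolvent l j) (suc k))
      ≡⟨ ∑-cong (λ l → trans (cong (_+_ (A i l * r (suc k) l)) (product l)) (cancel (A i l) (r (suc k) l) (unit l i) (r k l))) ⟩
    ∑ (λ l → r k l * unit l i)
      ≡⟨ ∑-unit (r k) i ⟩
    r k i ∎)
    where
    r : ℕ → Fin n → ℤ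
    r k l = coeff (resolvent l j) k
    product : ∀ l → coeff (charMatrix i l *P resolvent l j) (suc k) ≡ - A i l * r (suc k) l + unit l i * r k l
    product l = trans (coeff-* (charMatrix i l) (resolvent l j) (suc k))
      (trans (conv-linear-factor (coeff (charMatrix i l)) _ (charMatrix-degree i l) k)
        (cong₂ (λ x y → x * r (suc k) l + y * r k l) (charMatrix-coeff₀ i l) (trans (charMatrix-coeff₁ i l) (unit-sym i l))))
    cancel : ∀ x y u z → x * y + (- x * y + u * z) ≡ z * u
    cancel = solve-∀

  -- Jacobi's formula: differentiating row i of x I - A gives the i-th unit row, so the summands of
  -- `∂-det` are the diagonal entries of the adjugate.
  resolvent-trace : ∀ k → ∑ (λ i → coeff (resolvent i i) k) ≡ + suc k * coeff χ (suc k)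
  resolvent-trace k = begin
    ∑ (λ i → coeff (resolvent i i) k)
      ≡⟨ coeff-∑ _ k ⟨
    coeff (PS.∑ (λ i → resolvent i i)) k
      ≡⟨ at (PS.∑-cong (λ i → P.det-≔-cong charMatrix i (λ j → derivative i j))) k ⟨
    coeff (PS.∑ (λ i → P.Det (charMatrix [ i ≔ D ∘ charMatrix i ]))) k
      ≡⟨ at (∂-det charMatrix) k ⟨
    coeff (D (P.Det charMatrix)) k
      ≡⟨ at (D-cong χ≋det) k ⟨
    coeff (D χ) k
      ≡⟨ coeff-D χ k ⟩
    + suc k * coeff χ (suc k) ∎
    where
    open P.Derivation D D-cong D-+ D-* using (∂-det)
    derivative : ∀ i j → D (charMatrix i j) ≋ PS.unit i j
    derivative i j = coeffwise go
      where
      go : D (charMatrix i j) ≈P PS.unit i j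
      go k with does (i Fin.≟ j)
      go zero          | true  = refl
      go (suc zero)    | true  = refl
      go (suc (suc k)) | true  = refl
      go zero          | false = refl
      go (suc k)       | false = refl

-- Newton's identities

-- Downward induction. The recursions below express index k through suc k, and they can start
-- anywhere beyond the length of the lists, where all terms vanish.
descent : ∀ {p} {P : ℕ → Set p} K → (∀ k → K ≤ k → P k) → (∀ k → P (suc k) → P k) → ∀ k → P k
descent zero    large step k = large k z≤n
descent {P = P} (suc K) large step = descent {P = P} K
  (λ k K≤k → step k (large (suc k) (s≤s K≤k))) step

coeff-large : ∀ p k → length p ≤ k → coeff p k ≡ 0ℤ
coeff-large []      k       p≤k       = refl
coeff-large (a ∷ p) (suc k) (s≤s p≤k) = coeff-large p k p≤k

drop-large : ∀ (p : Poly) k → length p ≤ k → drop k p ≡ []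
drop-large []      zero    p≤k       = refl
drop-large []      (suc k) p≤k       = refl
drop-large (a ∷ p) (suc k) (s≤s p≤k) = drop-large p k p≤k

coeff-drop : ∀ p k j → coeff (drop k p) j ≡ coeff p (k ℕ.+ j)
coeff-drop p       zero    j = refl
coeff-drop []      (suc k) j = refl
coeff-drop (a ∷ p) (suc k) j = coeff-drop p k j

bounded : ∀ {n} (f : Fin n → ℕ) → ∃ λ K → ∀ i → f i ≤ K
bounded {zero}  f = 0 , λ ()
bounded {suc n} f with bounded (f ∘ suc)
... | K , f≤K = f zero ⊔ K , λ
  { zero    → ℕₚ.m≤m⊔n (f zero) K
  ; (suc i) → ℕₚ.≤-trans (f≤K i) (ℕₚ.m≤n⊔m (f zero) K) }

-- The linear functional that sends x^k to `t k`. It serves three purposes: `geometric c` evaluates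
-- at c, the i-th entries of A^k v give those of p(A) v, and power sums give the sum of p over the
-- roots.
τ : (ℕ → ℤ) → Poly → ℤ
τ t []      = 0ℤ
τ t (a ∷ p) = a * t 0 + τ (t ∘ suc) p

τ-zero : ∀ t p → (∀ k → coeff p k ≡ 0ℤ) → τ t p ≡ 0ℤ
τ-zero t []      p≡0 = refl
τ-zero t (a ∷ p) p≡0 = cong₂ (λ x y → x * t 0 + y) (p≡0 0) (τ-zero (t ∘ suc) p (p≡0 ∘ suc))

τ-cong : ∀ t p q → (∀ k → coeff p k ≡ coeff q k) → τ t p ≡ τ t q
τ-cong t []      q       p≡q = sym (τ-zero t q (sym ∘ p≡q))
τ-cong t (a ∷ p) []      p≡q = τ-zero t (a ∷ p) p≡q
τ-cong t (a ∷ p) (b ∷ q) p≡q = cong₂ (λ x y → x * t 0 + y) (p≡q 0) (τ-cong (t ∘ suc) p q (p≡q ∘ suc))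

τ-seq-cong : ∀ {t t′} → (∀ k → t k ≡ t′ k) → ∀ p → τ t p ≡ τ t′ p
τ-seq-cong t≡t′ []      = refl
τ-seq-cong t≡t′ (a ∷ p) = cong₂ (λ x y → a * x + y) (t≡t′ 0) (τ-seq-cong (t≡t′ ∘ suc) p)

τ-seq-linear : ∀ c t t′ p → τ (λ k → c * t k + t′ k) p ≡ c * τ t p + τ t′ p
τ-seq-linear c t t′ []      = sym (trans (ℤₚ.+-identityʳ _) (ℤₚ.*-zeroʳ c))
τ-seq-linear c t t′ (a ∷ p) = trans (cong (_+_ (a * (c * t 0 + t′ 0))) (τ-seq-linear c (t ∘ suc) (t′ ∘ suc) p))
  (regroup a c (t 0) (t′ 0) (τ (t ∘ suc) p) (τ (t′ ∘ suc) p))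
  where
  regroup : ∀ a c x y s r → a * (c * x + y) + (c * s + r) ≡ c * (a * x + s) + (a * y + r)
  regroup = solve-∀

τ-+ : ∀ t p q → τ t (p +P q) ≡ τ t p + τ t q
τ-+ t []      q       = sym (ℤₚ.+-identityˡ _)
τ-+ t (a ∷ p) []      = sym (ℤₚ.+-identityʳ _)
τ-+ t (a ∷ p) (b ∷ q) = trans (cong (_+_ ((a + b) * t 0)) (τ-+ (t ∘ suc) p q))
  (regroup a b (t 0) (τ (t ∘ suc) p) (τ (t ∘ suc) q))
  where
  regroup : ∀ a b x s r → (a + b) * x + (s + r) ≡ (a * x + s) + (b * x + r)
  regroup = solve-∀

τ-scale : ∀ t c p → τ t (scaleP c p) ≡ c * τ t p
τ-scale t c []      = sym (ℤₚ.*-zeroʳ c)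
τ-scale t c (a ∷ p) = trans (cong (_+_ (c * a * t 0)) (τ-scale (t ∘ suc) c p)) (regroup c a (t 0) _)
  where
  regroup : ∀ c a x s → c * a * x + c * s ≡ c * (a * x + s)
  regroup = solve-∀

τ-∑ : ∀ {m} (c : Fin m → ℤ) (s : Fin m → ℕ → ℤ) p →
      τ (λ k → ∑ (λ l → c l * s l k)) p ≡ ∑ (λ l → c l * τ (s l) p)
τ-∑ c s []      = sym (∑-zero λ l → ℤₚ.*-zeroʳ (c l))
τ-∑ c s (a ∷ p) = begin
  a * ∑ (λ l → c l * s l 0) + τ (λ k → ∑ (λ l → c l * s l (suc k))) p
    ≡⟨ cong (_+_ (a * ∑ (λ l → c l * s l 0))) (τ-∑ c (λ l → s l ∘ suc) p) ⟩
  a * ∑ (λ l → c l * s l 0) + ∑ (λ l → c l * τ (s l ∘ suc) p)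
    ≡⟨ ∑-linear a _ _ ⟨
  ∑ (λ l → a * (c l * s l 0) + c l * τ (s l ∘ suc) p)
    ≡⟨ ∑-cong (λ l → regroup a (c l) (s l 0) (τ (s l ∘ suc) p)) ⟩
  ∑ (λ l → c l * (a * s l 0 + τ (s l ∘ suc) p)) ∎
  where
  regroup : ∀ a c x s → a * (c * x) + c * s ≡ c * (a * x + s)
  regroup = solve-∀

τ-drop : ∀ t p k → τ t (drop k p) ≡ coeff p k * t 0 + τ (t ∘ suc) (drop (suc k) p)
τ-drop t []      zero    = refl
τ-drop t []      (suc k) = refl
τ-drop t (a ∷ p) zero    = refl
τ-drop t (a ∷ p) (suc k) = τ-drop t p k

geometric : ℤ → ℕ → ℤ
geometric c zero    = 1ℤ
geometric c (suc k) = c * geometric c k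

τ-geometric-suc : ∀ c p → τ (geometric c ∘ suc) p ≡ c * τ (geometric c) p
τ-geometric-suc c p = trans (τ-seq-cong (λ k → sym (ℤₚ.+-identityʳ (c * geometric c k))) p)
  (trans (τ-seq-linear c (geometric c) (λ _ → 0ℤ) p) (trans (cong (_+_ (c * τ (geometric c) p)) (zeros p)) (ℤₚ.+-identityʳ _)))
  where
  zeros : ∀ p → τ (λ _ → 0ℤ) p ≡ 0ℤ
  zeros []      = refl
  zeros (a ∷ p) = cong₂ _+_ (ℤₚ.*-zeroʳ a) (zeros p)

-- Newton's identities for the power sums t of the roots of g, including
-- the first one beyond the degree of g.
record PowerSums (g : Poly) (t : ℕ → ℤ) : Set where
  field
    newton  : ∀ k → τ t (drop k g) ≡ + k * coeff g k
    newton⁺ : τ (t ∘ suc) g ≡ 0ℤ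

record MonicOfDegree (d : ℕ) (g : Poly) : Set where
  field
    degree : ∀ k → d < k → coeff g k ≡ 0ℤ
    monic  : coeff g d ≡ 1ℤ

module LinearFactor {c f g} (f≋ : f ≋ (- c ∷ 1ℤ ∷ []) *P g) where

  factor-zero : coeff f 0 ≡ - c * coeff g 0
  factor-zero = trans (at f≋ 0) (coeff-* (- c ∷ 1ℤ ∷ []) g 0)

  factor-suc : ∀ k → coeff f (suc k) ≡ coeff g k - c * coeff g (suc k)
  factor-suc k = trans (at f≋ (suc k)) (trans (coeff-* (- c ∷ 1ℤ ∷ []) g (suc k))
    (trans (conv-linear-factor (coeff (- c ∷ 1ℤ ∷ [])) (coeff g) (λ _ → refl) k)
      (swap c (coeff g (suc k)) (coeff g k))))
    where
    swap : ∀ c x y → - c * x + 1ℤ * y ≡ y - c * x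
    swap = solve-∀

  -- Synthetic division: g_k = f_(k+1) + c g_(k+1), read from the top down.
  factor-degree : ∀ {d} → MonicOfDegree (suc d) f → MonicOfDegree d g
  factor-degree {d} f-monic = record { degree = g-degree ; monic = g-monic }
    where
    open MonicOfDegree f-monic
    solve-g : ∀ k → coeff g k ≡ coeff f (suc k) + c * coeff g (suc k)
    solve-g k = sym (trans (cong (_+ c * coeff g (suc k)) (factor-suc k)) (cancel (coeff g k) (c * coeff g (suc k))))
      where
      cancel : ∀ x y → x - y + y ≡ x
      cancel = solve-∀
    g-degree : ∀ k → d < k → coeff g k ≡ 0ℤ
    g-degree = descent {P = λ k → d < k → coeff g k ≡ 0ℤ} (length g) (λ k g≤k _ → coeff-large g k g≤k)
      λ k ih d<k → trans (solve-g k) (trans (cong₂ (λ x y → x + c * y)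
        (degree (suc k) (s≤s d<k)) (ih (ℕₚ.m<n⇒m<1+n d<k))) (trans (ℤₚ.+-identityˡ _) (ℤₚ.*-zeroʳ c)))
    g-monic : coeff g d ≡ 1ℤ
    g-monic = trans (solve-g d) (trans (cong₂ (λ x y → x + c * y) monic (g-degree (suc d) (ℕₚ.n<1+n d)))
      (cong (_+_ 1ℤ) (ℤₚ.*-zeroʳ c)))

  -- Multiplication by x becomes a shift of the sequence. For the powers of A this says f(A) v = (A
  -- - c) g(A) v.
  τ-factor : ∀ t → τ t f ≡ τ (t ∘ suc) g - c * τ t g
  τ-factor t = begin
    τ t f
      ≡⟨ τ-cong t f ((0ℤ ∷ g) +P scaleP (- c) g) same ⟩
    τ t ((0ℤ ∷ g) +P scaleP (- c) g)
      ≡⟨ trans (τ-+ t (0ℤ ∷ g) (scaleP (- c) g)) (cong (_+_ (τ t (0ℤ ∷ g))) (τ-scale t (- c) g)) ⟩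
    0ℤ * t 0 + τ (t ∘ suc) g + - c * τ t g
      ≡⟨ tidy (t 0) (τ (t ∘ suc) g) c (τ t g) ⟩
    τ (t ∘ suc) g - c * τ t g ∎
    where
    tidy : ∀ x s c r → 0ℤ * x + s + - c * r ≡ s - c * r
    tidy = solve-∀
    same : ∀ k → coeff f k ≡ coeff ((0ℤ ∷ g) +P scaleP (- c) g) k
    same zero    = trans factor-zero (sym (trans (coeff-+ (0ℤ ∷ g) (scaleP (- c) g) 0)
      (trans (ℤₚ.+-identityˡ _) (coeff-scale (- c) g 0))))
    same (suc k) = trans (factor-suc k) (sym (trans (coeff-+ (0ℤ ∷ g) (scaleP (- c) g) (suc k))
      (trans (cong (_+_ (coeff g k)) (coeff-scale (- c) g (suc k))) (neg (coeff g k) c (coeff g (suc k))))))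
      where
      neg : ∀ y c x → y + - c * x ≡ y - c * x
      neg = solve-∀

  τ-factor-drop : ∀ t k → τ t (drop (suc k) f) ≡ τ t (drop k g) - c * τ t (drop (suc k) g)
  τ-factor-drop t k = begin
    τ t (drop (suc k) f)
      ≡⟨ τ-cong t (drop (suc k) f) (drop k g +P scaleP (- c) (drop (suc k) g)) same ⟩
    τ t (drop k g +P scaleP (- c) (drop (suc k) g))
      ≡⟨ trans (τ-+ t (drop k g) _) (cong (_+_ (τ t (drop k g))) (τ-scale t (- c) (drop (suc k) g))) ⟩
    τ t (drop k g) + - c * τ t (drop (suc k) g)
      ≡⟨ neg (τ t (drop k g)) c (τ t (drop (suc k) g)) ⟩
    τ t (drop k g) - c * τ t (drop (suc k) g) ∎
    where
    neg : ∀ y c x → y + - c * x ≡ y - c * x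
    neg = solve-∀
    same : ∀ j → coeff (drop (suc k) f) j ≡ coeff (drop k g +P scaleP (- c) (drop (suc k) g)) j
    same j = begin
      coeff (drop (suc k) f) j
        ≡⟨ trans (coeff-drop f (suc k) j) (factor-suc (k ℕ.+ j)) ⟩
      coeff g (k ℕ.+ j) - c * coeff g (suc (k ℕ.+ j))
        ≡⟨ neg (coeff g (k ℕ.+ j)) c (coeff g (suc (k ℕ.+ j))) ⟨
      coeff g (k ℕ.+ j) + - c * coeff g (suc (k ℕ.+ j))
        ≡⟨ cong₂ (λ x y → x + - c * y) (coeff-drop g k j) (coeff-drop g (suc k) j) ⟨
      coeff (drop k g) j + - c * coeff (drop (suc k) g) j
        ≡⟨ trans (coeff-+ (drop k g) _ j) (cong (_+_ (coeff (drop k g) j)) (coeff-scale (- c) (drop (suc k) g) j)) ⟨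
      coeff (drop k g +P scaleP (- c) (drop (suc k) g)) j ∎

  -- Removing the root c takes c^k from the k-th power sum. The identity for `g` at k combines the
  -- one for `f` at k + 1, the one for `g` at k + 1 and a Horner step for the value of `g` at c;
  -- hence the downward induction.
  factor-powerSums : ∀ {t} → PowerSums f t → PowerSums g (λ k → t k - geometric c k)
  factor-powerSums {t} f-sums = record { newton = newton′ ; newton⁺ = newton⁺′ }
    where
    open PowerSums f-sums
    t′ ev : ℕ → ℤ
    t′ k = t k - geometric c k
    ev = geometric c

    τ-t′ : ∀ p → τ t′ p ≡ τ t p - τ ev p
    τ-t′ p = trans (τ-seq-cong (λ k → swap (t k) (ev k)) p) (trans (τ-seq-linear -1ℤ ev t p) (sym (swap (τ t p) (τ ev p))))
      where
      swap : ∀ x y → x - y ≡ -1ℤ * y + x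
      swap = solve-∀

    newton′ : ∀ k → τ t′ (drop k g) ≡ + k * coeff g k
    newton′ = descent {P = λ k → τ t′ (drop k g) ≡ + k * coeff g k} (length g)
      (λ k g≤k → trans (cong (τ t′) (drop-large g k g≤k)) (sym (trans (cong (+ k *_) (coeff-large g k g≤k)) (ℤₚ.*-zeroʳ (+ k)))))
      λ k ih → combine (+ k) c (coeff g k) (coeff g (suc k)) (τ t (drop k g)) (τ t (drop (suc k) g)) _ _ _
        (trans (sym (τ-factor-drop t k)) (trans (newton (suc k)) (cong (+ suc k *_) (factor-suc k))))
        (trans (τ-drop ev g k) (cong (_+_ (coeff g k * 1ℤ)) (τ-geometric-suc c (drop (suc k) g))))
        (τ-t′ (drop k g))
        (trans (sym (τ-t′ (drop (suc k) g))) ih)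
      where
      combine : ∀ k c gₖ gₖ₊ T T₊ E E₊ T′ → T - c * T₊ ≡ (1ℤ + k) * (gₖ - c * gₖ₊) → E ≡ gₖ * 1ℤ + c * E₊ →
                T′ ≡ T - E → T₊ - E₊ ≡ (1ℤ + k) * gₖ₊ → T′ ≡ k * gₖ
      combine k c gₖ gₖ₊ T T₊ E E₊ T′ h₁ h₂ h₃ h₄ = begin
        T′                                                            ≡⟨ h₃ ⟩
        T - E                                                         ≡⟨ cong (_-_ T) h₂ ⟩
        T - (gₖ * 1ℤ + c * E₊)                                        ≡⟨ shuffle T c T₊ E₊ gₖ ⟩
        (T - c * T₊) + c * (T₊ - E₊) - gₖ                             ≡⟨ cong₂ (λ x y → x + c * y - gₖ) h₁ h₄ ⟩
        (1ℤ + k) * (gₖ - c * gₖ₊) + c * ((1ℤ + k) * gₖ₊) - gₖ         ≡⟨ collect k c gₖ gₖ₊ ⟩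
        k * gₖ                                                        ∎
        where
        shuffle : ∀ T c T₊ E₊ gₖ → T - (gₖ * 1ℤ + c * E₊) ≡ (T - c * T₊) + c * (T₊ - E₊) - gₖ
        shuffle = solve-∀
        collect : ∀ k c gₖ gₖ₊ → (1ℤ + k) * (gₖ - c * gₖ₊) + c * ((1ℤ + k) * gₖ₊) - gₖ ≡ k * gₖ
        collect = solve-∀

    newton⁺′ : τ (t′ ∘ suc) g ≡ 0ℤ
    newton⁺′ = begin
      τ (t′ ∘ suc) g
        ≡⟨ τ-seq-cong (λ k → swap (t (suc k)) (ev (suc k))) g ⟩
      τ (λ k → -1ℤ * ev (suc k) + t (suc k)) g
        ≡⟨ τ-seq-linear -1ℤ (ev ∘ suc) (t ∘ suc) g ⟩
      -1ℤ * τ (ev ∘ suc) g + τ (t ∘ suc) g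
        ≡⟨ cong (λ x → -1ℤ * x + τ (t ∘ suc) g) (τ-geometric-suc c g) ⟩
      -1ℤ * (c * τ ev g) + τ (t ∘ suc) g
        -- The regrouped summands are the identities at index 0 of `f` and, times c, of `g`; both
        -- vanish.
        ≡⟨ shuffle c (τ ev g) (τ (t ∘ suc) g) (τ t g) ⟩
      (τ (t ∘ suc) g - c * τ t g) + c * (τ t g - τ ev g)
        ≡⟨ cong₂ (λ x y → x + c * y) (trans (sym (τ-factor t)) (newton 0)) (trans (sym (τ-t′ g)) (newton′ 0)) ⟩
      0ℤ * coeff f 0 + c * (0ℤ * coeff g 0)
        ≡⟨ vanish (coeff f 0) c (coeff g 0) ⟩
      0ℤ ∎
      where
      swap : ∀ x y → x - y ≡ -1ℤ * y + x
      swap = solve-∀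
      shuffle : ∀ c E T⁺ T → -1ℤ * (c * E) + T⁺ ≡ (T⁺ - c * T) + c * (T - E)
      shuffle = solve-∀
      vanish : ∀ x c y → 0ℤ * x + c * (0ℤ * y) ≡ 0ℤ
      vanish = solve-∀

-- Removing the eigenvalues ±1

∑-nonneg : ∀ {n} (f : Fin n → ℤ) → (∀ i → 0ℤ ℤ.≤ f i) → 0ℤ ℤ.≤ ∑ f
∑-nonneg {zero}  f f≥0 = ℤₚ.≤-reflexive (sym (∑-nil f))
∑-nonneg {suc n} f f≥0 = ℤₚ.≤-trans (ℤₚ.+-mono-≤ (f≥0 zero) (∑-nonneg (f ∘ suc) (f≥0 ∘ suc)))
  (ℤₚ.≤-reflexive (sym (∑-suc f)))

∑-nonneg≡0 : ∀ {n} (f : Fin n → ℤ) → (∀ i → 0ℤ ℤ.≤ f i) → ∑ f ≡ 0ℤ → ∀ i → f i ≡ 0ℤ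
∑-nonneg≡0 {suc n} f f≥0 ∑f≡0 i = case i
  where
  rest≥0 = ∑-nonneg (f ∘ suc) (f≥0 ∘ suc)
  sum≡0 : f zero + ∑ (f ∘ suc) ≡ 0ℤ
  sum≡0 = trans (sym (∑-suc f)) ∑f≡0
  head≡0 : f zero ≡ 0ℤ
  head≡0 = ℤₚ.≤-antisym (ℤₚ.≤-trans (ℤₚ.≤-reflexive (sym (ℤₚ.+-identityʳ _)))
    (ℤₚ.≤-trans (ℤₚ.+-monoʳ-≤ (f zero) rest≥0) (ℤₚ.≤-reflexive sum≡0))) (f≥0 zero)
  case : ∀ i → f i ≡ 0ℤ
  case zero    = head≡0
  case (suc i) = ∑-nonneg≡0 (f ∘ suc) (f≥0 ∘ suc)
    (trans (sym (ℤₚ.+-identityˡ _)) (trans (cong (_+ ∑ (f ∘ suc)) (sym head≡0)) sum≡0)) i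

square-nonneg : ∀ x → 0ℤ ℤ.≤ x * x
square-nonneg (+ m)    = ℤₚ.≤-trans (ℤ.+≤+ z≤n) (ℤₚ.≤-reflexive (ℤₚ.pos-* m m))
square-nonneg -[1+ m ] = ℤ.+≤+ z≤n

square≡0 : ∀ x → x * x ≡ 0ℤ → x ≡ 0ℤ
square≡0 x x²≡0 with ℤₚ.i*j≡0⇒i≡0∨j≡0 x x²≡0
... | inj₁ x≡0 = x≡0
... | inj₂ x≡0 = x≡0

module Operators {n} (A : Matrix n) (symmetric : ∀ i j → A i j ≡ A j i) where
  open CharacteristicPolynomial A

  Vector : Set
  Vector = Fin n → ℤ

  mul : Vector → Vector
  mul v i = ∑ (λ l → A i l * v l)

  mul-cong : ∀ {v w} → (∀ i → v i ≡ w i) → ∀ i → mul v i ≡ mul w i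
  mul-cong v≡w i = ∑-cong (λ l → cong (A i l *_) (v≡w l))

  mul-zero : ∀ {v} → (∀ i → v i ≡ 0ℤ) → ∀ i → mul v i ≡ 0ℤ
  mul-zero v≡0 i = ∑-zero λ l → trans (cong (A i l *_) (v≡0 l)) (ℤₚ.*-zeroʳ (A i l))

  mul-linear : ∀ c v w i → mul (λ l → c * v l + w l) i ≡ c * mul v i + mul w i
  mul-linear c v w i = trans (∑-cong (λ l → expand (A i l) c (v l) (w l))) (∑-linear c _ _)
    where
    expand : ∀ a c x y → a * (c * x + y) ≡ c * (a * x) + a * y
    expand = solve-∀

  mul-adjoint : ∀ v w → ∑ (λ i → mul v i * w i) ≡ ∑ (λ i → v i * mul w i)
  mul-adjoint v w = begin
    ∑ (λ i → mul v i * w i)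
      ≡⟨ ∑-cong (λ i → *-distribʳ-∑ (w i) (λ l → A i l * v l)) ⟩
    ∑ (λ i → ∑ (λ l → A i l * v l * w i))
      ≡⟨ ∑-swap _ ⟩
    ∑ (λ l → ∑ (λ i → A i l * v l * w i))
      ≡⟨ ∑-cong (λ l → ∑-cong (λ i → trans (cong (λ a → a * v l * w i) (symmetric i l)) (swap (A l i) (v l) (w i)))) ⟩
    ∑ (λ l → ∑ (λ i → v l * (A l i * w i)))
      ≡⟨ ∑-cong (λ l → sym (*-distribˡ-∑ (v l) (λ i → A l i * w i))) ⟩
    ∑ (λ l → v l * mul w l) ∎
    where
    swap : ∀ a x y → a * x * y ≡ x * (a * y)
    swap = solve-∀

  pow : ℕ → Vector → Vector
  pow zero    v = v
  pow (suc k) v = mul (pow k v)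

  act : Poly → Vector → Vector
  act p v i = τ (λ k → pow k v i) p

  act-shift : ∀ p v i → τ (λ k → pow (suc k) v i) p ≡ mul (act p v) i
  act-shift p v i = τ-∑ (A i) (λ l k → pow k v l) p

  basis : Fin n → Vector
  basis j i = unit i j

  act-drop-step : ∀ p v k i → act (drop k p) v i ≡ coeff p k * v i + mul (act (drop (suc k) p) v) i
  act-drop-step p v k i = trans (τ-drop (λ k → pow k v i) p k)
    (cong (_+_ (coeff p k * v i)) (act-shift (drop (suc k) p) v i))

  -- Both sides satisfy X_k = χ_(k+1) I + A X_(k+1) and vanish for large k: the coefficients of the
  -- adjugate are the Horner tails of χ evaluated at A.
  act-drop-χ : ∀ j k i → act (drop (suc k) χ) (basis j) i ≡ coeff (resolvent i j) k
  act-drop-χ j = descent {P = λ k → ∀ i → act (drop (suc k) χ) (basis j) i ≡ coeff (resolvent i j) k}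
    (length χ ⊔ K) large step
    where
    K = proj₁ (bounded λ i → length (resolvent i j))
    large : ∀ k → length χ ⊔ K ≤ k → ∀ i → act (drop (suc k) χ) (basis j) i ≡ coeff (resolvent i j) k
    large k bound i = trans
      (cong (λ p → act p (basis j) i) (drop-large χ (suc k) (ℕₚ.m≤n⇒m≤1+n (ℕₚ.≤-trans (ℕₚ.m≤m⊔n (length χ) K) bound))))
      (sym (coeff-large (resolvent i j) k (ℕₚ.≤-trans (proj₂ (bounded λ i → length (resolvent i j)) i)
        (ℕₚ.≤-trans (ℕₚ.m≤n⊔m (length χ) K) bound))))
    step : ∀ k → (∀ i → act (drop (suc (suc k)) χ) (basis j) i ≡ coeff (resolvent i j) (suc k)) →
           ∀ i → act (drop (suc k) χ) (basis j) i ≡ coeff (resolvent i j) k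
    step k ih i = begin
      act (drop (suc k) χ) (basis j) i
        ≡⟨ act-drop-step χ (basis j) (suc k) i ⟩
      coeff χ (suc k) * unit i j + mul (act (drop (suc (suc k)) χ) (basis j)) i
        ≡⟨ cong (_+_ (coeff χ (suc k) * unit i j)) (mul-cong ih i) ⟩
      coeff χ (suc k) * unit i j + ∑ (λ l → A i l * coeff (resolvent l j) (suc k))
        ≡⟨ ℤₚ.+-comm (coeff χ (suc k) * unit i j) _ ⟩
      ∑ (λ l → A i l * coeff (resolvent l j) (suc k)) + coeff χ (suc k) * unit i j
        ≡⟨ resolvent-suc i j k ⟨
      coeff (resolvent i j) k ∎

  cayley-hamilton : ∀ j i → act χ (basis j) i ≡ 0ℤ
  cayley-hamilton j i = begin
    act χ (basis j) i
      ≡⟨ act-drop-step χ (basis j) 0 i ⟩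
    coeff χ 0 * unit i j + mul (act (drop 1 χ) (basis j)) i
      ≡⟨ cong (_+_ (coeff χ 0 * unit i j)) (mul-cong (act-drop-χ j 0) i) ⟩
    coeff χ 0 * unit i j + ∑ (λ l → A i l * coeff (resolvent l j) 0)
      ≡⟨ ℤₚ.+-comm (coeff χ 0 * unit i j) _ ⟩
    ∑ (λ l → A i l * coeff (resolvent l j) 0) + coeff χ 0 * unit i j
      ≡⟨ resolvent-zero i j ⟩
    0ℤ ∎

  -- The factor `1ℤ` gives the trace of A^k the weighted form that `τ-∑` expects.
  traceᵏ : ℕ → ℤ
  traceᵏ k = ∑ (λ j → 1ℤ * pow k (basis j) j)

  τ-trace : ∀ p → τ traceᵏ p ≡ ∑ (λ j → act p (basis j) j)
  τ-trace p = trans (τ-∑ (λ _ → 1ℤ) (λ j k → pow k (basis j) j) p) (∑-cong λ j → ℤₚ.*-identityˡ _)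

  -- At a positive index, the trace of a Horner tail at A is the trace of a coefficient of the
  -- adjugate, hence a coefficient of χ′. The remaining two identities are the traces of χ(A) = 0
  -- and A χ(A) = 0.
  χ-powerSums : PowerSums χ traceᵏ
  χ-powerSums = record
    { newton = λ
      { zero    → trans (τ-trace χ) (∑-zero λ j → cayley-hamilton j j)
      ; (suc k) → trans (τ-trace (drop (suc k) χ)) (trans (∑-cong (λ j → act-drop-χ j k j)) (resolvent-trace k)) }
    ; newton⁺ = trans (τ-∑ (λ _ → 1ℤ) (λ j k → pow (suc k) (basis j) j) χ)
        (∑-zero λ j → trans (ℤₚ.*-identityˡ _) (trans (act-shift χ (basis j) j) (mul-zero (cayley-hamilton j) j)))
    }

  χ-monicOfDegree : MonicOfDegree n χ
  χ-monicOfDegree = record { degree = χ-degree ; monic = χ-monic }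

  N : Vector → Vector
  N v i = mul (mul v) i - v i

  -- The factor N = (A - 1) (A + 1) in front lets g lose any number of factors x - 1 and x + 1 while
  -- the relation persists.
  Annihilates : Poly → Set
  Annihilates g = ∀ j i → N (act g (basis j)) i ≡ 0ℤ

  -- With z = (A² − I) u = (A − c) y, self-adjointness turns (A − c) z = 0
  -- into ⟨ z , z ⟩ = ⟨ (A − c) z , y ⟩ = 0.
  N-cancel : ∀ c u → c * c ≡ 1ℤ → (∀ i → N (λ l → mul u l - c * u l) i ≡ 0ℤ) → ∀ i → N u i ≡ 0ℤ
  N-cancel c u c²≡1 hyp i = square≡0 (z i) (∑-nonneg≡0 (λ i → z i * z i) (λ i → square-nonneg (z i)) norm≡0 i)
    where
    z y : Vector
    z = N u
    y l = c * u l + mul u l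

    mul-y : ∀ i → mul y i ≡ c * mul u i + mul (mul u) i
    mul-y = mul-linear c u (mul u)

    z≡ : ∀ i → z i ≡ mul y i - c * y i
    z≡ i = sym (begin
      mul y i - c * y i                                 ≡⟨ cong (_- c * y i) (mul-y i) ⟩
      c * mul u i + mul (mul u) i - c * y i             ≡⟨ regroup c (u i) (mul u i) (mul (mul u) i) ⟩
      mul (mul u) i - c * c * u i                       ≡⟨ cong (λ e → mul (mul u) i - e * u i) c²≡1 ⟩
      mul (mul u) i - 1ℤ * u i                          ≡⟨ cong (_-_ (mul (mul u) i)) (ℤₚ.*-identityˡ (u i)) ⟩
      z i                                               ∎)
      where
      regroup : ∀ c x x₁ x₂ → c * x₁ + x₂ - c * (c * x + x₁) ≡ x₂ - c * c * x
      regroup = solve-∀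

    mul-z : ∀ i → mul z i ≡ c * z i
    mul-z i = begin
      mul z i
        ≡⟨ mul-cong (λ l → flip (mul (mul u) l) (u l)) i ⟩
      mul (λ l → -1ℤ * u l + mul (mul u) l) i
        ≡⟨ mul-linear -1ℤ u (mul (mul u)) i ⟩
      -1ℤ * mul u i + mul (mul (mul u)) i
        ≡⟨ shuffle c (u i) (mul u i) (mul (mul u) i) (mul (mul (mul u)) i) ⟩
      (- c * mul (mul u) i + mul (mul (mul u)) i - (mul u i - c * u i)) + c * z i
        ≡⟨ cong (λ e → e - (mul u i - c * u i) + c * z i) twice ⟨
      N (λ l → mul u l - c * u l) i + c * z i
        ≡⟨ trans (cong (_+ c * z i) (hyp i)) (ℤₚ.+-identityˡ _) ⟩
      c * z i ∎
      where
      flip : ∀ x y → x - y ≡ -1ℤ * y + x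
      flip = solve-∀
      flip′ : ∀ c x y → x - c * y ≡ - c * y + x
      flip′ = solve-∀
      shuffle : ∀ c x x₁ x₂ x₃ → -1ℤ * x₁ + x₃ ≡ (- c * x₂ + x₃ - (x₁ - c * x)) + c * (x₂ - x)
      shuffle = solve-∀
      once : ∀ l → mul (λ l → mul u l - c * u l) l ≡ - c * mul u l + mul (mul u) l
      once l = trans (mul-cong (λ l → flip′ c (mul u l) (u l)) l) (mul-linear (- c) u (mul u) l)
      twice : mul (mul (λ l → mul u l - c * u l)) i ≡ - c * mul (mul u) i + mul (mul (mul u)) i
      twice = trans (mul-cong once i) (mul-linear (- c) (mul u) (mul (mul u)) i)

    norm≡0 : ∑ (λ i → z i * z i) ≡ 0ℤ
    norm≡0 = begin
      ∑ (λ i → z i * z i)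
        ≡⟨ ∑-cong (λ i → trans (cong (z i *_) (z≡ i)) (expand (z i) (mul y i) c (y i))) ⟩
      ∑ (λ i → - c * (z i * y i) + z i * mul y i)
        ≡⟨ ∑-linear (- c) _ _ ⟩
      - c * ∑ (λ i → z i * y i) + ∑ (λ i → z i * mul y i)
        ≡⟨ cong (_+_ (- c * ∑ (λ i → z i * y i))) (trans (sym (mul-adjoint z y))
             (trans (∑-cong (λ i → trans (cong (_* y i) (mul-z i)) (ℤₚ.*-assoc c (z i) (y i)))) (sym (*-distribˡ-∑ c _)))) ⟩
      - c * ∑ (λ i → z i * y i) + c * ∑ (λ i → z i * y i)
        ≡⟨ cancel c (∑ (λ i → z i * y i)) ⟩
      0ℤ ∎
      where
      expand : ∀ z m c y → z * (m - c * y) ≡ - c * (z * y) + z * m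
      expand = solve-∀
      cancel : ∀ c x → - c * x + c * x ≡ 0ℤ
      cancel = solve-∀

  N-cong : ∀ {v w} → (∀ i → v i ≡ w i) → ∀ i → N v i ≡ N w i
  N-cong v≡w i = cong₂ _-_ (mul-cong (mul-cong v≡w) i) (v≡w i)

  record Spectrum (d : ℕ) (g : Poly) (t : ℕ → ℤ) : Set where
    field
      monicOfDegree : MonicOfDegree d g
      powerSums     : PowerSums g t
      annihilates   : Annihilates g

  factor-spectrum : ∀ {c d f g t} → c * c ≡ 1ℤ → f ≋ (- c ∷ 1ℤ ∷ []) *P g →
                    Spectrum (suc d) f t → Spectrum d g (λ k → t k - geometric c k)
  factor-spectrum {c} {g = g} c²≡1 f≋ spectrum = record
    { monicOfDegree = factor-degree monicOfDegree
    ; powerSums     = factor-powerSums powerSums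
    ; annihilates   = λ j → N-cancel c (act g (basis j)) c²≡1 λ i →
        trans (N-cong (λ l → sym (trans (τ-factor (λ k → pow k (basis j) l))
          (cong (_- c * act g (basis j) l) (act-shift g (basis j) l)))) i) (annihilates j i)
    }
    where
    open Spectrum spectrum
    open LinearFactor {c} f≋

  -- As c^(k+2) = c^k for c = ±1, removing such roots changes no difference of power sums two steps
  -- apart. For A these differences are the traces of A^k N.
  SameDifferences : (ℕ → ℤ) → (ℕ → ℤ) → Set
  SameDifferences t t′ = ∀ k → t′ (suc (suc k)) - t′ k ≡ t (suc (suc k)) - t k

  remove-geometric : ∀ c t → c * c ≡ 1ℤ → SameDifferences t (λ k → t k - geometric c k)
  remove-geometric c t c²≡1 k = begin
    (t (suc (suc k)) - c * (c * geometric c k)) - (t k - geometric c k)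
      ≡⟨ shuffle (t (suc (suc k))) c (geometric c k) (t k) ⟩
    (t (suc (suc k)) - t k) + (1ℤ - c * c) * geometric c k
      ≡⟨ cong (λ e → (t (suc (suc k)) - t k) + (1ℤ - e) * geometric c k) c²≡1 ⟩
    (t (suc (suc k)) - t k) + 0ℤ
      ≡⟨ ℤₚ.+-identityʳ _ ⟩
    t (suc (suc k)) - t k ∎
    where
    shuffle : ∀ x c e y → (x - c * (c * e)) - (y - e) ≡ (x - y) + (1ℤ - c * c) * e
    shuffle = solve-∀

  -- Here d counts the factors still to be removed. At d = 0 any leftover factors x - 1 and x + 1
  -- stay in the quadratic, so ±1 may be among its roots.
  peel : ∀ d a b ρ {f t} → d ≤ a ℕ.+ b → f ≋ powP xMinus1 a *P powP xPlus1 b *P ρ → Spectrum (d ℕ.+ 2) f t →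
         ∃₂ λ g t′ → Spectrum 2 g t′ × SameDifferences t t′
  peel zero    a       b       ρ {f} {t} d≤ f≋ spectrum = f , t , spectrum , λ k → refl
  peel (suc d) (suc a) b       ρ {f} {t} (s≤s d≤) f≋ spectrum
    with peel d a b ρ d≤ PR.refl (factor-spectrum {1ℤ} refl
           (PR.trans f≋ (PR.trans (PR.*-congʳ {ρ} (PR.*-assoc xMinus1 (powP xMinus1 a) (powP xPlus1 b)))
             (PR.*-assoc xMinus1 (powP xMinus1 a *P powP xPlus1 b) ρ))) spectrum)
  ... | g , t′ , spectrum′ , same = g , t′ , spectrum′ , λ k → trans (same k) (remove-geometric 1ℤ t refl k)
  peel (suc d) zero    (suc b) ρ {f} {t} (s≤s d≤) f≋ spectrum
    with peel d zero b ρ d≤ PR.refl (factor-spectrum {c = -1ℤ} refl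
           (PR.trans f≋ (PR.trans (PR.*-congʳ {ρ} (PR.trans (PR.*-identityˡ (xPlus1 *P powP xPlus1 b))
               (PR.sym (PR.*-congˡ {xPlus1} (PR.*-identityˡ (powP xPlus1 b))))))
             (PR.*-assoc xPlus1 (oneP *P powP xPlus1 b) ρ))) spectrum)
  ... | g , t′ , spectrum′ , same = g , t′ , spectrum′ , λ k → trans (same k) (remove-geometric -1ℤ t refl k)

  -- Vieta's data of q = x² - s x + p with roots θ and η. The right sides of `tr₂` and `tr₃` are θ²
  -- + η² - 2 and θ³ + η³ - θ - η, and the left sides are the traces of N and A N.
  record Quadratic : Set where
    field
      s p   : ℤ
      tr₂   : traceᵏ 2 - traceᵏ 0 ≡ s * s - p - p - + 2
      tr₃   : traceᵏ 3 - traceᵏ 1 ≡ s * s * s - + 3 * p * s - s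
      annih : ∀ j i → N (λ l → p * basis j l + (- s * mul (basis j) l + mul (mul (basis j)) l)) i ≡ 0ℤ

  from-spectrum : (∃₂ λ g t → Spectrum 2 g t × SameDifferences traceᵏ t) → Quadratic
  from-spectrum (g , t , spectrum , same) = record
    { s = - coeff g 1
    ; p = coeff g 0
    ; tr₂ = trans (sym (same 0)) (proj₁ sums)
    ; tr₃ = trans (sym (same 1)) (proj₂ sums)
    ; annih = λ j i → trans (N-cong (λ l → sym (at-g j l)) i) (annihilates j i)
    }
    where
    open Spectrum spectrum
    open MonicOfDegree monicOfDegree
    open PowerSums powerSums

    g′ : Poly
    g′ = coeff g 0 ∷ coeff g 1 ∷ 1ℤ ∷ []

    g≈g′ : ∀ k → coeff g k ≡ coeff g′ k
    g≈g′ zero                = refl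
    g≈g′ (suc zero)          = refl
    g≈g′ (suc (suc zero))    = monic
    g≈g′ (suc (suc (suc k))) = degree (suc (suc (suc k))) (s≤s (s≤s (s≤s z≤n)))

    τ-g : ∀ t k → τ t (drop k g) ≡ τ t (drop k g′)
    τ-g t k = τ-cong t (drop k g) (drop k g′) λ j →
      trans (coeff-drop g k j) (trans (g≈g′ (k ℕ.+ j)) (sym (coeff-drop g′ k j)))

    at-g : ∀ j l → act g (basis j) l ≡ coeff g 0 * basis j l + (- - coeff g 1 * mul (basis j) l + mul (mul (basis j)) l)
    at-g j l = trans (τ-g (λ k → pow k (basis j) l) 0)
      (tidy (coeff g 0) (coeff g 1) (basis j l) (mul (basis j) l) (mul (mul (basis j)) l))
      where
      tidy : ∀ p q x x₁ x₂ → p * x + (q * x₁ + (1ℤ * x₂ + 0ℤ)) ≡ p * x + (- - q * x₁ + x₂)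
      tidy = solve-∀

    sums : (t 2 - t 0 ≡ - coeff g 1 * - coeff g 1 - coeff g 0 - coeff g 0 - + 2) ×
           (t 3 - t 1 ≡ - coeff g 1 * - coeff g 1 * - coeff g 1 - + 3 * coeff g 0 * - coeff g 1 - - coeff g 1)
    sums = solve-sums (coeff g 0) (coeff g 1) (t 0) (t 1) (t 2) (t 3)
      (trans (sym (τ-g t 2)) (trans (newton 2) (cong (+ 2 *_) monic)))
      (trans (sym (τ-g t 1)) (newton 1))
      (trans (sym (τ-g t 0)) (newton 0))
      -- The identities at indices 0 to 2 determine only t 0, t 1 and t 2; the third power sum needs
      -- the one beyond the degree.
      (trans (sym (τ-g (t ∘ suc) 0)) newton⁺)
      where
      solve-sums : ∀ p q t₀ t₁ t₂ t₃ → 1ℤ * t₀ + 0ℤ ≡ + 2 * 1ℤ → q * t₀ + (1ℤ * t₁ + 0ℤ) ≡ 1ℤ * q →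
        p * t₀ + (q * t₁ + (1ℤ * t₂ + 0ℤ)) ≡ 0ℤ * p → p * t₁ + (q * t₂ + (1ℤ * t₃ + 0ℤ)) ≡ 0ℤ →
        (t₂ - t₀ ≡ - q * - q - p - p - + 2) × (t₃ - t₁ ≡ - q * - q * - q - + 3 * p * - q - - q)
      solve-sums p q t₀ t₁ t₂ t₃ h₀ h₁ h₂ h₃ =
        trans (cong₂ _-_ t₂≡ t₀≡) (end₂ p q) , trans (cong₂ _-_ t₃≡ t₁≡) (end₃ p q)
        where
        t₀≡ : t₀ ≡ + 2
        t₀≡ = trans (sym (trans (ℤₚ.+-identityʳ _) (ℤₚ.*-identityˡ t₀))) h₀
        t₁≡ : t₁ ≡ - q
        t₁≡ = trans (iso q t₀ t₁) (trans (cong₂ (λ x y → x - q * y) h₁ t₀≡) (fin q))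
          where
          iso : ∀ q t₀ t₁ → t₁ ≡ (q * t₀ + (1ℤ * t₁ + 0ℤ)) - q * t₀
          iso = solve-∀
          fin : ∀ q → 1ℤ * q - q * + 2 ≡ - q
          fin = solve-∀
        t₂≡ : t₂ ≡ q * q - p - p
        t₂≡ = trans (iso p q t₀ t₁ t₂) (trans (cong (λ x → x - (p * t₀ + q * t₁)) h₂)
          (trans (cong₂ (λ x y → 0ℤ * p - (p * x + q * y)) t₀≡ t₁≡) (fin p q)))
          where
          iso : ∀ p q t₀ t₁ t₂ → t₂ ≡ (p * t₀ + (q * t₁ + (1ℤ * t₂ + 0ℤ))) - (p * t₀ + q * t₁)
          iso = solve-∀
          fin : ∀ p q → 0ℤ * p - (p * + 2 + q * - q) ≡ q * q - p - p
          fin = solve-∀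
        t₃≡ : t₃ ≡ + 3 * p * q - q * q * q
        t₃≡ = trans (iso p q t₁ t₂ t₃) (trans (cong (λ x → x - (p * t₁ + q * t₂)) h₃)
          (trans (cong₂ (λ x y → 0ℤ - (p * x + q * y)) t₁≡ t₂≡) (fin p q)))
          where
          iso : ∀ p q t₁ t₂ t₃ → t₃ ≡ (p * t₁ + (q * t₂ + (1ℤ * t₃ + 0ℤ))) - (p * t₁ + q * t₂)
          iso = solve-∀
          fin : ∀ p q → 0ℤ - (p * - q + q * (q * q - p - p)) ≡ + 3 * p * q - q * q * q
          fin = solve-∀
        end₂ : ∀ p q → q * q - p - p - + 2 ≡ - q * - q - p - p - + 2
        end₂ = solve-∀
        end₃ : ∀ p q → + 3 * p * q - q * q * q - - q ≡ - q * - q * - q - + 3 * p * - q - - q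
        end₃ = solve-∀

  quadratic : 2 ≤ n → AllButAtMostTwoEigenvaluesPM1 A → Quadratic
  quadratic 2≤n (a , b , n∸2≤a+b , ρ , πρ≈χ) = from-spectrum
    (peel (n ∸ 2) a b ρ n∸2≤a+b (PR.sym (coeffwise πρ≈χ))
      (subst (λ d → Spectrum d χ traceᵏ) (sym (ℕₚ.m∸n+n≡m 2≤n))
        (record { monicOfDegree = χ-monicOfDegree ; powerSums = χ-powerSums
                ; annihilates = λ j i → cong₂ _-_ (mul-zero (mul-zero (cayley-hamilton j)) i) (cayley-hamilton j i) })))

-- Rank one on each part

infixl 7 _⊗_

_⊗_ : ∀ {n} → Matrix n → Matrix n → Matrix n
(X ⊗ Y) i j = ∑ (λ l → X i l * Y l j)

trace : ∀ {n} → Matrix n → ℤ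
trace X = ∑ (λ i → X i i)

∑-product : ∀ {m n} (f : Fin m → ℤ) (g : Fin n → ℤ) → ∑ (λ a → ∑ (λ b → f a * g b)) ≡ ∑ f * ∑ g
∑-product f g = trans (∑-cong λ a → sym (*-distribˡ-∑ (f a) g)) (sym (*-distribʳ-∑ (∑ g) f))

⊗-assoc : ∀ {n} (X Y W : Matrix n) i j → ((X ⊗ Y) ⊗ W) i j ≡ (X ⊗ (Y ⊗ W)) i j
⊗-assoc X Y W i j = begin
  ∑ (λ l → ∑ (λ k → X i k * Y k l) * W l j)       ≡⟨ ∑-cong (λ l → *-distribʳ-∑ (W l j) _) ⟩
  ∑ (λ l → ∑ (λ k → X i k * Y k l * W l j))       ≡⟨ ∑-swap _ ⟩
  ∑ (λ k → ∑ (λ l → X i k * Y k l * W l j))       ≡⟨ ∑-cong (λ k → trans (∑-cong λ l → ℤₚ.*-assoc (X i k) (Y k l) (W l j)) (sym (*-distribˡ-∑ (X i k) _))) ⟩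
  ∑ (λ k → X i k * ∑ (λ l → Y k l * W l j))       ∎

⊗-linearʳ : ∀ {n} (X Y U W : Matrix n) a b → (∀ l j → Y l j ≡ a * U l j + b * W l j) →
            ∀ i j → (X ⊗ Y) i j ≡ a * (X ⊗ U) i j + b * (X ⊗ W) i j
⊗-linearʳ X Y U W a b Y≡ i j = begin
  ∑ (λ l → X i l * Y l j)
    ≡⟨ ∑-cong (λ l → trans (cong (X i l *_) (Y≡ l j)) (expand (X i l) a (U l j) b (W l j))) ⟩
  ∑ (λ l → a * (X i l * U l j) + b * (X i l * W l j))
    ≡⟨ ∑-linear a _ _ ⟩
  a * (X ⊗ U) i j + ∑ (λ l → b * (X i l * W l j))
    ≡⟨ cong (_+_ (a * (X ⊗ U) i j)) (sym (*-distribˡ-∑ b _)) ⟩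
  a * (X ⊗ U) i j + b * (X ⊗ W) i j ∎
  where
  expand : ∀ x a u b w → x * (a * u + b * w) ≡ a * (x * u) + b * (x * w)
  expand = solve-∀

⊗-linearˡ : ∀ {n} (X Y U W : Matrix n) a b → (∀ i l → Y i l ≡ a * U i l + b * W i l) →
            ∀ i j → (Y ⊗ X) i j ≡ a * (U ⊗ X) i j + b * (W ⊗ X) i j
⊗-linearˡ X Y U W a b Y≡ i j = begin
  ∑ (λ l → Y i l * X l j)
    ≡⟨ ∑-cong (λ l → trans (cong (_* X l j) (Y≡ i l)) (expand (X l j) a (U i l) b (W i l))) ⟩
  ∑ (λ l → a * (U i l * X l j) + b * (W i l * X l j))
    ≡⟨ ∑-linear a _ _ ⟩
  a * (U ⊗ X) i j + ∑ (λ l → b * (W i l * X l j))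
    ≡⟨ cong (_+_ (a * (U ⊗ X) i j)) (sym (*-distribˡ-∑ b _)) ⟩
  a * (U ⊗ X) i j + b * (W ⊗ X) i j ∎
  where
  expand : ∀ x a u b w → (a * u + b * w) * x ≡ a * (u * x) + b * (w * x)
  expand = solve-∀

Symmetric : ∀ {n} → Matrix n → Set
Symmetric X = ∀ i j → X i j ≡ X j i

-- A symmetric U with U² = δ U is δ times an orthogonal projection.
-- Its rank trace U / δ, if positive, is at least 1, and exactly 1 only
-- when all 2 × 2 minors vanish (Lagrange's identity).
module ScaledProjection {n} (U : Matrix n) (δ : ℤ) (U-sym : Symmetric U)
  (U² : ∀ i j → (U ⊗ U) i j ≡ δ * U i j) where

  -- This is tr U², the sum of the squares of all entries. If U is δ times a projection of rank r,
  -- it equals δ² r, so comparing it with δ² measures the rank without division.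
  y : ℤ
  y = δ * trace U

  y≡∑² : y ≡ ∑ (λ i → ∑ (λ a → U i a * U i a))
  y≡∑² = trans (*-distribˡ-∑ δ _) (∑-cong λ i → trans (sym (U² i i))
    (∑-cong λ a → cong (U i a *_) (U-sym a i)))

  minor² : Fin n → Fin n → Fin n → Fin n → ℤ
  minor² i j a b = (U i a * U j b - U i b * U j a) * (U i a * U j b - U i b * U j a)

  gram : ∀ i j → ∑ (λ a → U i a * U j a) ≡ δ * U i j
  gram i j = trans (∑-cong λ a → cong (U i a *_) (U-sym j a)) (U² i j)

  -- Lagrange's identity for two rows, whose inner product is δ * U i j because U² = δ U.
  lagrange-rows : ∀ i j → ∑ (λ a → ∑ (λ b → minor² i j a b)) ≡
    + 2 * (∑ (λ a → U i a * U i a) * ∑ (λ b → U j b * U j b)) + - + 2 * (δ * δ) * (U i j * U i j)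
  lagrange-rows i j = begin
    ∑ (λ a → ∑ (λ b → minor² i j a b))
      ≡⟨ ∑-cong (λ a → trans (∑-cong (λ b → expand (U i a) (U j b) (U i b) (U j a)))
           (trans (∑-distrib-+ _ _) (cong₂ _+_ (∑-distrib-+ _ _) (sym (*-distribˡ-∑ (- + 2) _))))) ⟩
    ∑ (λ a → (∑ (λ b → U i a * U i a * (U j b * U j b)) + ∑ (λ b → U j a * U j a * (U i b * U i b)))
             + - + 2 * ∑ (λ b → U i a * U j a * (U i b * U j b)))
      ≡⟨ trans (∑-distrib-+ _ _) (cong₂ _+_ (∑-distrib-+ _ _) (sym (*-distribˡ-∑ (- + 2) _))) ⟩
    (∑ (λ a → ∑ (λ b → U i a * U i a * (U j b * U j b))) + ∑ (λ a → ∑ (λ b → U j a * U j a * (U i b * U i b))))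
      + - + 2 * ∑ (λ a → ∑ (λ b → U i a * U j a * (U i b * U j b)))
      ≡⟨ cong₂ _+_ (cong₂ _+_ (∑-product _ _) (∑-product _ _)) (cong (- + 2 *_) (trans (∑-product _ _) (cong₂ _*_ (gram i j) (gram i j)))) ⟩
    (rᵢ * rⱼ + rⱼ * rᵢ) + - + 2 * (δ * U i j * (δ * U i j))
      ≡⟨ collect rᵢ rⱼ δ (U i j) ⟩
    + 2 * (rᵢ * rⱼ) + - + 2 * (δ * δ) * (U i j * U i j) ∎
    where
    rᵢ rⱼ : ℤ
    rᵢ = ∑ (λ a → U i a * U i a)
    rⱼ = ∑ (λ a → U j a * U j a)
    expand : ∀ x y z w → (x * y - z * w) * (x * y - z * w) ≡ (x * x * (y * y) + w * w * (z * z)) + - + 2 * (x * w * (z * y))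
    expand = solve-∀
    collect : ∀ r r′ δ u → (r * r′ + r′ * r) + - + 2 * (δ * u * (δ * u)) ≡ + 2 * (r * r′) + - + 2 * (δ * δ) * (u * u)
    collect = solve-∀

  minors : ℤ
  minors = ∑ (λ i → ∑ (λ j → ∑ (λ a → ∑ (λ b → minor² i j a b))))

  -- Both the squared row norms and the squares of the entries add up to y. In terms of the rank r,
  -- the right side is 2 δ⁴ r (r - 1).
  lagrange : minors ≡ + 2 * (y * (y - δ * δ))
  lagrange = begin
    ∑ (λ i → ∑ (λ j → ∑ (λ a → ∑ (λ b → minor² i j a b))))
      ≡⟨ ∑-cong (λ i → trans (∑-cong (λ j → lagrange-rows i j)) (trans (∑-linear (+ 2) _ _)
           (cong (_+_ (+ 2 * ∑ (λ j → r i * r j))) (sym (*-distribˡ-∑ (- + 2 * (δ * δ)) _))))) ⟩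
    ∑ (λ i → + 2 * ∑ (λ j → r i * r j) + - + 2 * (δ * δ) * r i)
      ≡⟨ trans (∑-linear (+ 2) _ _) (cong₂ (λ u v → + 2 * u + v) (∑-product r r) (sym (*-distribˡ-∑ (- + 2 * (δ * δ)) r))) ⟩
    + 2 * (∑ r * ∑ r) + - + 2 * (δ * δ) * ∑ r
      ≡⟨ cong (λ z → + 2 * (z * z) + - + 2 * (δ * δ) * z) (sym y≡∑²) ⟩
    + 2 * (y * y) + - + 2 * (δ * δ) * y
      ≡⟨ collect y δ ⟩
    + 2 * (y * (y - δ * δ)) ∎
    where
    r : Fin n → ℤ
    r i = ∑ (λ a → U i a * U i a)
    collect : ∀ y δ → + 2 * (y * y) + - + 2 * (δ * δ) * y ≡ + 2 * (y * (y - δ * δ))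
    collect = solve-∀

  minor²-nonneg : ∀ i j a b → 0ℤ ℤ.≤ minor² i j a b
  minor²-nonneg i j a b = square-nonneg (U i a * U j b - U i b * U j a)

  minors-nonneg : 0ℤ ℤ.≤ minors
  minors-nonneg = ∑-nonneg _ λ i → ∑-nonneg _ λ j → ∑-nonneg _ λ a → ∑-nonneg _ λ b → minor²-nonneg i j a b

  rank-one : y ≡ δ * δ → ∀ i j a b → U i a * U j b ≡ U i b * U j a
  rank-one y≡δ² i j a b = ℤₚ.i-j≡0⇒i≡j _ _ (square≡0 _
    (∑-nonneg≡0 _ (λ b → minor²-nonneg i j a b)
    (∑-nonneg≡0 _ (λ a → ∑-nonneg _ λ b → minor²-nonneg i j a b)
    (∑-nonneg≡0 _ (λ j → ∑-nonneg _ λ a → ∑-nonneg _ λ b → minor²-nonneg i j a b)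
    (∑-nonneg≡0 _ (λ i → ∑-nonneg _ λ j → ∑-nonneg _ λ a → ∑-nonneg _ λ b → minor²-nonneg i j a b)
      (trans lagrange (trans (cong (λ z → + 2 * (y * (z - δ * δ))) y≡δ²) (vanish y (δ * δ)))) i) j) a) b))
    where
    vanish : ∀ y d → + 2 * (y * (d - d)) ≡ 0ℤ
    vanish = solve-∀

  module _ {i j} (Uᵢⱼ≢0 : U i j ≢ 0ℤ) where

    y-positive : 0ℤ ℤ.< y
    y-positive = ℤₚ.≤∧≢⇒< (subst (0ℤ ℤ.≤_) (sym y≡∑²) (∑-nonneg _ λ i → ∑-nonneg _ λ a → square-nonneg (U i a)))
      λ 0≡y → Uᵢⱼ≢0 (square≡0 (U i j) (∑-nonneg≡0 _ (λ a → square-nonneg (U i a))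
        (∑-nonneg≡0 _ (λ i → ∑-nonneg _ λ a → square-nonneg (U i a)) (trans (sym y≡∑²) (sym 0≡y)) i) j))

    y-bound : δ * δ ℤ.≤ y
    y-bound with δ * δ ℤ.≤? y
    ... | yes δ²≤y = δ²≤y
    ... | no  δ²≰y = ⊥-elim (ℤₚ.<⇒≱ negative (subst (0ℤ ℤ.≤_) lagrange minors-nonneg))
      where
      y-δ²<0 : y - δ * δ ℤ.< 0ℤ
      y-δ²<0 = subst (y - δ * δ ℤ.<_) (ℤₚ.+-inverseʳ (δ * δ)) (ℤₚ.+-monoˡ-< (- (δ * δ)) (ℤₚ.≰⇒> δ²≰y))
      negative : + 2 * (y * (y - δ * δ)) ℤ.< 0ℤ
      negative = ℤₚ.*-monoˡ-<-pos (+ 2) (subst (y * (y - δ * δ) ℤ.<_) (ℤₚ.*-zeroʳ y)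
        (ℤₚ.*-monoˡ-<-pos y {{ℤ.positive y-positive}} y-δ²<0))

module Blocks {n} (S : Fin n → Bool) where

  indicator : Bool → Fin n → ℤ
  indicator β i = if does (S i Bool.≟ β) then 1ℤ else 0ℤ

  indicator-in : ∀ {β i} → S i ≡ β → indicator β i ≡ 1ℤ
  indicator-in {β} {i} Sᵢ≡β with S i Bool.≟ β
  ... | yes _   = refl
  ... | no Sᵢ≢β = contradiction Sᵢ≡β Sᵢ≢β

  indicator-idem : ∀ β i → indicator β i * indicator β i ≡ indicator β i
  indicator-idem β i with does (S i Bool.≟ β)
  ... | true  = refl
  ... | false = refl

  indicator-sum : ∀ i → indicator true i + indicator false i ≡ 1ℤ
  indicator-sum i with S i
  ... | true  = refl
  ... | false = refl

  BlockDiagonal : Matrix n → Set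
  BlockDiagonal Z = ∀ i j → S i ≢ S j → Z i j ≡ 0ℤ

  module _ (Z : Matrix n) (δ : ℤ) (Z-sym : Symmetric Z) (Z-block : BlockDiagonal Z)
    (Z² : ∀ i j → (Z ⊗ Z) i j ≡ δ * Z i j) where

    -- Only rows are masked, but for a block diagonal matrix this masks the same columns (`move`);
    -- hence the result is symmetric and still squares to δ times itself.
    restrict : Bool → Matrix n
    restrict β i j = indicator β i * Z i j

    move : ∀ β i j → indicator β i * Z i j ≡ indicator β j * Z i j
    move β i j with S i Bool.≟ S j
    ... | yes Sᵢ≡Sⱼ rewrite Sᵢ≡Sⱼ = refl
    ... | no  Sᵢ≢Sⱼ rewrite Z-block i j Sᵢ≢Sⱼ = trans (ℤₚ.*-zeroʳ (indicator β i)) (sym (ℤₚ.*-zeroʳ (indicator β j)))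

    restrict-sym : ∀ β → Symmetric (restrict β)
    restrict-sym β i j = trans (move β i j) (cong (indicator β j *_) (Z-sym i j))

    restrict² : ∀ β i j → (restrict β ⊗ restrict β) i j ≡ δ * restrict β i j
    restrict² β i j = begin
      ∑ (λ l → indicator β i * Z i l * (indicator β l * Z l j))
        ≡⟨ ∑-cong (λ l → begin
             indicator β i * Z i l * (indicator β l * Z l j)
               ≡⟨ shuffle (indicator β i) (Z i l) (indicator β l) (Z l j) ⟩
             indicator β i * (indicator β l * Z i l * Z l j)
               ≡⟨ cong (λ z → indicator β i * (z * Z l j)) (sym (move β i l)) ⟩
             indicator β i * (indicator β i * Z i l * Z l j)
               ≡⟨ shuffle′ (indicator β i) (Z i l) (Z l j) ⟩
             indicator β i * indicator β i * (Z i l * Z l j)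
               ≡⟨ cong (_* (Z i l * Z l j)) (indicator-idem β i) ⟩
             indicator β i * (Z i l * Z l j) ∎) ⟩
      ∑ (λ l → indicator β i * (Z i l * Z l j))
        ≡⟨ sym (*-distribˡ-∑ (indicator β i) _) ⟩
      indicator β i * (Z ⊗ Z) i j
        ≡⟨ cong (indicator β i *_) (Z² i j) ⟩
      indicator β i * (δ * Z i j)
        ≡⟨ swap (indicator β i) δ (Z i j) ⟩
      δ * restrict β i j ∎
      where
      shuffle : ∀ p z q w → p * z * (q * w) ≡ p * (q * z * w)
      shuffle = solve-∀
      shuffle′ : ∀ p z w → p * (p * z * w) ≡ p * p * (z * w)
      shuffle′ = solve-∀
      swap : ∀ p d z → p * (d * z) ≡ d * (p * z)
      swap = solve-∀

    module Part β = ScaledProjection (restrict β) δ (restrict-sym β) (restrict² β)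

    parts-sum : Part.y true + Part.y false ≡ δ * trace Z
    parts-sum = begin
      δ * trace (restrict true) + δ * trace (restrict false)
        ≡⟨ ℤₚ.*-distribˡ-+ δ (trace (restrict true)) (trace (restrict false)) ⟨
      δ * (trace (restrict true) + trace (restrict false))
        ≡⟨ cong (δ *_) (sym (∑-distrib-+ _ _)) ⟩
      δ * ∑ (λ i → indicator true i * Z i i + indicator false i * Z i i)
        ≡⟨ cong (δ *_) (∑-cong λ i → trans (sym (ℤₚ.*-distribʳ-+ (Z i i) (indicator true i) (indicator false i)))
             (trans (cong (_* Z i i) (indicator-sum i)) (ℤₚ.*-identityˡ (Z i i)))) ⟩
      δ * trace Z ∎

    restrict-≢0 : ∀ {β i j} → S i ≡ β → Z i j ≢ 0ℤ → restrict β i j ≢ 0ℤ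
    restrict-≢0 {β} {i} {j} Sᵢ≡β Z≢0 eq =
      Z≢0 (trans (sym (trans (cong (_* Z i j) (indicator-in Sᵢ≡β)) (ℤₚ.*-identityˡ (Z i j)))) eq)

  module RankOne (N : Matrix n) (σ δ : ℤ) (N-sym : Symmetric N) (N-block : BlockDiagonal N)
    (N³ : ∀ i j → (N ⊗ (N ⊗ N)) i j ≡ σ * (N ⊗ N) i j + - δ * N i j)
    (tr-N : trace N ≡ σ) (tr-N² : trace (N ⊗ N) ≡ σ * σ - + 2 * δ)
    (N≢0 : ∀ β → ∃₂ λ i w → S i ≡ β × N i w ≢ 0ℤ) where

    Z : Matrix n
    Z i j = σ * N i j + -1ℤ * (N ⊗ N) i j

    N²-sym : Symmetric (N ⊗ N)
    N²-sym i j = ∑-cong λ l → trans (ℤₚ.*-comm (N i l) (N l j)) (cong₂ _*_ (N-sym l j) (N-sym i l))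

    N²-block : BlockDiagonal (N ⊗ N)
    N²-block i j Sᵢ≢Sⱼ = ∑-zero λ l → across l
      where
      across : ∀ l → N i l * N l j ≡ 0ℤ
      across l with S i Bool.≟ S l
      ... | yes Sᵢ≡Sₗ = trans (cong (N i l *_) (N-block l j (Sᵢ≢Sⱼ ∘ trans Sᵢ≡Sₗ))) (ℤₚ.*-zeroʳ (N i l))
      ... | no  Sᵢ≢Sₗ = cong (_* N l j) (N-block i l Sᵢ≢Sₗ)

    Z-sym : Symmetric Z
    Z-sym i j = cong₂ (λ x y → σ * x + -1ℤ * y) (N-sym i j) (N²-sym i j)

    Z-block : BlockDiagonal Z
    Z-block i j Sᵢ≢Sⱼ = trans (cong₂ (λ x y → σ * x + -1ℤ * y) (N-block i j Sᵢ≢Sⱼ) (N²-block i j Sᵢ≢Sⱼ))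
      (trans (ℤₚ.+-identityʳ _) (ℤₚ.*-zeroʳ σ))

    ZN : ∀ i j → (Z ⊗ N) i j ≡ δ * N i j
    ZN i j = begin
      (Z ⊗ N) i j
        ≡⟨ ⊗-linearˡ N Z N (N ⊗ N) σ -1ℤ (λ _ _ → refl) i j ⟩
      σ * (N ⊗ N) i j + -1ℤ * ((N ⊗ N) ⊗ N) i j
        ≡⟨ cong (λ z → σ * (N ⊗ N) i j + -1ℤ * z) (trans (⊗-assoc N N N i j) (N³ i j)) ⟩
      σ * (N ⊗ N) i j + -1ℤ * (σ * (N ⊗ N) i j + - δ * N i j)
        ≡⟨ cancel σ ((N ⊗ N) i j) δ (N i j) ⟩
      δ * N i j ∎
      where
      cancel : ∀ σ x δ y → σ * x + -1ℤ * (σ * x + - δ * y) ≡ δ * y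
      cancel = solve-∀

    Z² : ∀ i j → (Z ⊗ Z) i j ≡ δ * Z i j
    Z² i j = begin
      (Z ⊗ Z) i j
        ≡⟨ ⊗-linearʳ Z Z N (N ⊗ N) σ -1ℤ (λ _ _ → refl) i j ⟩
      σ * (Z ⊗ N) i j + -1ℤ * (Z ⊗ (N ⊗ N)) i j
        ≡⟨ cong₂ (λ x y → σ * x + -1ℤ * y) (ZN i j) (trans (sym (⊗-assoc Z N N i j))
             (trans (∑-cong λ l → trans (cong (_* N l j) (ZN i l)) (ℤₚ.*-assoc δ (N i l) (N l j))) (sym (*-distribˡ-∑ δ _)))) ⟩
      σ * (δ * N i j) + -1ℤ * (δ * (N ⊗ N) i j)
        ≡⟨ factor σ δ (N i j) ((N ⊗ N) i j) ⟩
      δ * Z i j ∎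
      where
      factor : ∀ σ δ x y → σ * (δ * x) + -1ℤ * (δ * y) ≡ δ * (σ * x + -1ℤ * y)
      factor = solve-∀

    tr-Z : trace Z ≡ + 2 * δ
    tr-Z = begin
      ∑ (λ i → σ * N i i + -1ℤ * (N ⊗ N) i i)
        ≡⟨ ∑-linear σ _ _ ⟩
      σ * trace N + ∑ (λ i → -1ℤ * (N ⊗ N) i i)
        ≡⟨ cong₂ (λ x y → σ * x + y) tr-N (trans (sym (*-distribˡ-∑ -1ℤ _)) (cong (-1ℤ *_) tr-N²)) ⟩
      σ * σ + -1ℤ * (σ * σ - + 2 * δ)
        ≡⟨ cancel (σ * σ) δ ⟩
      + 2 * δ ∎
      where
      cancel : ∀ x δ → x + -1ℤ * (x - + 2 * δ) ≡ + 2 * δ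
      cancel = solve-∀

    module Zβ = Part Z δ Z-sym Z-block Z²

    -- Otherwise Z² = 0, so Z = 0 and N² = σ N. The values `y` of the two parts of N then add up to
    -- σ tr N = σ²; the part `true` takes at least all of it, while the part `false` needs a
    -- positive share.
    δ≢0 : δ ≢ 0ℤ
    δ≢0 δ≡0 = ℤₚ.<⇒≱ (Nβ.y-positive false (nonzero false)) (ℤₚ.≤-trans
      (ℤₚ.≤-reflexive (begin
        Nβ.y false                           ≡⟨ isolate (Nβ.y true) (Nβ.y false) ⟩
        (Nβ.y true + Nβ.y false) - Nβ.y true ≡⟨ cong (_- Nβ.y true) (trans (parts-sum N σ N-sym N-block N²) (cong (σ *_) tr-N)) ⟩
        σ * σ - Nβ.y true                    ∎))
      (ℤₚ.≤-trans (ℤₚ.+-monoʳ-≤ (σ * σ) (ℤₚ.neg-mono-≤ (Nβ.y-bound true (nonzero true))))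
        (ℤₚ.≤-reflexive (ℤₚ.+-inverseʳ (σ * σ)))))
      where
      isolate : ∀ x y → y ≡ (x + y) - x
      isolate = solve-∀
      Z≡0 : ∀ i j → Z i j ≡ 0ℤ
      Z≡0 i j = square≡0 (Z i j) (∑-nonneg≡0 (λ j → Z i j * Z i j) (λ j → square-nonneg (Z i j))
        (trans (∑-cong λ l → cong (Z i l *_) (Z-sym i l)) (trans (Z² i i) (cong (_* Z i i) δ≡0))) j)
      N² : ∀ i j → (N ⊗ N) i j ≡ σ * N i j
      N² i j = trans (rearrange (σ * N i j) ((N ⊗ N) i j)) (trans (cong (_-_ (σ * N i j)) (Z≡0 i j)) (ℤₚ.+-identityʳ _))
        where
        rearrange : ∀ x y → y ≡ x - (x + -1ℤ * y)
        rearrange = solve-∀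
      module Nβ = Part N σ N-sym N-block N²
      nonzero : ∀ β → restrict N σ N-sym N-block N² β (proj₁ (N≢0 β)) (proj₁ (proj₂ (N≢0 β))) ≢ 0ℤ
      nonzero β = restrict-≢0 N σ N-sym N-block N² (proj₁ (proj₂ (proj₂ (N≢0 β)))) (proj₂ (proj₂ (proj₂ (N≢0 β))))

    -- Since Z N = δ N, a zero row of Z would make the same row of N vanish.
    Z≢0 : ∀ β → ∃₂ λ i j → restrict Z δ Z-sym Z-block Z² β i j ≢ 0ℤ
    Z≢0 β = from-N (N≢0 β)
      where
      from-N : (∃₂ λ i w → S i ≡ β × N i w ≢ 0ℤ) → ∃₂ λ i j → restrict Z δ Z-sym Z-block Z² β i j ≢ 0ℤ
      from-N (i , w , Sᵢ≡β , Nᵢw≢0) = i , proj₁ Zᵢₗ≢0 , restrict-≢0 Z δ Z-sym Z-block Z² Sᵢ≡β (proj₂ Zᵢₗ≢0)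
        where
        Zᵢₗ≢0 : ∃ λ l → Z i l ≢ 0ℤ
        Zᵢₗ≢0 = Finₚ.¬∀⟶∃¬ n (λ l → Z i l ≡ 0ℤ) (λ l → Z i l ℤ.≟ 0ℤ) λ Z≡0 →
          [ δ≢0 , Nᵢw≢0 ]′ (ℤₚ.i*j≡0⇒i≡0∨j≡0 δ (trans (sym (ZN i w)) (∑-zero λ l → cong (_* N l w) (Z≡0 l))))

    y-bound : ∀ β → δ * δ ℤ.≤ Zβ.y β
    y-bound β = Zβ.y-bound β (proj₂ (proj₂ (Z≢0 β)))

    -- The total δ tr Z = 2 δ² leaves no room above the two lower bounds δ².
    y≡δ² : ∀ β → Zβ.y β ≡ δ * δ
    y≡δ² = λ { true → tight (Zβ.y true) (Zβ.y false) sum≡ (y-bound true) (y-bound false)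
             ; false → tight (Zβ.y false) (Zβ.y true) (trans (ℤₚ.+-comm (Zβ.y false) (Zβ.y true)) sum≡) (y-bound false) (y-bound true) }
      where
      sum≡ : Zβ.y true + Zβ.y false ≡ δ * δ + δ * δ
      sum≡ = trans (parts-sum Z δ Z-sym Z-block Z²) (trans (cong (δ *_) tr-Z) (double δ))
        where
        double : ∀ δ → δ * (+ 2 * δ) ≡ δ * δ + δ * δ
        double = solve-∀
      tight : ∀ x y {d} → x + y ≡ d + d → d ℤ.≤ x → d ℤ.≤ y → x ≡ d
      tight x y {d} x+y≡ d≤x d≤y = ℤₚ.≤-antisym
        (subst (ℤ._≤ d) (isolate x y) (subst (λ z → z - y ℤ.≤ d) (sym x+y≡)
          (subst (d + d - y ℤ.≤_) (cancel d) (ℤₚ.+-monoʳ-≤ (d + d) (ℤₚ.neg-mono-≤ d≤y))))) d≤x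
        where
        isolate : ∀ x y → (x + y) - y ≡ x
        isolate = solve-∀
        cancel : ∀ d → d + d - d ≡ d
        cancel = solve-∀

    Z-rank-one : ∀ {i j} → S i ≡ S j → ∀ a b → Z i a * Z j b ≡ Z i b * Z j a
    Z-rank-one {i} {j} Sᵢ≡Sⱼ a b = begin
      Z i a * Z j b   ≡⟨ cong₂ _*_ (full refl a) (full (sym Sᵢ≡Sⱼ) b) ⟩
      _               ≡⟨ Zβ.rank-one (S i) (y≡δ² (S i)) i j a b ⟩
      _               ≡⟨ cong₂ _*_ (full refl b) (full (sym Sᵢ≡Sⱼ) a) ⟨
      Z i b * Z j a   ∎
      where
      full : ∀ {β k} → S k ≡ β → ∀ c → Z k c ≡ indicator β k * Z k c
      full {β} {k} S≡ c = sym (trans (cong (_* Z k c) (indicator-in S≡)) (ℤₚ.*-identityˡ (Z k c)))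

    -- Since δ N = Z N, the product δ² N i a N j b is a double sum over k and l containing Z i k Z j
    -- l; the vanishing minors of Z allow k and l to be exchanged there, which exchanges a and b.
    -- Finally δ² is cancelled.
    N-rank-one : ∀ {i j} → S i ≡ S j → ∀ a b → N i a * N j b ≡ N i b * N j a
    N-rank-one {i} {j} Sᵢ≡Sⱼ a b = cancel-δ (begin
      δ * N i a * (δ * N j b)
        ≡⟨ cong₂ _*_ (ZN i a) (ZN j b) ⟨
      (Z ⊗ N) i a * (Z ⊗ N) j b
        ≡⟨ ∑-product _ _ ⟨
      ∑ (λ k → ∑ (λ l → Z i k * N k a * (Z j l * N l b)))
        ≡⟨ ∑-cong (λ k → ∑-cong λ l → trans (shuffle (Z i k) (N k a) (Z j l) (N l b))
             (trans (cong (_* (N k a * N l b)) (Z-rank-one Sᵢ≡Sⱼ k l)) (shuffle′ (Z i l) (Z j k) (N k a) (N l b)))) ⟩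
      ∑ (λ k → ∑ (λ l → Z i l * N l b * (Z j k * N k a)))
        ≡⟨ ∑-swap _ ⟩
      ∑ (λ l → ∑ (λ k → Z i l * N l b * (Z j k * N k a)))
        ≡⟨ ∑-product _ _ ⟩
      (Z ⊗ N) i b * (Z ⊗ N) j a
        ≡⟨ cong₂ _*_ (ZN i b) (ZN j a) ⟩
      δ * N i b * (δ * N j a) ∎)
      where
      shuffle : ∀ z n z′ n′ → z * n * (z′ * n′) ≡ z * z′ * (n * n′)
      shuffle = solve-∀
      shuffle′ : ∀ z z′ n n′ → z * z′ * (n * n′) ≡ z * n′ * (z′ * n)
      shuffle′ = solve-∀
      cancel-δ : ∀ {x x′ y y′} → δ * x * (δ * x′) ≡ δ * y * (δ * y′) → x * x′ ≡ y * y′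
      cancel-δ {x} {x′} {y} {y′} eq = cancel (cancel (trans (regroup δ x x′) (trans eq (sym (regroup δ y y′)))))
        where
        regroup : ∀ δ x x′ → δ * (δ * (x * x′)) ≡ δ * x * (δ * x′)
        regroup = solve-∀
        cancel : ∀ {u v} → δ * u ≡ δ * v → u ≡ v
        cancel {u} {v} = ℤₚ.*-cancelˡ-≡ δ u v {{ℤ.≢-nonZero δ≢0}}

-- Signed graphs whose A² − I has rank one

unit-same : ∀ {n} (i : Fin n) → unit i i ≡ 1ℤ
unit-same zero    = refl
unit-same (suc i) = unit-same i

unit-other : ∀ {n} {i j : Fin n} → i ≢ j → unit i j ≡ 0ℤ
unit-other {i = i} {j} i≢j with i Fin.≟ j
... | yes i≡j = contradiction i≡j i≢j
... | no  _   = refl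

∑-single : ∀ {n} (f : Fin n → ℤ) k → (∀ l → l ≢ k → f l ≡ 0ℤ) → ∑ f ≡ f k
∑-single f k others = trans (∑-cong λ l → only l (l Fin.≟ k)) (∑-unit f k)
  where
  only : ∀ l → _ → f l ≡ f l * unit l k
  only l (yes refl) = sym (trans (cong (f l *_) (unit-same l)) (ℤₚ.*-identityʳ (f l)))
  only l (no  l≢k)  = trans (others l l≢k) (sym (cong (_* unit l k) (others l l≢k)))

∑-units : ∀ {n} (k : Fin n) → ∑ (λ l → unit l k) ≡ 1ℤ
∑-units k = trans (∑-single (λ l → unit l k) k (λ l → unit-other)) (unit-same k)

∑-mono : ∀ {n} (f g : Fin n → ℤ) → (∀ i → f i ℤ.≤ g i) → ∑ f ℤ.≤ ∑ g
∑-mono {zero}  f g f≤g = ℤₚ.≤-reflexive (trans (∑-nil f) (sym (∑-nil g)))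
∑-mono {suc n} f g f≤g = ℤₚ.≤-trans (ℤₚ.≤-reflexive (∑-suc f))
  (ℤₚ.≤-trans (ℤₚ.+-mono-≤ (f≤g zero) (∑-mono (f ∘ suc) (g ∘ suc) (f≤g ∘ suc))) (ℤₚ.≤-reflexive (sym (∑-suc g))))

-- Adding `unit l p` to `f` keeps it below `g` and raises its sum by one.
∑-mono-gap : ∀ {n} (f g : Fin n → ℤ) p → (∀ i → f i ℤ.≤ g i) → f p + 1ℤ ℤ.≤ g p → ∑ f + 1ℤ ℤ.≤ ∑ g
∑-mono-gap f g p f≤g gap = subst (ℤ._≤ ∑ g) (trans (∑-distrib-+ f (λ l → unit l p)) (cong (_+_ (∑ f)) (∑-units p)))
  (∑-mono (λ l → f l + unit l p) g λ l → pointwise l (l Fin.≟ p))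
  where
  pointwise : ∀ l → _ → f l + unit l p ℤ.≤ g l
  pointwise l (yes refl) = subst (λ e → f l + e ℤ.≤ g l) (sym (unit-same l)) gap
  pointwise l (no  l≢p)  = subst (ℤ._≤ g l) (sym (trans (cong (_+_ (f l)) (unit-other l≢p)) (ℤₚ.+-identityʳ (f l)))) (f≤g l)

∑-mono-gap₂ : ∀ {n} (f g : Fin n → ℤ) p q → p ≢ q → (∀ i → f i ℤ.≤ g i) →
              f p + 1ℤ ℤ.≤ g p → f q + 1ℤ ℤ.≤ g q → ∑ f + 1ℤ + 1ℤ ℤ.≤ ∑ g
∑-mono-gap₂ f g p q p≢q f≤g gap-p gap-q = subst (λ e → e + 1ℤ ℤ.≤ ∑ g)
  (trans (∑-distrib-+ f (λ l → unit l p)) (cong (_+_ (∑ f)) (∑-units p)))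
  (∑-mono-gap (λ l → f l + unit l p) g q (λ l → pointwise l (l Fin.≟ p))
    (subst (λ e → e + 1ℤ ℤ.≤ g q) (sym (trans (cong (_+_ (f q)) (unit-other (p≢q ∘ sym))) (ℤₚ.+-identityʳ (f q)))) gap-q))
  where
  pointwise : ∀ l → _ → f l + unit l p ℤ.≤ g l
  pointwise l (yes refl) = subst (λ e → f l + e ℤ.≤ g l) (sym (unit-same l)) gap-p
  pointwise l (no  l≢p)  = subst (ℤ._≤ g l) (sym (trans (cong (_+_ (f l)) (unit-other l≢p)) (ℤₚ.+-identityʳ (f l)))) (f≤g l)

+1-cancel-≤ : ∀ x y → x + 1ℤ ℤ.≤ y + 1ℤ → x ℤ.≤ y
+1-cancel-≤ x y x+1≤y+1 = subst₂ ℤ._≤_ (cancel x) (cancel y) (ℤₚ.+-monoˡ-≤ -1ℤ x+1≤y+1)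
  where
  cancel : ∀ x → x + 1ℤ + -1ℤ ≡ x
  cancel = solve-∀

Entry : ℤ → Set
Entry x = x ≡ 0ℤ ⊎ x ≡ 1ℤ ⊎ x ≡ -1ℤ

entry-square : ∀ {x} → Entry x → x ≢ 0ℤ → x * x ≡ 1ℤ
entry-square (inj₁ x≡0)         x≢0 = contradiction x≡0 x≢0
entry-square (inj₂ (inj₁ refl)) x≢0 = refl
entry-square (inj₂ (inj₂ refl)) x≢0 = refl

entry-product : ∀ {x y} → Entry x → Entry y → x ≢ 0ℤ → y ≢ 0ℤ → x * y ≡ 1ℤ ⊎ x * y ≡ -1ℤ
entry-product (inj₁ x≡0)         _                  x≢0 y≢0 = contradiction x≡0 x≢0
entry-product (inj₂ _)           (inj₁ y≡0)         x≢0 y≢0 = contradiction y≡0 y≢0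
entry-product (inj₂ (inj₁ refl)) (inj₂ (inj₁ refl)) x≢0 y≢0 = inj₁ refl
entry-product (inj₂ (inj₁ refl)) (inj₂ (inj₂ refl)) x≢0 y≢0 = inj₂ refl
entry-product (inj₂ (inj₂ refl)) (inj₂ (inj₁ refl)) x≢0 y≢0 = inj₂ refl
entry-product (inj₂ (inj₂ refl)) (inj₂ (inj₂ refl)) x≢0 y≢0 = inj₁ refl

±1-bound : ∀ e → Entry e → ∀ {x y} → Entry x → Entry y → e * (x * y) ℤ.≤ y * y
±1-bound e e-entry {x} x-entry (inj₁ refl) = ℤₚ.≤-reflexive (vanish e x)
  where
  vanish : ∀ e x → e * (x * 0ℤ) ≡ 0ℤ * 0ℤ
  vanish = solve-∀
±1-bound e (inj₁ refl) {x} {y} x-entry (inj₂ _) = square-nonneg y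
±1-bound e (inj₂ e-unit) {x} (inj₁ refl) (inj₂ (inj₁ refl)) = subst (ℤ._≤ 1ℤ) (sym (ℤₚ.*-zeroʳ e)) (ℤ.+≤+ z≤n)
±1-bound e (inj₂ e-unit) {x} (inj₁ refl) (inj₂ (inj₂ refl)) = subst (ℤ._≤ 1ℤ) (sym (ℤₚ.*-zeroʳ e)) (ℤ.+≤+ z≤n)
±1-bound e (inj₂ (inj₁ refl)) (inj₂ (inj₁ refl)) (inj₂ (inj₁ refl)) = toWitness {a? = 1ℤ ℤ.≤? 1ℤ} tt
±1-bound e (inj₂ (inj₁ refl)) (inj₂ (inj₁ refl)) (inj₂ (inj₂ refl)) = toWitness {a? = -1ℤ ℤ.≤? 1ℤ} tt
±1-bound e (inj₂ (inj₁ refl)) (inj₂ (inj₂ refl)) (inj₂ (inj₁ refl)) = toWitness {a? = -1ℤ ℤ.≤? 1ℤ} tt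
±1-bound e (inj₂ (inj₁ refl)) (inj₂ (inj₂ refl)) (inj₂ (inj₂ refl)) = toWitness {a? = 1ℤ ℤ.≤? 1ℤ} tt
±1-bound e (inj₂ (inj₂ refl)) (inj₂ (inj₁ refl)) (inj₂ (inj₁ refl)) = toWitness {a? = -1ℤ ℤ.≤? 1ℤ} tt
±1-bound e (inj₂ (inj₂ refl)) (inj₂ (inj₁ refl)) (inj₂ (inj₂ refl)) = toWitness {a? = 1ℤ ℤ.≤? 1ℤ} tt
±1-bound e (inj₂ (inj₂ refl)) (inj₂ (inj₂ refl)) (inj₂ (inj₁ refl)) = toWitness {a? = 1ℤ ℤ.≤? 1ℤ} tt
±1-bound e (inj₂ (inj₂ refl)) (inj₂ (inj₂ refl)) (inj₂ (inj₂ refl)) = toWitness {a? = -1ℤ ℤ.≤? 1ℤ} tt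

-- With e the sign of x, the bounds say |x| ≤ a and |x| < b, so x² < a b. They are asked for each
-- sign separately because the slack that proves them may sit at a different vertex for each sign.
too-small : ∀ {x a b} → x * x ≡ a * b → 0ℤ ℤ.< a → (∀ e → e ≡ 1ℤ ⊎ e ≡ -1ℤ → e * x ℤ.≤ a × e * x + 1ℤ ℤ.≤ b) → ⊥
too-small {x} {a} {b} x²≡ab 0<a bound = case (ℤₚ.≤-total 0ℤ x)
  where
  refute : ∀ y → y * y ≡ a * b → 0ℤ ℤ.≤ y → y ℤ.≤ a → y + 1ℤ ℤ.≤ b → ⊥
  refute y y²≡ab 0≤y y≤a y<b = ℤₚ.<-irrefl y²≡ab (ℤₚ.≤-<-trans
    (ℤₚ.*-monoʳ-≤-nonNeg y {{ℤ.nonNegative 0≤y}} y≤a)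
    (ℤₚ.*-monoˡ-<-pos a {{ℤ.positive 0<a}} (ℤₚ.suc[i]≤j⇒i<j (subst (ℤ._≤ b) (ℤₚ.+-comm y 1ℤ) y<b))))
  case : _ → ⊥
  case (inj₁ 0≤x) = refute x x²≡ab 0≤x
    (subst (ℤ._≤ a) (ℤₚ.*-identityˡ x) (proj₁ (bound 1ℤ (inj₁ refl))))
    (subst (λ z → z + 1ℤ ℤ.≤ b) (ℤₚ.*-identityˡ x) (proj₂ (bound 1ℤ (inj₁ refl))))
  case (inj₂ x≤0) = refute (-1ℤ * x) (trans (square x) x²≡ab)
    (subst (0ℤ ℤ.≤_) (sym (ℤₚ.-1*i≡-i x)) (ℤₚ.neg-mono-≤ x≤0))
    (proj₁ (bound -1ℤ (inj₂ refl))) (proj₂ (bound -1ℤ (inj₂ refl)))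
    where
    square : ∀ x → -1ℤ * x * (-1ℤ * x) ≡ x * x
    square = solve-∀

UniformAfterSwitching : ∀ {n} → Matrix n → (Fin n → Bool) → Fin n → Set
UniformAfterSwitching A S o = ∃₂ λ ε X → (ε ≡ 1ℤ ⊎ ε ≡ -1ℤ) ×
  (∀ {i j} → S i ≡ S o → S j ≡ S o → i ≢ j → switch X A i j ≡ ε)

module SignedGraph {n} (A : Matrix n) (isSignedGraph : IsSignedGraph A) where
  open IsSignedGraph isSignedGraph

  N : Matrix n
  N i j = (A ⊗ A) i j - unit i j

  N-sym : Symmetric N
  N-sym i j = cong₂ _-_ (∑-cong λ l → trans (ℤₚ.*-comm (A i l) (A l j)) (cong₂ _*_ (symmetric l j) (symmetric i l))) (unit-sym i j)

  N-diagonal : ∀ i → N i i ≡ ∑ (λ l → A i l * A i l) - 1ℤ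
  N-diagonal i = cong₂ _-_ (∑-cong λ l → cong (A i l *_) (symmetric l i)) (unit-same i)

  degree≡ : ∀ i → ∑ (λ l → A i l * A i l) ≡ N i i + 1ℤ
  degree≡ i = sym (trans (cong (_+ 1ℤ) (N-diagonal i)) (cancel (∑ (λ l → A i l * A i l))))
    where
    cancel : ∀ x → x - 1ℤ + 1ℤ ≡ x
    cancel = solve-∀

  N-off-diagonal : ∀ {i j} → i ≢ j → N i j ≡ ∑ (λ l → A i l * A j l)
  N-off-diagonal {i} {j} i≢j = trans (cong₂ _-_ (∑-cong λ l → cong (A i l *_) (symmetric l j)) (unit-other i≢j)) (ℤₚ.+-identityʳ _)

  adjacent-sym : ∀ {i j} → A i j ≢ 0ℤ → A j i ≢ 0ℤ
  adjacent-sym {i} {j} Aᵢⱼ≢0 = Aᵢⱼ≢0 ∘ trans (symmetric i j)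

  adjacent-≢ : ∀ {i j} → A i j ≢ 0ℤ → i ≢ j
  adjacent-≢ {i} Aᵢⱼ≢0 refl = Aᵢⱼ≢0 (loopless i)

  -- In a zero row N i i = 0, so `i` has a single neighbour k. Then N i w is A i k * A w k for w ≠
  -- i, and its vanishing leaves k no neighbour but `i`: an isolated edge.
  N-row≢0 : ¬ HasIsolatedEdge A → ∀ i → ¬ (∀ w → N i w ≡ 0ℤ)
  N-row≢0 no-isolated i row≡0 with Finₚ.¬∀⟶∃¬ n (λ k → A i k ≡ 0ℤ) (λ k → A i k ℤ.≟ 0ℤ) has-neighbour
    where
    has-neighbour : ¬ (∀ k → A i k ≡ 0ℤ)
    has-neighbour A≡0 with trans (sym (degree≡ i)) (∑-zero λ l → cong (_* A i l) (A≡0 l))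
    ... | eq rewrite row≡0 i with eq
    ... | ()
  ... | k , Aᵢₖ≢0 = no-isolated (i , k , Aᵢₖ≢0 , only-k , only-i)
    where
    only-k : ∀ w → A i w ≢ 0ℤ → w ≡ k
    only-k w Aᵢw≢0 with w Fin.≟ k
    ... | yes w≡k = w≡k
    ... | no  w≢k with ∑-mono-gap₂ (λ _ → 0ℤ) (λ l → A i l * A i l) w k w≢k (λ l → square-nonneg (A i l))
                         (ℤₚ.≤-reflexive (sym (entry-square (entries i w) Aᵢw≢0)))
                         (ℤₚ.≤-reflexive (sym (entry-square (entries i k) Aᵢₖ≢0)))
    ... | gap rewrite degree≡ i | row≡0 i | ∑-zero {n} {λ _ → 0ℤ} (λ _ → refl) with gap
    ... | ℤ.+≤+ (s≤s ())

    only-i : ∀ w → A k w ≢ 0ℤ → w ≡ i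
    only-i w Aₖw≢0 with w Fin.≟ i
    ... | yes w≡i = w≡i
    ... | no  w≢i with ℤₚ.i*j≡0⇒i≡0∨j≡0 (A i k) product≡0
      where
      product≡0 : A i k * A w k ≡ 0ℤ
      product≡0 = begin
        A i k * A w k              ≡⟨ ∑-single (λ l → A i l * A w l) k (λ l l≢k → cong (_* A w l) (zero-off l l≢k)) ⟨
        ∑ (λ l → A i l * A w l)    ≡⟨ N-off-diagonal (w≢i ∘ sym) ⟨
        N i w                      ≡⟨ row≡0 w ⟩
        0ℤ                         ∎
        where
        zero-off : ∀ l → l ≢ k → A i l ≡ 0ℤ
        zero-off l l≢k with A i l ℤ.≟ 0ℤ
        ... | yes A≡0 = A≡0
        ... | no  A≢0 = contradiction (only-k l A≢0) l≢k
    ... | inj₁ A≡0 = contradiction A≡0 Aᵢₖ≢0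
    ... | inj₂ A≡0 = contradiction A≡0 (adjacent-sym Aₖw≢0)

  module RankOneBlocks (no-isolated : ¬ HasIsolatedEdge A) (S : Fin n → Bool)
    (A-block : ∀ i j → S i ≢ S j → A i j ≡ 0ℤ) (N-block : ∀ i j → S i ≢ S j → N i j ≡ 0ℤ)
    (rank-one : ∀ {i j} → S i ≡ S j → ∀ a b → N i a * N j b ≡ N i b * N j a) where

    N² : ∀ {i j} → S i ≡ S j → N i j * N i j ≡ N i i * N j j
    N² {i} {j} Sᵢ≡Sⱼ = trans (cong (N i j *_) (N-sym i j)) (sym (rank-one Sᵢ≡Sⱼ i j))

    Nᵢᵢ≢0 : ∀ i → N i i ≢ 0ℤ
    Nᵢᵢ≢0 i Nᵢᵢ≡0 = N-row≢0 no-isolated i row≡0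
      where
      row≡0 : ∀ w → N i w ≡ 0ℤ
      row≡0 w with S i Bool.≟ S w
      ... | yes Sᵢ≡Sw = square≡0 (N i w) (trans (N² Sᵢ≡Sw) (cong (_* N w w) Nᵢᵢ≡0))
      ... | no  Sᵢ≢Sw = N-block i w Sᵢ≢Sw

    -- As the degree minus 1, N i i can be negative only at an isolated vertex, where N i j = 0
    -- contradicts the nonzero product N i i * N j j. The second vertex j matters: in a part with a
    -- single vertex N i i is -1.
    Nᵢᵢ-positive : ∀ {i j} → S i ≡ S j → i ≢ j → 0ℤ ℤ.< N i i
    Nᵢᵢ-positive {i} {j} Sᵢ≡Sⱼ i≢j with 0ℤ ℤ.<? N i i
    ... | yes pos = pos
    ... | no ¬pos = ⊥-elim ([ Nᵢᵢ≢0 i , Nᵢᵢ≢0 j ]′ (ℤₚ.i*j≡0⇒i≡0∨j≡0 (N i i) product≡0))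
      where
      deg≤0 : ∑ (λ l → A i l * A i l) ℤ.≤ 0ℤ
      deg≤0 = subst (ℤ._≤ 0ℤ) (trans (ℤₚ.+-comm 1ℤ (N i i)) (sym (degree≡ i)))
        (ℤₚ.i<j⇒suc[i]≤j (ℤₚ.≤∧≢⇒< (ℤₚ.≮⇒≥ ¬pos) (Nᵢᵢ≢0 i)))
      row≡0 : ∀ l → A i l ≡ 0ℤ
      row≡0 l = square≡0 (A i l) (∑-nonneg≡0 (λ l → A i l * A i l) (λ l → square-nonneg (A i l))
        (ℤₚ.≤-antisym deg≤0 (∑-nonneg _ λ l → square-nonneg (A i l))) l)
      product≡0 : N i i * N j j ≡ 0ℤ
      product≡0 = trans (sym (N² Sᵢ≡Sⱼ)) (cong (λ z → z * z)
        (trans (N-off-diagonal i≢j) (∑-zero λ l → cong (_* A j l) (row≡0 l))))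

    -- Adjacent i and j satisfy N i j ² = N i i * N j j with |N i j| at most
    -- N i i and N j j, so no common-neighbour term may fall short of its maximum.
    squeeze : ∀ {i j} → A i j ≢ 0ℤ → (gap : ∀ e → e ≡ 1ℤ ⊎ e ≡ -1ℤ → ∃ λ l → l ≢ i × e * (A i l * A j l) + 1ℤ ℤ.≤ A j l * A j l) → ⊥
    squeeze {i} {j} Aᵢⱼ≢0 gap = too-small {N i j} (N² Sᵢ≡Sⱼ) (Nᵢᵢ-positive Sᵢ≡Sⱼ i≢j) λ e e≡±1 → bound-i e e≡±1 , bound-j e e≡±1
      where
      i≢j = adjacent-≢ Aᵢⱼ≢0
      Sᵢ≡Sⱼ : S i ≡ S j
      Sᵢ≡Sⱼ with S i Bool.≟ S j
      ... | yes eq = eq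
      ... | no neq = contradiction (A-block i j neq) Aᵢⱼ≢0

      e*N : ∀ e → ∑ (λ l → e * (A i l * A j l)) ≡ e * N i j
      e*N e = trans (sym (*-distribˡ-∑ e _)) (cong (e *_) (sym (N-off-diagonal i≢j)))

      bound-i : ∀ e → e ≡ 1ℤ ⊎ e ≡ -1ℤ → e * N i j ℤ.≤ N i i
      -- The slack sits at l = j, where A j j = 0 but A i j squares to 1; it offsets the -1 in N i i
      -- = degree - 1.
      bound-i e e≡±1 = +1-cancel-≤ (e * N i j) (N i i) (subst (ℤ._≤ N i i + 1ℤ) (cong (_+ 1ℤ) (e*N e))
        (subst (∑ (λ l → e * (A i l * A j l)) + 1ℤ ℤ.≤_) (degree≡ i) (∑-mono-gap (λ l → e * (A i l * A j l)) (λ l → A i l * A i l) j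
          (λ l → subst (ℤ._≤ A i l * A i l) (cong (e *_) (ℤₚ.*-comm (A j l) (A i l))) (±1-bound e (inj₂ e≡±1) (entries j l) (entries i l)))
          (ℤₚ.≤-reflexive (begin
            e * (A i j * A j j) + 1ℤ  ≡⟨ cong (λ z → e * (A i j * z) + 1ℤ) (loopless j) ⟩
            e * (A i j * 0ℤ) + 1ℤ     ≡⟨ vanish e (A i j) ⟩
            1ℤ                        ≡⟨ entry-square (entries i j) Aᵢⱼ≢0 ⟨
            A i j * A i j             ∎)))))
        where
        vanish : ∀ e x → e * (x * 0ℤ) + 1ℤ ≡ 1ℤ
        vanish = solve-∀

      bound-j : ∀ e → e ≡ 1ℤ ⊎ e ≡ -1ℤ → e * N i j + 1ℤ ℤ.≤ N j j
      -- Slack at i offsets the -1 in N j j, and slack at the witness of `gap` gives strictness;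
      -- hence the two vertices must differ.
      bound-j e e≡±1 = +1-cancel-≤ (e * N i j + 1ℤ) (N j j) (subst (λ z → z + 1ℤ + 1ℤ ℤ.≤ N j j + 1ℤ) (e*N e)
        (subst (∑ (λ l → e * (A i l * A j l)) + 1ℤ + 1ℤ ℤ.≤_) (degree≡ j) (∑-mono-gap₂ (λ l → e * (A i l * A j l)) (λ l → A j l * A j l) (proj₁ (gap e e≡±1)) i (proj₁ (proj₂ (gap e e≡±1)))
          (λ l → ±1-bound e (inj₂ e≡±1) (entries i l) (entries j l))
          (proj₂ (proj₂ (gap e e≡±1)))
          (ℤₚ.≤-reflexive (begin
            e * (A i i * A j i) + 1ℤ  ≡⟨ cong (λ z → e * (z * A j i) + 1ℤ) (loopless i) ⟩
            e * (0ℤ * A j i) + 1ℤ     ≡⟨ vanish e (A j i) ⟩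
            1ℤ                        ≡⟨ entry-square (entries j i) (adjacent-sym Aᵢⱼ≢0) ⟨
            A j i * A j i             ∎)))))
        where
        vanish : ∀ e x → e * (0ℤ * x) + 1ℤ ≡ 1ℤ
        vanish = solve-∀

    -- A neighbour l of j missing from the neighbours of i adds 0 to N i j, whatever the sign e, but
    -- 1 to the degree of j.
    closed-neighbourhood : ∀ {i j l} → A i j ≢ 0ℤ → A j l ≢ 0ℤ → l ≢ i → A i l ≢ 0ℤ
    closed-neighbourhood {i} {j} {l} Aᵢⱼ≢0 Aⱼₗ≢0 l≢i Aᵢₗ≡0 = squeeze Aᵢⱼ≢0 λ e _ → l , l≢i , ℤₚ.≤-reflexive (begin
      e * (A i l * A j l) + 1ℤ  ≡⟨ cong (λ z → e * (z * A j l) + 1ℤ) Aᵢₗ≡0 ⟩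
      e * (0ℤ * A j l) + 1ℤ     ≡⟨ vanish e (A j l) ⟩
      1ℤ                        ≡⟨ entry-square (entries j l) Aⱼₗ≢0 ⟨
      A j l * A j l             ∎)
      where
      vanish : ∀ e x → e * (0ℤ * x) + 1ℤ ≡ 1ℤ
      vanish = solve-∀

    -- For distinct vertices of a part N i j is nonzero, being a square root of N i i * N j j. So
    -- they have a common neighbour, whose closed neighbourhood is also theirs.
    block-complete : ∀ {i j} → S i ≡ S j → i ≢ j → A i j ≢ 0ℤ
    block-complete {i} {j} Sᵢ≡Sⱼ i≢j Aᵢⱼ≡0 with Finₚ.¬∀⟶∃¬ n (λ k → A i k * A j k ≡ 0ℤ) (λ k → A i k * A j k ℤ.≟ 0ℤ) common
      where
      common : ¬ (∀ k → A i k * A j k ≡ 0ℤ)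
      common all≡0 with ℤₚ.i*j≡0⇒i≡0∨j≡0 (N i i) (trans (sym (N² Sᵢ≡Sⱼ)) (cong (λ z → z * z) (trans (N-off-diagonal i≢j) (∑-zero all≡0))))
      ... | inj₁ eq = Nᵢᵢ≢0 i eq
      ... | inj₂ eq = Nᵢᵢ≢0 j eq
    ... | k , AᵢₖAⱼₖ≢0 = closed-neighbourhood
      (λ Aᵢₖ≡0 → AᵢₖAⱼₖ≢0 (cong (_* A j k) Aᵢₖ≡0))
      (λ Aₖⱼ≡0 → AᵢₖAⱼₖ≢0 (trans (cong (A i k *_) (trans (symmetric j k) Aₖⱼ≡0)) (ℤₚ.*-zeroʳ (A i k))))
      (i≢j ∘ sym) Aᵢⱼ≡0

    -- If two paths of length 2 between adjacent vertices had opposite signs, then for either sign e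
    -- one of them would contribute -1 to e * N i j instead of 1.
    path-signs-agree : ∀ {i j k l} → A i j ≢ 0ℤ → A i k ≢ 0ℤ → A j k ≢ 0ℤ → A i l ≢ 0ℤ → A j l ≢ 0ℤ →
                       A i k * A j k ≡ A i l * A j l
    path-signs-agree {i} {j} {k} {l} ij ik jk il jl
      with entry-product (entries i k) (entries j k) ik jk | entry-product (entries i l) (entries j l) il jl
    ... | inj₁ k+ | inj₁ l+ = trans k+ (sym l+)
    ... | inj₂ k- | inj₂ l- = trans k- (sym l-)
    ... | inj₁ k+ | inj₂ l- = ⊥-elim (squeeze ij λ
      { e (inj₁ refl) → l , adjacent-≢ (adjacent-sym il) , slack jl (cong (1ℤ *_) l-)
      ; e (inj₂ refl) → k , adjacent-≢ (adjacent-sym ik) , slack jk (cong (-1ℤ *_) k+) })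
      where
      slack : ∀ {m z} → A j m ≢ 0ℤ → z ≡ -1ℤ → z + 1ℤ ℤ.≤ A j m * A j m
      slack jm refl = subst (0ℤ ℤ.≤_) (sym (entry-square (entries j _) jm)) (ℤ.+≤+ z≤n)
    ... | inj₂ k- | inj₁ l+ = ⊥-elim (squeeze ij λ
      { e (inj₁ refl) → k , adjacent-≢ (adjacent-sym ik) , slack jk (cong (1ℤ *_) k-)
      ; e (inj₂ refl) → l , adjacent-≢ (adjacent-sym il) , slack jl (cong (-1ℤ *_) l+) })
      where
      slack : ∀ {m z} → A j m ≢ 0ℤ → z ≡ -1ℤ → z + 1ℤ ℤ.≤ A j m * A j m
      slack jm refl = subst (0ℤ ℤ.≤_) (sym (entry-square (entries j _) jm)) (ℤ.+≤+ z≤n)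

    module Triangles (o : Fin n) where

      Other : Fin n → Set
      Other i = S i ≡ S o × o ≢ i

      triangle : Fin n → Fin n → ℤ
      triangle i j = A o i * (A o j * A i j)

      triangle-sym : ∀ i j → triangle i j ≡ triangle j i
      triangle-sym i j = trans (cong (λ z → A o i * (A o j * z)) (symmetric i j)) (swap (A o i) (A o j) (A j i))
        where
        swap : ∀ x y z → x * (y * z) ≡ y * (x * z)
        swap = solve-∀

      edge : ∀ {i j} → Other i → Other j → i ≢ j → A i j ≢ 0ℤ
      edge (Sᵢ , _) (Sⱼ , _) = block-complete (trans Sᵢ (sym Sⱼ))

      spoke : ∀ {i} → Other i → A o i ≢ 0ℤ
      spoke (Sᵢ , o≢i) = block-complete (sym Sᵢ) o≢i

      -- The two triangles share the edge between o and i, and their other edges form two paths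
      -- joining its ends.
      triangle-rotate : ∀ {i j k} → Other i → Other j → Other k → i ≢ j → i ≢ k → triangle i j ≡ triangle i k
      triangle-rotate {i} oi oj ok i≢j i≢k = cong (A o i *_)
        (path-signs-agree (spoke oi) (spoke oj) (edge oi oj i≢j) (spoke ok) (edge oi ok i≢k))

      triangle-constant : ∀ {i j k l} → Other i → Other j → Other k → Other l → i ≢ j → k ≢ l → triangle i j ≡ triangle k l
      triangle-constant {i} {j} {k} {l} oi oj ok ol i≢j k≢l with i Fin.≟ k
      ... | yes refl = triangle-rotate oi oj ol i≢j k≢l
      ... | no  i≢k  = begin
        triangle i j  ≡⟨ triangle-rotate oi oj ok i≢j i≢k ⟩
        triangle i k  ≡⟨ triangle-sym i k ⟩
        triangle k i  ≡⟨ triangle-rotate ok oi ol (i≢k ∘ sym) k≢l ⟩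
        triangle k l  ∎

      triangle-sign : ∃ λ ε → (ε ≡ 1ℤ ⊎ ε ≡ -1ℤ) × (∀ {i j} → Other i → Other j → i ≢ j → triangle i j ≡ ε)
      triangle-sign with Finₚ.any? (λ i → Finₚ.any? (λ j → other? i ×-dec other? j ×-dec ¬? (i Fin.≟ j)))
        where
        other? = λ i → (S i Bool.≟ S o) ×-dec ¬? (o Fin.≟ i)
      ... | yes (i , j , oi , oj , i≢j) = triangle i j , sign , λ ok ol k≢l → triangle-constant ok ol oi oj k≢l i≢j
        where
        sign : triangle i j ≡ 1ℤ ⊎ triangle i j ≡ -1ℤ
        sign = entry-product (entries o i) (inj₂ (entry-product (entries o j) (entries i j) (spoke oj) (edge oi oj i≢j)))
          (spoke oi) (λ eq → path≢0 (entry-product (entries o j) (entries i j) (spoke oj) (edge oi oj i≢j)) eq)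
          where
          path≢0 : ∀ {z} → z ≡ 1ℤ ⊎ z ≡ -1ℤ → z ≢ 0ℤ
          path≢0 (inj₁ refl) ()
          path≢0 (inj₂ refl) ()
      -- With at most two vertices in the part there is no triangle at o, and the sign is chosen
      -- arbitrarily.
      ... | no none = 1ℤ , inj₁ refl , λ {i} {j} oi oj i≢j → contradiction (i , j , oi , oj , i≢j) none

    module Switched (o : Fin n) (ε : ℤ) (ε≡±1 : ε ≡ 1ℤ ⊎ ε ≡ -1ℤ)
      (triangle≡ε : ∀ {i j} → Triangles.Other o i → Triangles.Other o j → i ≢ j → Triangles.triangle o i j ≡ ε) where
      open Triangles o

      -- Switches the neighbours of o joined to it by the sign -ε, so that all edges at o become ε.
      -- An edge i j away from o then gets the sign of the triangle o i j, which is ε too. As A o o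
      -- = 0, o itself is not switched.
      X : Fin n → Bool
      X i = does (A o i ℤ.≟ - ε)

      sign : Bool → ℤ
      sign b = if b then -1ℤ else 1ℤ

      switch≡ : ∀ i j → switch X A i j ≡ sign (X i) * sign (X j) * A i j
      switch≡ i j with X i | X j
      ... | true  | true  = sym (ℤₚ.*-identityˡ (A i j))
      ... | true  | false = sym (ℤₚ.-1*i≡-i (A i j))
      ... | false | true  = sym (ℤₚ.-1*i≡-i (A i j))
      ... | false | false = sym (ℤₚ.*-identityˡ (A i j))

      sign-o : sign (X o) ≡ 1ℤ
      sign-o = trans (cong (λ a → sign (does (a ℤ.≟ - ε))) (loopless o)) (by-sign ε≡±1)
        where
        by-sign : ∀ {ε} → ε ≡ 1ℤ ⊎ ε ≡ -1ℤ → sign (does (0ℤ ℤ.≟ - ε)) ≡ 1ℤ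
        by-sign (inj₁ refl) = refl
        by-sign (inj₂ refl) = refl

      sign-other : ∀ {i} → Other i → sign (X i) ≡ ε * A o i
      sign-other {i} oi = by-sign ε≡±1 (entries o i) (spoke oi)
        where
        by-sign : ∀ {ε a} → ε ≡ 1ℤ ⊎ ε ≡ -1ℤ → Entry a → a ≢ 0ℤ → sign (does (a ℤ.≟ - ε)) ≡ ε * a
        by-sign _           (inj₁ a≡0)         a≢0 = contradiction a≡0 a≢0
        by-sign (inj₁ refl) (inj₂ (inj₁ refl)) _   = refl
        by-sign (inj₁ refl) (inj₂ (inj₂ refl)) _   = refl
        by-sign (inj₂ refl) (inj₂ (inj₁ refl)) _   = refl
        by-sign (inj₂ refl) (inj₂ (inj₂ refl)) _   = refl

      ε² : ε * ε ≡ 1ℤ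
      ε² = by-sign ε≡±1
        where
        by-sign : ∀ {ε} → ε ≡ 1ℤ ⊎ ε ≡ -1ℤ → ε * ε ≡ 1ℤ
        by-sign (inj₁ refl) = refl
        by-sign (inj₂ refl) = refl

      switched-spoke : ∀ {i} → Other i → ε * A o i * A o i ≡ ε
      switched-spoke {i} oi = trans (ℤₚ.*-assoc ε (A o i) (A o i))
        (trans (cong (ε *_) (entry-square (entries o i) (spoke oi))) (ℤₚ.*-identityʳ ε))

      switched : ∀ {i j} → S i ≡ S o → S j ≡ S o → i ≢ j → switch X A i j ≡ ε
      switched {i} {j} Sᵢ Sⱼ i≢j = trans (switch≡ i j) (by-cases (o Fin.≟ i) (o Fin.≟ j))
        where
        by-cases : _ → _ → sign (X i) * sign (X j) * A i j ≡ ε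
        by-cases (yes refl) (yes refl) = contradiction refl i≢j
        by-cases (yes refl) (no o≢j)   = begin
          sign (X o) * sign (X j) * A o j  ≡⟨ cong₂ (λ x y → x * y * A o j) sign-o (sign-other (Sⱼ , o≢j)) ⟩
          1ℤ * (ε * A o j) * A o j         ≡⟨ cong (_* A o j) (ℤₚ.*-identityˡ (ε * A o j)) ⟩
          ε * A o j * A o j                ≡⟨ switched-spoke (Sⱼ , o≢j) ⟩
          ε                                ∎
        by-cases (no o≢i)   (yes refl) = begin
          sign (X i) * sign (X o) * A i o  ≡⟨ cong₂ (λ x y → x * y * A i o) (sign-other (Sᵢ , o≢i)) sign-o ⟩
          ε * A o i * 1ℤ * A i o           ≡⟨ cong₂ _*_ (ℤₚ.*-identityʳ (ε * A o i)) (symmetric i o) ⟩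
          ε * A o i * A o i                ≡⟨ switched-spoke (Sᵢ , o≢i) ⟩
          ε                                ∎
        by-cases (no o≢i)   (no o≢j)   = begin
          sign (X i) * sign (X j) * A i j  ≡⟨ cong₂ (λ x y → x * y * A i j) (sign-other (Sᵢ , o≢i)) (sign-other (Sⱼ , o≢j)) ⟩
          ε * A o i * (ε * A o j) * A i j  ≡⟨ regroup ε (A o i) (A o j) (A i j) ⟩
          ε * ε * triangle i j             ≡⟨ cong₂ _*_ ε² (triangle≡ε (Sᵢ , o≢i) (Sⱼ , o≢j) i≢j) ⟩
          1ℤ * ε                           ≡⟨ ℤₚ.*-identityˡ ε ⟩
          ε                                ∎
          where
          regroup : ∀ e x y z → e * x * (e * y) * z ≡ e * e * (x * (y * z))
          regroup = solve-∀

    block-switching : ∀ o → UniformAfterSwitching A S o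
    block-switching o = from-sign (Triangles.triangle-sign o)
      where
      from-sign : _ → UniformAfterSwitching A S o
      from-sign (ε , ε≡±1 , triangle≡ε) = ε , X , ε≡±1 , switched
        where open Switched o ε ε≡±1 triangle≡ε

-- The cubic relation for N = A² - I and the traces of N and N²

module CubicRelation {n} (A : Matrix n) (isSignedGraph : IsSignedGraph A)
  (quad : Operators.Quadratic A (IsSignedGraph.symmetric isSignedGraph)) where
  open IsSignedGraph isSignedGraph
  open SignedGraph A isSignedGraph using (N)
  open Operators A symmetric using (mul; mul-cong; basis; traceᵏ; N-cong) renaming (N to Nop)
  open Operators.Quadratic quad

  -- With roots θ and η of q, θ² + η² = s² - 2 p; so δ = (θ² - 1) (η² - 1) = p² - (s² - 2 p) + 1.
  σ δ : ℤ
  σ = s * s - p - p - + 2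
  δ = (p + 1ℤ) * (p + 1ℤ) - s * s

  B N² : Matrix n
  B  = N ⊗ A
  N² = N ⊗ N

  mul-basis : ∀ j i → mul (basis j) i ≡ A i j
  mul-basis j i = ∑-unit (A i) j

  ⊗-unit : ∀ (X : Matrix n) i j → (X ⊗ unit) i j ≡ X i j
  ⊗-unit X i j = ∑-unit (X i) j

  unit-⊗ : ∀ (X : Matrix n) i j → (unit ⊗ X) i j ≡ X i j
  unit-⊗ X i j = trans (∑-cong λ l → trans (ℤₚ.*-comm (unit i l) (X l j)) (cong (X l j *_) (unit-sym i l)))
    (∑-unit (λ l → X l j) i)

  Nop≡ : ∀ (X : Matrix n) j i → Nop (λ l → X l j) i ≡ (N ⊗ X) i j
  Nop≡ X j i = sym (begin
    (N ⊗ X) i j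
      ≡⟨ ⊗-linearˡ X N (A ⊗ A) unit 1ℤ -1ℤ (λ i l → split ((A ⊗ A) i l) (unit i l)) i j ⟩
    1ℤ * ((A ⊗ A) ⊗ X) i j + -1ℤ * (unit ⊗ X) i j
      ≡⟨ cong₂ (λ x y → 1ℤ * x + -1ℤ * y) (⊗-assoc A A X i j) (unit-⊗ X i j) ⟩
    1ℤ * (A ⊗ (A ⊗ X)) i j + -1ℤ * X i j
      ≡⟨ split ((A ⊗ (A ⊗ X)) i j) (X i j) ⟨
    (A ⊗ (A ⊗ X)) i j - X i j ∎)
    where
    split : ∀ x y → x - y ≡ 1ℤ * x + -1ℤ * y
    split = solve-∀

  NA² : ∀ i j → (N ⊗ (A ⊗ A)) i j ≡ N² i j + N i j
  NA² i j = trans (⊗-linearʳ N (A ⊗ A) N unit 1ℤ 1ℤ (λ l j → split ((A ⊗ A) l j) (unit l j)) i j)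
    (cong₂ _+_ (ℤₚ.*-identityˡ (N² i j)) (trans (ℤₚ.*-identityˡ ((N ⊗ unit) i j)) (⊗-unit N i j)))
    where
    split : ∀ x y → x ≡ 1ℤ * (x - y) + 1ℤ * y
    split = solve-∀

  -- The relation N q(A) = 0 after substituting A² = N + I.
  N²≡ : ∀ i j → N² i j ≡ s * B i j + - (p + 1ℤ) * N i j
  N²≡ i j = solve-for (N² i j) (B i j) (N i j) s p (begin
    p * N i j + 1ℤ * (- s * B i j + 1ℤ * (N² i j + N i j))
      ≡⟨ cong₂ (λ x y → p * x + 1ℤ * (- s * B i j + 1ℤ * y)) (⊗-unit N i j) (NA² i j) ⟨
    p * (N ⊗ unit) i j + 1ℤ * (- s * (N ⊗ A) i j + 1ℤ * (N ⊗ (A ⊗ A)) i j)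
      ≡⟨ cong (λ z → p * (N ⊗ unit) i j + 1ℤ * z) (⊗-linearʳ N Q′ A (A ⊗ A) (- s) 1ℤ (λ _ _ → refl) i j) ⟨
    p * (N ⊗ unit) i j + 1ℤ * (N ⊗ Q′) i j
      ≡⟨ ⊗-linearʳ N Q unit Q′ p 1ℤ (λ _ _ → refl) i j ⟨
    (N ⊗ Q) i j
      ≡⟨ Nop≡ Q j i ⟨
    Nop (λ l → Q l j) i
      ≡⟨ N-cong (λ l → trans (cong (λ z → p * unit l j + z) (ℤₚ.*-identityˡ (Q′ l j)))
           (cong₂ (λ x y → p * unit l j + (- s * x + y)) (sym (mul-basis j l))
             (trans (ℤₚ.*-identityˡ _) (sym (mul-cong (mul-basis j) l))))) i ⟩
    Nop (λ l → p * basis j l + (- s * mul (basis j) l + mul (mul (basis j)) l)) i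
      ≡⟨ annih j i ⟩
    0ℤ ∎)
    where
    Q′ Q : Matrix n
    Q′ l j = - s * A l j + 1ℤ * (A ⊗ A) l j
    Q l j = p * unit l j + 1ℤ * Q′ l j
    solve-for : ∀ x b y s p → p * y + 1ℤ * (- s * b + 1ℤ * (x + y)) ≡ 0ℤ → x ≡ s * b + - (p + 1ℤ) * y
    solve-for x b y s p eq = trans (isolate x b y s p) (trans (cong (_+ (s * b + - (p + 1ℤ) * y)) eq) (ℤₚ.+-identityˡ _))
      where
      isolate : ∀ x b y s p → x ≡ (p * y + 1ℤ * (- s * b + 1ℤ * (x + y))) + (s * b + - (p + 1ℤ) * y)
      isolate = solve-∀

  -- N times `N²≡` brings in N B = N² A, which the same relation reduces to N², N and B. What is
  -- left of B occurs only as s * B, for which `N²≡` can be solved without dividing by s.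
  N³≡ : ∀ i j → (N ⊗ (N ⊗ N)) i j ≡ σ * (N ⊗ N) i j + - δ * N i j
  N³≡ i j = begin
    (N ⊗ N²) i j
      ≡⟨ ⊗-linearʳ N N² B N s (- (p + 1ℤ)) N²≡ i j ⟩
    s * (N ⊗ B) i j + - (p + 1ℤ) * N² i j
      ≡⟨ cong (λ z → s * z + - (p + 1ℤ) * N² i j) (trans (sym (⊗-assoc N N A i j))
           (trans (⊗-linearˡ A N² B N s (- (p + 1ℤ)) N²≡ i j)
             (cong (λ z → s * z + - (p + 1ℤ) * B i j) (trans (⊗-assoc N A A i j) (NA² i j))))) ⟩
    s * (s * (N² i j + N i j) + - (p + 1ℤ) * B i j) + - (p + 1ℤ) * N² i j
      ≡⟨ regroup s p (N² i j) (N i j) (B i j) ⟩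
    (s * s - (p + 1ℤ)) * N² i j + s * s * N i j - (p + 1ℤ) * (s * B i j)
      ≡⟨ cong (λ z → (s * s - (p + 1ℤ)) * N² i j + s * s * N i j - (p + 1ℤ) * z) sB ⟩
    (s * s - (p + 1ℤ)) * N² i j + s * s * N i j - (p + 1ℤ) * (N² i j + (p + 1ℤ) * N i j)
      ≡⟨ collect s p (N² i j) (N i j) ⟩
    σ * N² i j + - δ * N i j ∎
    where
    regroup : ∀ s p x y b → s * (s * (x + y) + - (p + 1ℤ) * b) + - (p + 1ℤ) * x ≡
                            (s * s - (p + 1ℤ)) * x + s * s * y - (p + 1ℤ) * (s * b)
    regroup = solve-∀
    collect : ∀ s p x y → (s * s - (p + 1ℤ)) * x + s * s * y - (p + 1ℤ) * (x + (p + 1ℤ) * y) ≡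
                          (s * s - p - p - + 2) * x + - ((p + 1ℤ) * (p + 1ℤ) - s * s) * y
    collect = solve-∀
    sB : s * B i j ≡ N² i j + (p + 1ℤ) * N i j
    sB = trans (isolate (s * B i j) p (N i j)) (cong (_+ (p + 1ℤ) * N i j) (sym (N²≡ i j)))
      where
      isolate : ∀ x p y → x ≡ (x + - (p + 1ℤ) * y) + (p + 1ℤ) * y
      isolate = solve-∀

  trace-difference : ∀ (f g : Fin n → ℤ) → ∑ (λ i → f i - g i) ≡ ∑ (λ i → 1ℤ * f i) - ∑ (λ i → 1ℤ * g i)
  trace-difference f g = begin
    ∑ (λ i → f i - g i)
      ≡⟨ ∑-cong (λ i → flip (f i) (g i)) ⟩
    ∑ (λ i → -1ℤ * (1ℤ * g i) + 1ℤ * f i)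
      ≡⟨ ∑-linear -1ℤ (λ i → 1ℤ * g i) (λ i → 1ℤ * f i) ⟩
    -1ℤ * ∑ (λ i → 1ℤ * g i) + ∑ (λ i → 1ℤ * f i)
      ≡⟨ flip′ (∑ (λ i → 1ℤ * f i)) (∑ (λ i → 1ℤ * g i)) ⟩
    ∑ (λ i → 1ℤ * f i) - ∑ (λ i → 1ℤ * g i) ∎
    where
    flip : ∀ x y → x - y ≡ -1ℤ * (1ℤ * y) + 1ℤ * x
    flip = solve-∀
    flip′ : ∀ x y → -1ℤ * y + x ≡ x - y
    flip′ = solve-∀

  tr-N : trace N ≡ σ
  tr-N = begin
    ∑ (λ j → (A ⊗ A) j j - unit j j)
      ≡⟨ ∑-cong (λ j → cong (_- unit j j) (mul-cong (mul-basis j) j)) ⟨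
    ∑ (λ j → mul (mul (basis j)) j - basis j j)
      ≡⟨ trace-difference (λ j → mul (mul (basis j)) j) (λ j → basis j j) ⟩
    traceᵏ 2 - traceᵏ 0
      ≡⟨ tr₂ ⟩
    σ ∎

  tr-B : trace B ≡ s * s * s - + 3 * p * s - s
  tr-B = begin
    ∑ (λ j → (N ⊗ A) j j)
      ≡⟨ ∑-cong (λ j → trans (N-cong (mul-basis j) j) (Nop≡ A j j)) ⟨
    ∑ (λ j → mul (mul (mul (basis j))) j - mul (basis j) j)
      ≡⟨ trace-difference (λ j → mul (mul (mul (basis j))) j) (λ j → mul (basis j) j) ⟩
    traceᵏ 3 - traceᵏ 1
      ≡⟨ tr₃ ⟩
    s * s * s - + 3 * p * s - s ∎

  -- The trace of `N²≡` reduces tr N² to tr B and tr N, which avoids the fourth power sum.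
  tr-N² : trace (N ⊗ N) ≡ σ * σ - + 2 * δ
  tr-N² = begin
    ∑ (λ i → N² i i)
      ≡⟨ ∑-cong (λ i → N²≡ i i) ⟩
    ∑ (λ i → s * B i i + - (p + 1ℤ) * N i i)
      ≡⟨ trans (∑-linear s _ _) (cong (_+_ (s * trace B)) (sym (*-distribˡ-∑ (- (p + 1ℤ)) _))) ⟩
    s * trace B + - (p + 1ℤ) * trace N
      ≡⟨ cong₂ (λ x y → s * x + - (p + 1ℤ) * y) tr-B tr-N ⟩
    s * (s * s * s - + 3 * p * s - s) + - (p + 1ℤ) * (s * s - p - p - + 2)
      ≡⟨ collect s p ⟩
    σ * σ - + 2 * δ ∎
    where
    collect : ∀ s p → s * (s * s * s - + 3 * p * s - s) + - (p + 1ℤ) * (s * s - p - p - + 2) ≡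
      (s * s - p - p - + 2) * (s * s - p - p - + 2) - + 2 * ((p + 1ℤ) * (p + 1ℤ) - s * s)
    collect = solve-∀

-- Connected components and the splitting of the vertices into two parts

falses : ∀ {n} → (Fin n → Bool) → ℕ
falses {zero}  S = 0
falses {suc n} S with S zero
... | true  = falses (S ∘ suc)
... | false = suc (falses (S ∘ suc))

falses-decrease : ∀ {n} (S : Fin n → Bool) j → S j ≡ false → falses (S [ j ≔ true ]) < falses S
falses-decrease S zero    Sⱼ rewrite Sⱼ = ℕₚ.≤-refl
falses-decrease S (suc j) Sⱼ with S zero
... | true  = falses-decrease (S ∘ suc) j Sⱼ
... | false = s≤s (falses-decrease (S ∘ suc) j Sⱼ)

record Component {n} (A : Matrix n) (u : Fin n) : Set where
  field
    S         : Fin n → Bool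
    root      : S u ≡ true
    reachable : ∀ i → S i ≡ true → Reachable A u i
    closed    : ∀ i j → S i ≡ true → A i j ≢ 0ℤ → S j ≡ true

-- As long as an edge leaves the set, its outer end is added. The number of vertices outside drops
-- each time, so the fuel suffices; once no edge leaves, the set is closed.
component : ∀ {n} (A : Matrix n) u → Component A u
component {n} A u = grow (suc (falses start)) start (ℕₚ.n<1+n _) (≔-same _ u true) start-reachable
  where
  start : Fin n → Bool
  start = (λ _ → false) [ u ≔ true ]

  start-reachable : ∀ i → start i ≡ true → Reachable A u i
  start-reachable i Sᵢ with u Fin.≟ i
  ... | yes refl = Star.ε
  ... | no  u≢i  = contradiction (trans (sym Sᵢ) (≔-other (λ _ → false) u i true u≢i)) λ ()

  grow : ∀ fuel S → falses S < fuel → S u ≡ true → (∀ i → S i ≡ true → Reachable A u i) → Component A u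
  grow (suc fuel) S (s≤s bound) root reachable
    with Finₚ.any? (λ i → Finₚ.any? (λ j → (S i Bool.≟ true) ×-dec (S j Bool.≟ false) ×-dec ¬? (A i j ℤ.≟ 0ℤ)))
  ... | no none = record { S = S ; root = root ; reachable = reachable ; closed = closed }
    where
    closed : ∀ i j → S i ≡ true → A i j ≢ 0ℤ → S j ≡ true
    closed i j Sᵢ Aᵢⱼ≢0 with S j in Sⱼ
    ... | true  = refl
    ... | false = contradiction (i , j , Sᵢ , Sⱼ , Aᵢⱼ≢0) none
  ... | yes (i , j , Sᵢ , Sⱼ , Aᵢⱼ≢0) = grow fuel (S [ j ≔ true ])
    (ℕₚ.<-≤-trans (falses-decrease S j Sⱼ) bound) (keep u root) reachable′
    where
    j≢ : ∀ k → S k ≡ true → j ≢ k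
    j≢ k Sₖ refl = contradiction (trans (sym Sₖ) Sⱼ) λ ()
    keep : ∀ k → S k ≡ true → (S [ j ≔ true ]) k ≡ true
    keep k Sₖ = trans (≔-other S j k true (j≢ k Sₖ)) Sₖ
    reachable′ : ∀ k → (S [ j ≔ true ]) k ≡ true → Reachable A u k
    reachable′ k Sₖ with j Fin.≟ k
    ... | yes refl = reachable i Sᵢ ◅◅ (Aᵢⱼ≢0 ◅ Star.ε)
    ... | no  j≢k  = reachable k (trans (sym (≔-other S j k true j≢k)) Sₖ)

record Partition {n} (S : Fin n → Bool) : Set where
  field
    m₁ m₂      : ℕ
    index      : Fin n → Fin m₁ ⊎ Fin m₂
    e₁         : Fin m₁ → Fin n
    e₂         : Fin m₂ → Fin n
    index-e₁   : ∀ x → index (e₁ x) ≡ inj₁ x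
    index-e₂   : ∀ x → index (e₂ x) ≡ inj₂ x
    e-index    : ∀ i → [ e₁ , e₂ ]′ (index i) ≡ i
    e₁-true    : ∀ x → S (e₁ x) ≡ true
    e₂-false   : ∀ x → S (e₂ x) ≡ false

partition : ∀ {n} (S : Fin n → Bool) → Partition S
partition {zero}  S = record
  { m₁ = 0 ; m₂ = 0 ; index = λ () ; e₁ = λ () ; e₂ = λ () ; index-e₁ = λ () ; index-e₂ = λ ()
  ; e-index = λ () ; e₁-true = λ () ; e₂-false = λ () }
partition {suc n} S with S zero in S₀
... | true = record
  { m₁ = suc m₁ ; m₂ = m₂
  ; index    = λ { zero → inj₁ zero ; (suc i) → raise (index i) }
  ; e₁       = e₁′
  ; e₂       = suc ∘ e₂
  ; index-e₁ = λ { zero → refl ; (suc x) → cong raise (index-e₁ x) }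
  ; index-e₂ = λ x → cong raise (index-e₂ x)
  ; e-index  = λ { zero → refl ; (suc i) → trans (e-raise (index i)) (cong suc (e-index i)) }
  ; e₁-true  = λ { zero → S₀ ; (suc x) → e₁-true x }
  ; e₂-false = e₂-false
  }
  where
  open Partition (partition (S ∘ suc))
  raise : Fin m₁ ⊎ Fin m₂ → Fin (suc m₁) ⊎ Fin m₂
  raise = [ inj₁ ∘ suc , inj₂ ]′
  e₁′ : Fin (suc m₁) → Fin (suc n)
  e₁′ zero    = zero
  e₁′ (suc x) = suc (e₁ x)
  e-raise : ∀ z → [ e₁′ , suc ∘ e₂ ]′ (raise z) ≡ suc ([ e₁ , e₂ ]′ z)
  e-raise (inj₁ x) = refl
  e-raise (inj₂ x) = refl
... | false = record
  { m₁ = m₁ ; m₂ = suc m₂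
  ; index    = λ { zero → inj₂ zero ; (suc i) → raise (index i) }
  ; e₁       = suc ∘ e₁
  ; e₂       = e₂′
  ; index-e₁ = λ x → cong raise (index-e₁ x)
  ; index-e₂ = λ { zero → refl ; (suc x) → cong raise (index-e₂ x) }
  ; e-index  = λ { zero → refl ; (suc i) → trans (e-raise (index i)) (cong suc (e-index i)) }
  ; e₁-true  = e₁-true
  ; e₂-false = λ { zero → S₀ ; (suc x) → e₂-false x }
  }
  where
  open Partition (partition (S ∘ suc))
  raise : Fin m₁ ⊎ Fin m₂ → Fin m₁ ⊎ Fin (suc m₂)
  raise = [ inj₁ , inj₂ ∘ suc ]′
  e₂′ : Fin (suc m₂) → Fin (suc n)
  e₂′ zero    = zero
  e₂′ (suc x) = suc (e₂ x)
  e-raise : ∀ z → [ suc ∘ e₁ , e₂′ ]′ (raise z) ≡ suc ([ e₁ , e₂ ]′ z)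
  e-raise (inj₁ x) = refl
  e-raise (inj₂ x) = refl

-- From uniform signs on each part to the disjoint union

constant⇒PMComplete : ∀ {m} (H : Matrix m) → (∀ i → H i i ≡ 0ℤ) → (X : Fin m → Bool) (η : ℤ) →
  η ≡ 1ℤ ⊎ η ≡ -1ℤ → (∀ i j → i ≢ j → switch X H i j ≡ η) → SwitchingIsoToPMComplete H
constant⇒PMComplete {m} H loopless X η η≡±1 off-diagonal = by-sign η≡±1
  where
  diagonal : ∀ i → switch X H i i ≡ 0ℤ
  diagonal i with X i
  ... | true  = loopless i
  ... | false = loopless i

  by-sign : _ → SwitchingIsoToPMComplete H
  by-sign (inj₁ refl) = inj₁ (X , ↔-id (Fin m) , agree)
    where
    agree : ∀ i j → completeM m i j ≡ switch X H i j
    agree i j with i Fin.≟ j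
    ... | yes refl = sym (diagonal i)
    ... | no  i≢j  = sym (off-diagonal i j i≢j)
  by-sign (inj₂ refl) = inj₂ (X , ↔-id (Fin m) , agree)
    where
    agree : ∀ i j → negM (completeM m) i j ≡ switch X H i j
    agree i j with i Fin.≟ j
    ... | yes refl = sym (diagonal i)
    ... | no  i≢j  = sym (off-diagonal i j i≢j)

two≤ : ∀ {n} {u v : Fin n} → u ≢ v → 2 ≤ n
two≤ {suc zero}    {zero} {zero} u≢v = contradiction refl u≢v
two≤ {suc (suc n)}               u≢v = s≤s (s≤s z≤n)

inhabited : ∀ {m} → Fin m → 1 ≤ m
inhabited {suc m} _ = s≤s z≤n

TwoPMCompleteParts : ∀ {n} → Matrix n → Set
TwoPMCompleteParts A =
  Σ ℕ λ m₁ → Σ ℕ λ m₂ → Σ (Matrix m₁) λ H₁ → Σ (Matrix m₂) λ H₂ →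
    IsSignedGraph H₁ × IsSignedGraph H₂ × 1 ≤ m₁ × 1 ≤ m₂ ×
    Isomorphic A (H₁ ⊕ H₂) ×
    SwitchingIsoToPMComplete H₁ × SwitchingIsoToPMComplete H₂

module _ {n} {A : Matrix n} (isSignedGraph : IsSignedGraph A) where
  open IsSignedGraph isSignedGraph
  open SignedGraph A isSignedGraph

  closed-block : ∀ {u} (C : Component A u) → let open Component C in ∀ i j → S i ≢ S j → A i j ≡ 0ℤ
  closed-block C i j Sᵢ≢Sⱼ with A i j ℤ.≟ 0ℤ
  ... | yes A≡0 = A≡0
  ... | no  A≢0 = contradiction same Sᵢ≢Sⱼ
    where
    open Component C
    same : S i ≡ S j
    same with S i in Sᵢ | S j in Sⱼ
    ... | true  | true  = refl
    ... | false | false = refl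
    ... | true  | false = trans (sym (closed i j Sᵢ A≢0)) Sⱼ
    ... | false | true  = trans (sym Sᵢ) (closed j i Sⱼ (adjacent-sym A≢0))

  module _ (S : Fin n → Bool) (A-block : ∀ i j → S i ≢ S j → A i j ≡ 0ℤ)
    {u v : Fin n} (u∈S : S u ≡ true) (v∉S : S v ≡ false) where

    blocks-uniform : ¬ HasIsolatedEdge A → Operators.Quadratic A symmetric → ∀ o → UniformAfterSwitching A S o
    blocks-uniform no-isolated quad = RankOneBlocks.block-switching no-isolated S A-block N-block
      (Blocks.RankOne.N-rank-one S N σ δ N-sym N-block N³≡ tr-N tr-N² N≢0)
      where
      open CubicRelation A isSignedGraph quad using (σ; δ; N³≡; tr-N; tr-N²)

      N-block : ∀ i j → S i ≢ S j → N i j ≡ 0ℤ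
      N-block i j Sᵢ≢Sⱼ = cong₂ _-_ (∑-zero across) (unit-other (Sᵢ≢Sⱼ ∘ cong S))
        where
        across : ∀ l → A i l * A l j ≡ 0ℤ
        across l with S i Bool.≟ S l
        ... | yes Sᵢ≡Sₗ = trans (cong (A i l *_) (A-block l j (Sᵢ≢Sⱼ ∘ trans Sᵢ≡Sₗ))) (ℤₚ.*-zeroʳ (A i l))
        ... | no  Sᵢ≢Sₗ = cong (_* A l j) (A-block i l Sᵢ≢Sₗ)

      representative : ∀ β → ∃ λ i → S i ≡ β
      representative true  = u , u∈S
      representative false = v , v∉S

      N≢0 : ∀ β → ∃₂ λ i w → S i ≡ β × N i w ≢ 0ℤ
      N≢0 β = proj₁ i , proj₁ w , proj₂ i , proj₂ w
        where
        i : ∃ λ i → S i ≡ β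
        i = representative β
        w : ∃ λ w → N (proj₁ i) w ≢ 0ℤ
        w = Finₚ.¬∀⟶∃¬ n (λ w → N (proj₁ i) w ≡ 0ℤ) (λ w → N (proj₁ i) w ℤ.≟ 0ℤ) (N-row≢0 no-isolated (proj₁ i))

    decompose : UniformAfterSwitching A S u → UniformAfterSwitching A S v → TwoPMCompleteParts A
    decompose (ε₁ , X₁ , ε₁≡±1 , uniform₁) (ε₂ , X₂ , ε₂≡±1 , uniform₂) =
      m₁ , m₂ , H₁ , H₂ ,
      induced e₁ , induced e₂ ,
      inhabited (in₁ u u∈S) , inhabited (in₂ v v∉S) ,
      (mk↔ₛ′ to from to-from from-to , blocks) ,
      constant⇒PMComplete H₁ (λ x → loopless (e₁ x)) (X₁ ∘ e₁) ε₁ ε₁≡±1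
        (λ x y x≢y → uniform₁ (trans (e₁-true x) (sym u∈S)) (trans (e₁-true y) (sym u∈S)) (x≢y ∘ e₁-injective)) ,
      constant⇒PMComplete H₂ (λ x → loopless (e₂ x)) (X₂ ∘ e₂) ε₂ ε₂≡±1
        (λ x y x≢y → uniform₂ (trans (e₂-false x) (sym v∉S)) (trans (e₂-false y) (sym v∉S)) (x≢y ∘ e₂-injective))
      where
      open Partition (partition S)

      H₁ : Matrix m₁
      H₁ x y = A (e₁ x) (e₁ y)

      H₂ : Matrix m₂
      H₂ x y = A (e₂ x) (e₂ y)

      induced : ∀ {m} (e : Fin m → Fin n) → IsSignedGraph (λ x y → A (e x) (e y))
      induced e = record
        { symmetric = λ x y → symmetric (e x) (e y)
        ; loopless  = λ x → loopless (e x)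
        ; entries   = λ x y → entries (e x) (e y)
        }

      e₁-injective : ∀ {x y} → e₁ x ≡ e₁ y → x ≡ y
      e₁-injective {x} {y} eq with trans (sym (index-e₁ x)) (trans (cong index eq) (index-e₁ y))
      ... | refl = refl

      e₂-injective : ∀ {x y} → e₂ x ≡ e₂ y → x ≡ y
      e₂-injective {x} {y} eq with trans (sym (index-e₂ x)) (trans (cong index eq) (index-e₂ y))
      ... | refl = refl

      in₁ : ∀ i → S i ≡ true → Fin m₁
      in₁ i Sᵢ with index i | e-index i
      ... | inj₁ x | _  = x
      ... | inj₂ x | eq = contradiction (trans (sym (e₂-false x)) (trans (cong S eq) Sᵢ)) λ ()

      in₂ : ∀ i → S i ≡ false → Fin m₂
      in₂ i Sᵢ with index i | e-index i
      ... | inj₂ x | _  = x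
      ... | inj₁ x | eq = contradiction (trans (sym (e₁-true x)) (trans (cong S eq) Sᵢ)) λ ()

      to : Fin n → Fin (m₁ ℕ.+ m₂)
      to i = join m₁ m₂ (index i)

      from : Fin (m₁ ℕ.+ m₂) → Fin n
      from x = [ e₁ , e₂ ]′ (splitAt m₁ x)

      to-from : ∀ x → to (from x) ≡ x
      to-from x = trans (cong (join m₁ m₂) (index-e (splitAt m₁ x))) (Finₚ.join-splitAt m₁ m₂ x)
        where
        index-e : ∀ z → index ([ e₁ , e₂ ]′ z) ≡ z
        index-e (inj₁ x) = index-e₁ x
        index-e (inj₂ x) = index-e₂ x

      from-to : ∀ i → from (to i) ≡ i
      from-to i = trans (cong [ e₁ , e₂ ]′ (Finₚ.splitAt-join m₁ m₂ (index i))) (e-index i)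

      blocks : ∀ i j → (H₁ ⊕ H₂) (to i) (to j) ≡ A i j
      blocks i j = trans
        (cong₂ (blockM H₁ H₂) (Finₚ.splitAt-join m₁ m₂ (index i)) (Finₚ.splitAt-join m₁ m₂ (index j)))
        (trans (embed (index i) (index j)) (cong₂ A (e-index i) (e-index j)))
        where
        apart : ∀ {x y} → S x ≡ true → S y ≡ false → S x ≢ S y
        apart Sx Sy eq = contradiction (trans (sym Sx) (trans eq Sy)) λ ()
        embed : ∀ z w → blockM H₁ H₂ z w ≡ A ([ e₁ , e₂ ]′ z) ([ e₁ , e₂ ]′ w)
        embed (inj₁ x) (inj₁ y) = refl
        embed (inj₂ x) (inj₂ y) = refl
        embed (inj₁ x) (inj₂ y) = sym (A-block _ _ (apart (e₁-true x) (e₂-false y)))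
        embed (inj₂ x) (inj₁ y) = sym (A-block _ _ (apart (e₁-true y) (e₂-false x) ∘ sym))

theorem2p4 : (n : ℕ) (A : Matrix n) → IsSignedGraph A →
    AllButAtMostTwoEigenvaluesPM1 A → Disconnected A → ¬ HasIsolatedEdge A →
    Σ ℕ λ m₁ → Σ ℕ λ m₂ → Σ (Matrix m₁) λ H₁ → Σ (Matrix m₂) λ H₂ →
    IsSignedGraph H₁ × IsSignedGraph H₂ × 1 ≤ m₁ × 1 ≤ m₂ ×
    Isomorphic A (H₁ ⊕ H₂) ×
    SwitchingIsoToPMComplete H₁ × SwitchingIsoToPMComplete H₂
theorem2p4 n A isSignedGraph eigenvalues (u , v , u↛v) no-isolated =
  decompose isSignedGraph S A-block root v∉S (uniform u) (uniform v)
  where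
  open Component (component A u)

  A-block : ∀ i j → S i ≢ S j → A i j ≡ 0ℤ
  A-block = closed-block isSignedGraph (component A u)

  v∉S : S v ≡ false
  v∉S = Boolₚ.¬-not λ Sᵥ → u↛v (reachable v Sᵥ)

  u≢v : u ≢ v
  u≢v refl = u↛v Star.ε

  uniform : ∀ o → UniformAfterSwitching A S o
  uniform = blocks-uniform isSignedGraph S A-block root v∉S no-isolated
    -- The two vertices that witness disconnectedness are distinct, which gives the bound 2 ≤ n
    -- under which n ∸ 2 is a true difference.
    (Operators.quadratic A (IsSignedGraph.symmetric isSignedGraph) (two≤ u≢v) eigenvalues)
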